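{- Let $p$ be an odd prime, and let $A_n=\sum_{k=0}^n\binom{2k}k\binom{2n-2k}{n-k}\binom nk^2$. If $p\equiv 1,3\pmod 8$, so that $p=x^2+2y^2$ for some integers $x,y$, then $\sum_{n=0}^{p-1}\frac{A_n}{8^n}\equiv 4x^2\pmod p$. If $p\equiv 5,7\pmod 8$, then $\sum_{n=0}^{p-1}\frac{A_n}{8^n}\equiv 0\pmod p$.
   Context: Congruences modulo $p$ are between rational numbers whose denominators are prime to $p$. -}

module Defs where

open import Data.Nat as ℕ using (ℕ; zero; suc; _^_; NonZero)
open import Data.Nat.Properties using (m^n≢0)
open import Data.Nat.Combinatorics using (_C_)
open import Data.Nat.Divisibility using (_∣_)
open import Data.List using (List; map; upTo; foldr)
open import Data.Nat.ListAction using (sum)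
open import Data.Integer as ℤ using (ℤ; +_; ∣_∣)
open import Data.Rational as ℚ using (ℚ; _/_; ↥_; ↧ₙ_; _-_)
open import Data.Product using (_×_)
open import Relation.Nullary using (¬_)

A : ℕ → ℕ
A n = sum (map (λ k → ((2 ℕ.* k) C k) ℕ.* (((2 ℕ.* n) ℕ.∸ (2 ℕ.* k)) C (n ℕ.∸ k))
                         ℕ.* ((n C k) ℕ.* (n C k)))
               (upTo (suc n)))

term : ℕ → ℚ
term n = (+ A n) / (8 ^ n)
  where instance _ = m^n≢0 8 n

sumQ : ℕ → ℚ
sumQ m = foldr ℚ._+_ ℚ.0ℚ (map term (upTo m))

_≡_[modℚ_] : ℚ → ℚ → ℕ → Set
a ≡ b [modℚ p ] = (¬ p ∣ ↧ₙ a) × (¬ p ∣ ↧ₙ b) × (p ∣ ∣ ↥ (a - b) ∣)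

{-# OPTIONS --safe #-}
module Submission where

-- Put p = 2m + 1 and C(n,k) for binomial coefficients.  Modulo p one has C(2k,k) ≡ (−4)ᵏ C(m,k) for k < p, so
-- the sum becomes Σ C(m,k) C(m,j) C(k+j,k)² (−1/2)^(k+j) over k, j ≤ m.  Since C(N,k)² is the coefficient of
-- zᵏuᵏ in ((1+z)(1+u))^N, this is 4^(−m) times the coefficient of zᵐuᵐ in ((z+u)² − (1−zu)²)ᵐ, and the binomial
-- theorem gives Σ C(m,l) C(2l,l) C(2m−2l,m−l) for that coefficient.  Hence the sum is ≡ (−1)ᵐ F with
-- F = Σ C(m,l)³ = Σ C(m,n)² C(2n,m).
--
-- F is evaluated with θ(q) = Σ q^(x²).  Put a = θ(q)², b = θ(q²)², c = θ(q⁴)².  If e and d are the even and odd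
-- parts of θ(q), then a = (e+d)², b = e² + d², c = e², so (a−b)² = 4c(b−c).  Landen's transformation modulo p
-- then says that H = Σ C(m,i)² (a−b)^(2i) b^(2(m−i)) is invariant under q ↦ q², so H ≡ 1.  Multiply the Wronskian
-- W = θ(q²) D θ(q) − θ(q) D θ(q²), D = q d/dq, by H ≡ 1 and expand in powers of f = θ(q) and g = θ(q²).  As
-- fⁱ gʲ W ≡ D(f^(i+1) g^(j+1)) / (i+1) when i + j = 2p − 2, its coefficient of q^p vanishes unless p ∣ i + 1, and
-- only i = j = 2m survives: the coefficient of q^p in W is ≡ 2 (−1)ᵐ F.  On the other hand
-- W = Σ (x² − 2y²) q^(x² + 2y²) over all integers x, y, whose coefficient of q^p is 4(x² − 2y²) ≡ 8x² if
-- p = x² + 2y² and 0 if p is not of this form.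

import Defs
open import Algebra.Bundles using (AbelianGroup; CommutativeRing)
import Algebra.Properties.AbelianGroup as AbelianGroupProperties
import Algebra.Properties.CommutativeMonoid.Sum as Sum
import Algebra.Properties.CommutativeSemiring.Binomial as BinomialTheorem
import Algebra.Properties.CommutativeSemiring.Exp as ExpProperties
import Algebra.Properties.Group as GroupProperties
import Algebra.Properties.Ring as RingProperties
import Algebra.Properties.Semiring.Mult as Mult
import Algebra.Solver.Ring as RingSolver
import Algebra.Solver.Ring.AlmostCommutativeRing as ACR
open import Data.Fin.Base using (Fin; toℕ; fromℕ<) renaming (zero to fzero; suc to fsuc)
open import Data.Fin.Properties using (all?; toℕ-fromℕ<)
open import Data.Integer as ℤ using (ℤ; +_; -[1+_]; +0; +[1+_]; ∣_∣)
open import Data.Integer.Divisibility.Signed as ℤ∣ using () renaming (_∣_ to _∣ℤ_)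
open import Data.Integer.GCD using (gcd)
import Data.Integer.Properties as ℤₚ
import Data.Integer.Solver as ℤ-Solver
open import Data.List using (List; []; _∷_; _++_; length; map; filter; upTo; applyUpTo; cartesianProduct; foldr)
open import Data.List.Membership.Propositional using (_∈_)
open import Data.List.Membership.Propositional.Properties using (∈-filter⁺; ∈-filter⁻; ∈-map⁺; ∈-map⁻; ∈-++⁺ˡ; ∈-++⁺ʳ; ∈-upTo⁺; ∈-cartesianProduct⁺)
open import Data.List.Membership.Propositional.Properties.WithK using (unique∧set⇒bag)
import Data.List.Properties as Listₚ
open import Data.List.Relation.Binary.BagAndSetEquality using (∼bag⇒↭)
open import Data.List.Relation.Binary.Permutation.Propositional.Properties using (↭-length)
import Data.List.Relation.Unary.All as All
import Data.List.Relation.Unary.AllPairs as AllPairs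
open import Data.List.Relation.Unary.Any using (here; there)
open import Data.List.Relation.Unary.Unique.Propositional using (Unique)
import Data.List.Relation.Unary.Unique.Propositional.Properties as Uniqueₚ
import Data.Maybe.Base as Maybe
open import Data.Nat as ℕ using (ℕ; zero; suc; _∸_; _%_; _≤_; _<_; z≤n; s≤s; _!)
open import Data.Nat.Combinatorics using (_C_; nCk+nC[k+1]≡[n+1]C[k+1]; k>n⇒nCk≡0; nCn≡1; nCk≡nC[n∸k]; nCk≡n!/k![n-k]!; k![n∸k]!∣n!)
open import Data.Nat.Divisibility as ℕ∣ using (_∣_; _∤_; >⇒∤)
open import Data.Nat.DivMod using (m/n*n≡m; %-distribˡ-+; %-distribˡ-*; m%n<n)
open import Data.Nat.Induction using (<-rec)
open import Data.Nat.ListAction using (sum)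
open import Data.Nat.Primality using (Prime; euclidsLemma; prime⇒irreducible; prime⇒nonTrivial; prime[2])
import Data.Nat.Properties as ℕₚ
import Data.Nat.Solver as ℕ-Solver
open import Data.Product using (∃; _×_; _,_; proj₁; proj₂)
import Data.Rational as ℚ
import Data.Rational.Properties as ℚₚ
open import Data.Sum using (_⊎_; inj₁; inj₂)
open import Function using (_∘_)
open import Function.Bundles using (mk⇔)
open import Level using (Level; _⊔_; 0ℓ)
open import Relation.Binary.Definitions using (tri<; tri≈; tri>)
open import Relation.Binary.PropositionalEquality as ≡ using (_≡_; _≢_)
import Relation.Binary.Reasoning.Setoid as SetoidReasoning
open import Relation.Nullary using (¬_; Dec; yes; no; contradiction)
open import Relation.Nullary.Decidable using (dec⇒maybe; from-yes; ¬?; _×-dec_)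

-- H is multiplied in for its degree: as a polynomial in f and g it is homogeneous of degree 4m = 2p
-- - 2, the degree in which fⁱ gʲ W becomes a derivative up to multiples of p. Its value 1 needs no
-- theory of modular forms: invariance under q ↦ q² equates the coefficient at 2k with the one at k
-- and kills the odd ones, so H is constant. The surviving term f^(2m) g^(2m) W has i + 1 = p and
-- escapes the derivative argument; its coefficient comes from running the same argument again on f
-- - g and g, whose Wronskian is also W. Since f - g = 2q + ..., what remains starts at q^p with
-- coefficient 4^m · 2, and 4^m ≡ 1. Two choices shape the setting. The argument cancels instead of
-- dividing: a ring only has to satisfy p = 0 and allow cancellation of integers prime to p. Power
-- series over it then do the same, so the congruence for C(2k,k) serves for the sum and again, over
-- power series, in Landen's transformation. And series in q are compared one coefficient at a time,
-- so each theta identity becomes a bijection between solution sets inside a finite box.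

module RingTools {c ℓ : Level} (R : CommutativeRing c ℓ) where
  open CommutativeRing R public hiding (zero)
  open RingProperties ring public using (-‿distribˡ-*; -‿distribʳ-*)
  open AbelianGroupProperties +-abelianGroup public using (⁻¹-∙-comm; ε⁻¹≈ε; ⁻¹-involutive; x∙y⁻¹≈ε⇒x≈y)
  open ExpProperties commutativeSemiring public using (_^_; ^-congˡ; ^-congʳ; ^-homo-*; ^-distrib-*)
  open SetoidReasoning setoid public

  -- The separate clause for 1 makes `ι 1` definitionally `1#`, so that the solver constant
  -- `con (+ 1)` matches `1#` in goals.
  ι : ℕ → Carrier
  ι zero          = 0#
  ι (suc zero)    = 1#
  ι (suc (suc n)) = 1# + ι (suc n)

  ι-suc : ∀ n → ι (suc n) ≈ 1# + ι n
  ι-suc zero    = sym (+-identityʳ 1#)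
  ι-suc (suc n) = refl

  ι-cong : ∀ {m n} → m ≡ n → ι m ≈ ι n
  ι-cong ≡.refl = refl

  ι-+ : ∀ m n → ι (m ℕ.+ n) ≈ ι m + ι n
  ι-+ zero    n = sym (+-identityˡ _)
  ι-+ (suc m) n = begin
    ι (suc (m ℕ.+ n))     ≈⟨ ι-suc (m ℕ.+ n) ⟩
    1# + ι (m ℕ.+ n)      ≈⟨ +-congˡ (ι-+ m n) ⟩
    1# + (ι m + ι n)      ≈⟨ +-assoc _ _ _ ⟨
    1# + ι m + ι n        ≈⟨ +-congʳ (ι-suc m) ⟨
    ι (suc m) + ι n       ∎

  ι-* : ∀ m n → ι (m ℕ.* n) ≈ ι m * ι n
  ι-* zero    n = sym (zeroˡ _)
  ι-* (suc m) n = begin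
    ι (n ℕ.+ m ℕ.* n)     ≈⟨ ι-+ n (m ℕ.* n) ⟩
    ι n + ι (m ℕ.* n)     ≈⟨ +-cong (sym (*-identityˡ _)) (ι-* m n) ⟩
    1# * ι n + ι m * ι n  ≈⟨ distribʳ _ _ _ ⟨
    (1# + ι m) * ι n      ≈⟨ *-congʳ (ι-suc m) ⟨
    ι (suc m) * ι n       ∎

  ι-^ : ∀ m n → ι (m ℕ.^ n) ≈ ι m ^ n
  ι-^ m zero    = refl
  ι-^ m (suc n) = trans (ι-* m (m ℕ.^ n)) (*-congˡ (ι-^ m n))

  -- Coefficient map for the ring solver: with ℤ as coefficient ring, numerals such as 4 and 8 are
  -- normalised over any commutative ring.
  ιℤ : ℤ → Carrier
  ιℤ (+ n)    = ι n
  ιℤ -[1+ n ] = - ι (suc n)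

  ιℤ-neg : ∀ i → ιℤ (ℤ.- i) ≈ - ιℤ i
  ιℤ-neg -[1+ n ] = sym (⁻¹-involutive _)
  ιℤ-neg +0       = sym ε⁻¹≈ε
  ιℤ-neg +[1+ n ] = refl

  ιℤ-⊖ : ∀ m n → ιℤ (m ℤ.⊖ n) ≈ ι m - ι n
  ιℤ-⊖ m zero = sym (trans (+-congˡ ε⁻¹≈ε) (+-identityʳ _))
  ιℤ-⊖ zero (suc n) = sym (+-identityˡ _)
  ιℤ-⊖ (suc m) (suc n) = begin
    ιℤ (suc m ℤ.⊖ suc n)              ≡⟨ ≡.cong ιℤ (ℤₚ.[1+m]⊖[1+n]≡m⊖n m n) ⟩
    ιℤ (m ℤ.⊖ n)                      ≈⟨ ιℤ-⊖ m n ⟩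
    ι m - ι n                         ≈⟨ +-congʳ (+-identityʳ _) ⟨
    (ι m + 0#) - ι n                  ≈⟨ +-congʳ (+-congˡ (-‿inverseʳ 1#)) ⟨
    (ι m + (1# - 1#)) - ι n           ≈⟨ +-congʳ (+-assoc _ _ _) ⟨
    ((ι m + 1#) - 1#) - ι n           ≈⟨ +-assoc _ _ _ ⟩
    (ι m + 1#) + (- 1# - ι n)         ≈⟨ +-cong (+-comm _ _) (⁻¹-∙-comm _ _) ⟩
    (1# + ι m) - (1# + ι n)           ≈⟨ +-cong (ι-suc m) (-‿cong (ι-suc n)) ⟨
    ι (suc m) - ι (suc n)             ∎

  ιℤ-+ : ∀ i j → ιℤ (i ℤ.+ j) ≈ ιℤ i + ιℤ j
  ιℤ-+ (+ m)    (+ n)    = ι-+ m n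
  ιℤ-+ (+ m)    -[1+ n ] = ιℤ-⊖ m (suc n)
  ιℤ-+ -[1+ m ] (+ n)    = trans (ιℤ-⊖ n (suc m)) (+-comm _ _)
  ιℤ-+ -[1+ m ] -[1+ n ] = begin
    - ι (suc (suc (m ℕ.+ n)))   ≡⟨ ≡.cong (λ k → - ι (suc k)) (ℕₚ.+-suc m n) ⟨
    - ι (suc m ℕ.+ suc n)       ≈⟨ -‿cong (ι-+ (suc m) (suc n)) ⟩
    - (ι (suc m) + ι (suc n))   ≈⟨ ⁻¹-∙-comm _ _ ⟨
    - ι (suc m) - ι (suc n)     ∎

  ιℤ-*ⁿ : ∀ m j → ιℤ (+ m ℤ.* j) ≈ ι m * ιℤ j
  ιℤ-*ⁿ m (+ n)    = trans (reflexive (≡.cong ιℤ (≡.sym (ℤₚ.pos-* m n)))) (ι-* m n)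
  ιℤ-*ⁿ m -[1+ n ] = begin
    ιℤ (+ m ℤ.* -[1+ n ])        ≡⟨ ≡.cong ιℤ (ℤₚ.neg-distribʳ-* (+ m) +[1+ n ]) ⟨
    ιℤ (ℤ.- (+ m ℤ.* +[1+ n ]))  ≈⟨ ιℤ-neg (+ m ℤ.* +[1+ n ]) ⟩
    - ιℤ (+ m ℤ.* +[1+ n ])      ≈⟨ -‿cong (ιℤ-*ⁿ m +[1+ n ]) ⟩
    - (ι m * ι (suc n))          ≈⟨ -‿distribʳ-* _ _ ⟩
    ι m * - ι (suc n)            ∎

  ιℤ-* : ∀ i j → ιℤ (i ℤ.* j) ≈ ιℤ i * ιℤ j
  ιℤ-* (+ m)    j = ιℤ-*ⁿ m j
  ιℤ-* -[1+ m ] j = begin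
    ιℤ (-[1+ m ] ℤ.* j)          ≡⟨ ≡.cong ιℤ (ℤₚ.neg-distribˡ-* +[1+ m ] j) ⟨
    ιℤ (ℤ.- (+[1+ m ] ℤ.* j))    ≈⟨ ιℤ-neg (+[1+ m ] ℤ.* j) ⟩
    - ιℤ (+[1+ m ] ℤ.* j)        ≈⟨ -‿cong (ιℤ-*ⁿ (suc m) j) ⟩
    - (ι (suc m) * ιℤ j)         ≈⟨ -‿distribˡ-* _ _ ⟩
    - ι (suc m) * ιℤ j           ∎

  square-^ : ∀ x n → (x * x) ^ n ≈ x ^ (2 ℕ.* n)
  square-^ x n = begin
    (x * x) ^ n         ≈⟨ ^-distrib-* x x n ⟩
    x ^ n * x ^ n       ≈⟨ ^-homo-* x n n ⟨
    x ^ (n ℕ.+ n)       ≈⟨ ^-congʳ x (≡.cong (n ℕ.+_) (ℕₚ.+-identityʳ n)) ⟨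
    x ^ (2 ℕ.* n)       ∎

  1^n≈1 : ∀ n → 1# ^ n ≈ 1#
  1^n≈1 zero    = refl
  1^n≈1 (suc n) = trans (*-identityˡ _) (1^n≈1 n)

  private
    almostCommutativeRing = ACR.fromCommutativeRing R

    morphism : ACR._-Raw-AlmostCommutative⟶_ ℤ.+-*-rawRing almostCommutativeRing
    morphism = record
      { ⟦_⟧ = ιℤ ; +-homo = ιℤ-+ ; *-homo = ιℤ-* ; -‿homo = ιℤ-neg
      ; 0-homo = refl ; 1-homo = refl }

    coeff≟ : ∀ i j → Maybe.Maybe (ιℤ i ≈ ιℤ j)
    coeff≟ i j = Maybe.map (λ eq → reflexive (≡.cong ιℤ eq)) (dec⇒maybe (i ℤ.≟ j))

  open RingSolver ℤ.+-*-rawRing almostCommutativeRing morphism coeff≟ public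
    using (solve; _:=_; _:+_; _:*_; _:-_; :-_; con)

  -- Kept opaque so that unification can read length and summand off a sum; outside, `∑-empty` and
  -- `∑-suc` replace computation.
  opaque
    ∑ : ℕ → (ℕ → Carrier) → Carrier
    ∑ zero    f = 0#
    ∑ (suc n) f = f zero + ∑ n (λ k → f (suc k))

    ∑-cong : ∀ n {f g} → (∀ k → k < n → f k ≈ g k) → ∑ n f ≈ ∑ n g
    ∑-cong zero    e = refl
    ∑-cong (suc n) e = +-cong (e 0 (s≤s z≤n)) (∑-cong n (λ k k<n → e (suc k) (s≤s k<n)))

    ∑-zero : ∀ n {f} → (∀ k → k < n → f k ≈ 0#) → ∑ n f ≈ 0#
    ∑-zero zero    e = refl
    ∑-zero (suc n) e = trans (+-cong (e 0 (s≤s z≤n)) (∑-zero n (λ k k<n → e (suc k) (s≤s k<n)))) (+-identityˡ 0#)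

    ∑-+ : ∀ n f g → ∑ n (λ k → f k + g k) ≈ ∑ n f + ∑ n g
    ∑-+ zero    f g = sym (+-identityˡ 0#)
    ∑-+ (suc n) f g = begin
      f 0 + g 0 + ∑ n (λ k → f (suc k) + g (suc k))
        ≈⟨ +-congˡ (∑-+ n (λ k → f (suc k)) (λ k → g (suc k))) ⟩
      f 0 + g 0 + (∑ n (λ k → f (suc k)) + ∑ n (λ k → g (suc k)))
        ≈⟨ solve 4 (λ a b s t → a :+ b :+ (s :+ t) := a :+ s :+ (b :+ t)) refl _ _ _ _ ⟩
      f 0 + ∑ n (λ k → f (suc k)) + (g 0 + ∑ n (λ k → g (suc k))) ∎

    ∑-*ˡ : ∀ n c f → c * ∑ n f ≈ ∑ n (λ k → c * f k)
    ∑-*ˡ zero    c f = zeroʳ c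
    ∑-*ˡ (suc n) c f = trans (distribˡ c _ _) (+-congˡ (∑-*ˡ n c (λ k → f (suc k))))

    ∑-*ʳ : ∀ n c f → ∑ n f * c ≈ ∑ n (λ k → f k * c)
    ∑-*ʳ n c f = trans (*-comm _ c) (trans (∑-*ˡ n c f) (∑-cong n (λ k _ → *-comm c (f k))))

    ∑-swap : ∀ m n (f : ℕ → ℕ → Carrier) → ∑ m (λ i → ∑ n (f i)) ≈ ∑ n (λ j → ∑ m (λ i → f i j))
    ∑-swap zero    n f = sym (∑-zero n (λ _ _ → refl))
    ∑-swap (suc m) n f = trans (+-congˡ (∑-swap m n (λ i → f (suc i))))
      (sym (∑-+ n (f 0) (λ j → ∑ m (λ i → f (suc i) j))))

    ∑-last : ∀ n f → ∑ (suc n) f ≈ ∑ n f + f n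
    ∑-last zero    f = +-comm (f 0) 0#
    ∑-last (suc n) f = trans (+-congˡ (∑-last n (λ k → f (suc k)))) (sym (+-assoc _ _ _))

    ∑-empty : ∀ f → ∑ 0 f ≈ 0#
    ∑-empty f = refl

    ∑-suc : ∀ n f → ∑ (suc n) f ≈ f 0 + ∑ n (λ k → f (suc k))
    ∑-suc n f = refl

    ∑-reverse : ∀ n f → ∑ n f ≈ ∑ n (λ k → f (n ∸ suc k))
    ∑-reverse zero    f = refl
    ∑-reverse (suc n) f = trans (∑-last n f) (trans (+-comm _ _) (+-congˡ (∑-reverse n f)))

    ∑-split : ∀ m n f → ∑ (m ℕ.+ n) f ≈ ∑ m f + ∑ n (λ k → f (m ℕ.+ k))
    ∑-split zero    n f = sym (+-identityˡ _)
    ∑-split (suc m) n f = trans (+-congˡ (∑-split m n (λ k → f (suc k)))) (sym (+-assoc _ _ _))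

    ∑-truncate : ∀ {m n} f → m ≤ n → (∀ k → m ≤ k → f k ≈ 0#) → ∑ n f ≈ ∑ m f
    ∑-truncate {m} {n} f m≤n e = begin
      ∑ n f                                  ≡⟨ ≡.cong (λ k → ∑ k f) (ℕₚ.m+[n∸m]≡n m≤n) ⟨
      ∑ (m ℕ.+ (n ∸ m)) f                    ≈⟨ ∑-split m (n ∸ m) f ⟩
      ∑ m f + ∑ (n ∸ m) (λ k → f (m ℕ.+ k))  ≈⟨ +-congˡ (∑-zero (n ∸ m) (λ k _ → e (m ℕ.+ k) (ℕₚ.m≤m+n m k))) ⟩
      ∑ m f + 0#                             ≈⟨ +-identityʳ _ ⟩
      ∑ m f                                  ∎

    ∑-single : ∀ n i f → i < n → (∀ k → k < n → k ≢ i → f k ≈ 0#) → ∑ n f ≈ f i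
    ∑-single (suc n) zero f _ e =
      trans (+-congˡ (∑-zero n (λ k k<n → e (suc k) (s≤s k<n) (λ ())))) (+-identityʳ _)
    ∑-single (suc n) (suc i) f (s≤s i<n) e =
      trans (+-cong (e 0 (s≤s z≤n) (λ ()))
                    (∑-single n i (λ k → f (suc k)) i<n
                      (λ k k<n k≢i → e (suc k) (s≤s k<n) (λ eq → k≢i (ℕₚ.suc-injective eq)))))
            (+-identityˡ _)

    binomial-theorem : ∀ n x y → (x + y) ^ n ≈ ∑ (suc n) (λ k → ι (n C k) * (x ^ k * y ^ (n ∸ k)))
    binomial-theorem n x y = trans (Binomial.theorem n x y) (sum≈∑ (suc n) _ (λ k → ι (n C k) * (x ^ k * y ^ (n ∸ k)))
      (λ k → ×≈ι* (n C toℕ k) _))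
      where
      open Mult semiring using () renaming (_×_ to _·_)
      open Sum +-commutativeMonoid using () renaming (sum to sumᶠ)
      ×≈ι* : ∀ n z → n · z ≈ ι n * z
      ×≈ι* zero    z = sym (zeroˡ z)
      ×≈ι* (suc n) z = trans (+-cong (sym (*-identityˡ z)) (×≈ι* n z))
        (trans (sym (distribʳ z _ _)) (*-congʳ (sym (ι-suc n))))
      sum≈∑ : ∀ n (g : Fin n → Carrier) f → (∀ k → g k ≈ f (toℕ k)) → sumᶠ g ≈ ∑ n f
      sum≈∑ zero    g f e = refl
      sum≈∑ (suc n) g f e = +-cong (e fzero) (sum≈∑ n (λ k → g (fsuc k)) (λ k → f (suc k)) (λ k → e (fsuc k)))
      module Binomial = BinomialTheorem commutativeSemiring

-- Formal power series in one variable

module PowerSeries {c ℓ : Level} (R : CommutativeRing c ℓ) where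
  open RingTools R

  Series : Set c
  Series = ℕ → Carrier

  infix 4 _≋_
  -- A record rather than a function type, so that both series can be inferred from the type of an
  -- equation.
  record _≋_ (f g : Series) : Set ℓ where
    constructor coefficients
    field at : ∀ n → f n ≈ g n
  open _≋_ public

  tail : Series → Series
  tail f n = f (suc n)

  infixl 6 _⊕_
  infixl 7 _⊛_
  -- The product follows f = f(0) + X · `tail f`, which makes the ring laws inductions on the
  -- exponent; `⊛-∑` recovers the Cauchy sum.
  _⊕_ _⊛_ : Series → Series → Series
  (f ⊕ g) n = f n + g n
  (f ⊛ g) zero    = f 0 * g 0
  (f ⊛ g) (suc n) = f 0 * g (suc n) + (tail f ⊛ g) n

  ⊖_ : Series → Series
  (⊖ f) n = - f n

  𝟘 𝟙 : Series
  𝟘 n = 0#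
  𝟙 zero    = 1#
  𝟙 (suc n) = 0#

  private
    scale : Carrier → Series → Series
    scale a f n = a * f n

    ⊛-cong : ∀ {f f′ g g′} → (∀ n → f n ≈ f′ n) → (∀ n → g n ≈ g′ n) → ∀ n → (f ⊛ g) n ≈ (f′ ⊛ g′) n
    ⊛-cong e e′ zero    = *-cong (e 0) (e′ 0)
    ⊛-cong e e′ (suc n) = +-cong (*-cong (e 0) (e′ (suc n))) (⊛-cong (λ k → e (suc k)) e′ n)

    ⊛-distribʳ : ∀ h f g n → ((f ⊕ g) ⊛ h) n ≈ (f ⊛ h) n + (g ⊛ h) n
    ⊛-distribʳ h f g zero    = distribʳ _ _ _
    ⊛-distribʳ h f g (suc n) = trans (+-cong (distribʳ _ _ _) (⊛-distribʳ h (tail f) (tail g) n))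
      (solve 4 (λ a b s t → (a :+ b) :+ (s :+ t) := a :+ s :+ (b :+ t)) refl _ _ _ _)

    ⊛-scale : ∀ a f g n → (scale a f ⊛ g) n ≈ a * (f ⊛ g) n
    ⊛-scale a f g zero    = *-assoc _ _ _
    ⊛-scale a f g (suc n) = trans (+-cong (*-assoc _ _ _) (⊛-scale a (tail f) g n)) (sym (distribˡ _ _ _))

    ⊛-assoc : ∀ f g h n → ((f ⊛ g) ⊛ h) n ≈ (f ⊛ (g ⊛ h)) n
    ⊛-assoc f g h zero    = *-assoc _ _ _
    ⊛-assoc f g h (suc n) = begin
      f 0 * g 0 * h (suc n) + (tail (f ⊛ g) ⊛ h) n
        ≈⟨ +-congˡ (⊛-distribʳ h (scale (f 0) (tail g)) (tail f ⊛ g) n) ⟩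
      f 0 * g 0 * h (suc n) + ((scale (f 0) (tail g) ⊛ h) n + ((tail f ⊛ g) ⊛ h) n)
        ≈⟨ +-congˡ (+-cong (⊛-scale (f 0) (tail g) h n) (⊛-assoc (tail f) g h n)) ⟩
      f 0 * g 0 * h (suc n) + (f 0 * (tail g ⊛ h) n + (tail f ⊛ (g ⊛ h)) n)
        ≈⟨ solve 5 (λ a b x y z → a :* b :* x :+ (a :* y :+ z) := a :* (b :* x :+ y) :+ z) refl _ _ _ _ _ ⟩
      f 0 * (g 0 * h (suc n) + (tail g ⊛ h) n) + (tail f ⊛ (g ⊛ h)) n ∎

    ⊛-sucʳ : ∀ f g n → (f ⊛ g) (suc n) ≈ f (suc n) * g 0 + (f ⊛ tail g) n
    ⊛-sucʳ f g zero    = +-comm _ _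
    ⊛-sucʳ f g (suc n) = trans (+-congˡ (⊛-sucʳ (tail f) g n))
      (solve 3 (λ a b s → a :+ (b :+ s) := b :+ (a :+ s)) refl _ _ _)

    ⊛-comm : ∀ f g n → (f ⊛ g) n ≈ (g ⊛ f) n
    ⊛-comm f g zero    = *-comm _ _
    ⊛-comm f g (suc n) = trans (+-cong (*-comm _ _) (⊛-comm (tail f) g n)) (sym (⊛-sucʳ g f n))

    ⊛-zeroˡ : ∀ f n → (𝟘 ⊛ f) n ≈ 0#
    ⊛-zeroˡ f zero    = zeroˡ _
    ⊛-zeroˡ f (suc n) = trans (+-cong (zeroˡ _) (⊛-zeroˡ f n)) (+-identityˡ 0#)

    ⊛-identityˡ : ∀ f n → (𝟙 ⊛ f) n ≈ f n
    ⊛-identityˡ f zero    = *-identityˡ _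
    ⊛-identityˡ f (suc n) = trans (+-cong (*-identityˡ _) (⊛-zeroˡ f n)) (+-identityʳ _)

  series : CommutativeRing c ℓ
  series = record
    { Carrier = Series ; _≈_ = _≋_ ; _+_ = _⊕_ ; _*_ = _⊛_ ; -_ = ⊖_ ; 0# = 𝟘 ; 1# = 𝟙
    ; isCommutativeRing = record
      { isRing = record
        { +-isAbelianGroup = record
          { isGroup = record
            { isMonoid = record
              { isSemigroup = record
                { isMagma = record
                  { isEquivalence = record
                    { refl  = coefficients λ _ → refl
                    ; sym   = λ e → coefficients λ n → sym (at e n)
                    ; trans = λ e e′ → coefficients λ n → trans (at e n) (at e′ n) }
                  ; ∙-cong = λ e e′ → coefficients λ n → +-cong (at e n) (at e′ n) }
                ; assoc = λ f g h → coefficients λ n → +-assoc _ _ _ }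
              ; identity = (λ f → coefficients λ n → +-identityˡ _) , (λ f → coefficients λ n → +-identityʳ _) }
            ; inverse = (λ f → coefficients λ n → -‿inverseˡ _) , (λ f → coefficients λ n → -‿inverseʳ _)
            ; ⁻¹-cong = λ e → coefficients λ n → -‿cong (at e n) }
          ; comm = λ f g → coefficients λ n → +-comm _ _ }
        ; *-cong = λ e e′ → coefficients (⊛-cong (at e) (at e′))
        ; *-assoc = λ f g h → coefficients (⊛-assoc f g h)
        ; *-identity = (λ f → coefficients (⊛-identityˡ f))
                     , (λ f → coefficients λ n → trans (⊛-comm f 𝟙 n) (⊛-identityˡ f n))
        ; distrib = (λ f g h → coefficients λ n → trans (⊛-comm f (g ⊕ h) n)
                       (trans (⊛-distribʳ f g h n) (+-cong (⊛-comm g f n) (⊛-comm h f n))))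
                  , (λ h f g → coefficients (⊛-distribʳ h f g)) }
      ; *-comm = λ f g → coefficients (⊛-comm f g) } }

  private module S = RingTools series

  constant : Carrier → Series
  constant a zero    = a
  constant a (suc n) = 0#

  X : Series
  X zero          = 0#
  X (suc zero)    = 1#
  X (suc (suc n)) = 0#

  constant-⊛ : ∀ a f n → (constant a ⊛ f) n ≈ a * f n
  constant-⊛ a f zero    = refl
  constant-⊛ a f (suc n) = trans (+-congˡ (⊛-zeroˡ f n)) (+-identityʳ _)

  constant-cong : ∀ {a b} → a ≈ b → constant a ≋ constant b
  constant-cong e = coefficients λ { zero → e ; (suc n) → refl }

  constant-+ : ∀ a b → constant (a + b) ≋ constant a ⊕ constant b
  constant-+ a b = coefficients λ { zero → refl ; (suc n) → sym (+-identityˡ 0#) }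

  constant-neg : ∀ a → constant (- a) ≋ ⊖ constant a
  constant-neg a = coefficients λ { zero → refl ; (suc n) → sym ε⁻¹≈ε }

  constant-1 : constant 1# ≋ 𝟙
  constant-1 = coefficients λ { zero → refl ; (suc n) → refl }

  constant-* : ∀ a b → constant (a * b) ≋ constant a ⊛ constant b
  constant-* a b = coefficients λ
    { zero → refl ; (suc n) → sym (trans (constant-⊛ a (constant b) (suc n)) (zeroʳ a)) }

  constant-^ : ∀ a n → constant (a ^ n) ≋ constant a S.^ n
  constant-^ a zero    = constant-1
  constant-^ a (suc n) = S.trans (constant-* a (a ^ n)) (S.*-congˡ (constant-^ a n))

  constant-ι : ∀ n → constant (ι n) ≋ S.ι n
  constant-ι zero          = coefficients λ { zero → refl ; (suc n) → refl }
  constant-ι (suc zero)    = constant-1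
  constant-ι (suc (suc n)) = S.trans (constant-+ 1# (ι (suc n))) (S.+-cong constant-1 (constant-ι (suc n)))

  ι-⊛ : ∀ k f n → (S.ι k ⊛ f) n ≈ ι k * f n
  ι-⊛ k f n = trans (at (S.*-congʳ (S.sym (constant-ι k))) n) (constant-⊛ (ι k) f n)

  ∑-at : ∀ N F n → S.∑ N F n ≈ ∑ N (λ k → F k n)
  ∑-at zero    F n = trans (at (S.∑-empty F) n) (sym (∑-empty (λ k → F k n)))
  ∑-at (suc N) F n = trans (at (S.∑-suc N F) n)
    (trans (+-congˡ (∑-at N (λ k → F (suc k)) n)) (sym (∑-suc N (λ k → F k n))))

  ⊛-∑ : ∀ f g n → (f ⊛ g) n ≈ ∑ (suc n) (λ k → f k * g (n ∸ k))
  ⊛-∑ f g zero    = sym (trans (∑-suc 0 _) (trans (+-congˡ (∑-empty _)) (+-identityʳ _)))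
  ⊛-∑ f g (suc n) = trans (+-congˡ (⊛-∑ (tail f) g n)) (sym (∑-suc (suc n) (λ k → f k * g (suc n ∸ k))))

  X-⊛-zero : ∀ f → (X ⊛ f) 0 ≈ 0#
  X-⊛-zero f = zeroˡ _

  X-⊛-suc : ∀ f n → (X ⊛ f) (suc n) ≈ f n
  X-⊛-suc f n = trans (+-cong (zeroˡ _) (⊛-cong tail-X (λ _ → refl) n)) (trans (+-identityˡ _) (⊛-identityˡ f n))
    where
    tail-X : ∀ n → tail X n ≈ 𝟙 n
    tail-X zero    = refl
    tail-X (suc n) = refl

  X^-⊛ : ∀ j f n → (X S.^ j ⊛ f) (j ℕ.+ n) ≈ f n
  X^-⊛ zero    f n = ⊛-identityˡ f n
  X^-⊛ (suc j) f n = trans (⊛-assoc X (X S.^ j) f (suc j ℕ.+ n)) (trans (X-⊛-suc (X S.^ j ⊛ f) (j ℕ.+ n)) (X^-⊛ j f n))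

  X^-at : ∀ j → (X S.^ j) j ≈ 1#
  X^-at zero    = refl
  X^-at (suc j) = trans (X-⊛-suc (X S.^ j) j) (X^-at j)

  X^-at-≢ : ∀ j n → n ≢ j → (X S.^ j) n ≈ 0#
  X^-at-≢ zero    zero    n≢j = contradiction ≡.refl n≢j
  X^-at-≢ zero    (suc n) n≢j = refl
  X^-at-≢ (suc j) zero    n≢j = X-⊛-zero (X S.^ j)
  X^-at-≢ (suc j) (suc n) n≢j = trans (X-⊛-suc (X S.^ j) n) (X^-at-≢ j n (λ eq → n≢j (≡.cong suc eq)))

  linear-⊛ : ∀ a b f n → ((constant a ⊕ constant b ⊛ X) ⊛ f) (suc n) ≈ a * f (suc n) + b * f n
  linear-⊛ a b f n = begin
    ((constant a ⊕ constant b ⊛ X) ⊛ f) (suc n)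
      ≈⟨ ⊛-distribʳ f (constant a) (constant b ⊛ X) (suc n) ⟩
    (constant a ⊛ f) (suc n) + (constant b ⊛ X ⊛ f) (suc n)
      ≈⟨ +-cong (constant-⊛ a f (suc n)) (trans (⊛-assoc (constant b) X f (suc n)) (constant-⊛ b (X ⊛ f) (suc n))) ⟩
    a * f (suc n) + b * (X ⊛ f) (suc n)
      ≈⟨ +-congˡ (*-congˡ (X-⊛-suc f n)) ⟩
    a * f (suc n) + b * f n ∎

  linear-⊛-zero : ∀ a b f → ((constant a ⊕ constant b ⊛ X) ⊛ f) 0 ≈ a * f 0
  linear-⊛-zero a b f = *-congʳ (trans (+-congˡ (zeroʳ b)) (+-identityʳ a))

  -- Multiplication by a + bX reproduces Pascal's recursion on the coefficients.
  linear-^ : ∀ a b N k → ((constant a ⊕ constant b ⊛ X) S.^ N) k ≈ ι (N C k) * (b ^ k * a ^ (N ∸ k))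
  linear-^ a b zero zero    = solve 0 (con (+ 1) := con (+ 1) :* (con (+ 1) :* con (+ 1))) refl
  linear-^ a b zero (suc k) = sym (zeroˡ _)
  linear-^ a b (suc N) zero = begin
    ((constant a ⊕ constant b ⊛ X) S.^ suc N) 0   ≈⟨ linear-⊛-zero a b ((constant a ⊕ constant b ⊛ X) S.^ N) ⟩
    a * ((constant a ⊕ constant b ⊛ X) S.^ N) 0   ≈⟨ *-congˡ (linear-^ a b N 0) ⟩
    a * (ι (N C 0) * (1# * a ^ N))                ≈⟨ solve 2 (λ a x → a :* (con (+ 1) :* (con (+ 1) :* x)) := con (+ 1) :* (con (+ 1) :* (a :* x))) refl a (a ^ N) ⟩
    1# * (1# * a ^ suc N)                         ∎
  linear-^ a b (suc N) (suc k) = begin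
    ((constant a ⊕ constant b ⊛ X) S.^ suc N) (suc k)
      ≈⟨ linear-⊛ a b L k ⟩
    a * L (suc k) + b * L k
      ≈⟨ +-cong (*-congˡ (linear-^ a b N (suc k))) (*-congˡ (linear-^ a b N k)) ⟩
    a * (ι (N C suc k) * (b ^ suc k * a ^ (N ∸ suc k))) + b * (ι (N C k) * (b ^ k * a ^ (N ∸ k)))
      ≈⟨ +-congʳ (shift (k ℕ.<? N)) ⟩
    ι (N C suc k) * (b ^ suc k * a ^ (N ∸ k)) + b * (ι (N C k) * (b ^ k * a ^ (N ∸ k)))
      ≈⟨ solve 5 (λ x y b u v → x :* ((b :* u) :* v) :+ b :* (y :* (u :* v)) := (y :+ x) :* ((b :* u) :* v)) refl _ _ b _ _ ⟩
    (ι (N C k) + ι (N C suc k)) * (b ^ suc k * a ^ (N ∸ k))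
      ≈⟨ *-congʳ (trans (sym (ι-+ (N C k) (N C suc k))) (ι-cong (nCk+nC[k+1]≡[n+1]C[k+1] N k))) ⟩
    ι (suc N C suc k) * (b ^ suc k * a ^ (N ∸ k)) ∎
    where
    L = (constant a ⊕ constant b ⊛ X) S.^ N
    -- Truncated subtraction breaks the power law of a once k ≥ N, but there the binomial
    -- coefficient C(N,k+1) is 0.
    shift : Dec (k < N) → a * (ι (N C suc k) * (b ^ suc k * a ^ (N ∸ suc k))) ≈ ι (N C suc k) * (b ^ suc k * a ^ (N ∸ k))
    shift (yes k<N) = trans (solve 4 (λ a x y z → a :* (x :* (y :* z)) := x :* (y :* (a :* z))) refl a _ _ _)
      (*-congˡ (*-congˡ (reflexive (≡.cong (a ^_) (≡.sym (ℕₚ.+-∸-assoc 1 k<N))))))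
    shift (no k≮N) = trans (*-congˡ (vanish _)) (trans (zeroʳ a) (sym (vanish _)))
      where
      vanish : ∀ z → ι (N C suc k) * z ≈ 0#
      vanish z = trans (*-congʳ (ι-cong (k>n⇒nCk≡0 (s≤s (ℕₚ.≮⇒≥ k≮N))))) (zeroˡ z)

  [1+X]^ : ∀ N k → ((𝟙 ⊕ X) S.^ N) k ≈ ι (N C k)
  [1+X]^ N k = begin
    ((𝟙 ⊕ X) S.^ N) k                              ≈⟨ at (S.^-congˡ N (S.+-cong constant-1 (S.trans (S.*-congʳ constant-1) (S.*-identityˡ X)))) k ⟨
    ((constant 1# ⊕ constant 1# ⊛ X) S.^ N) k      ≈⟨ linear-^ 1# 1# N k ⟩
    ι (N C k) * (1# ^ k * 1# ^ (N ∸ k))            ≈⟨ *-congˡ (trans (*-cong (1^n≈1 k) (1^n≈1 (N ∸ k))) (*-identityˡ 1#)) ⟩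
    ι (N C k) * 1#                                 ≈⟨ *-identityʳ _ ⟩
    ι (N C k)                                      ∎

-- Binomial identities in ℕ

module BinomialCoefficients where
  open import Data.Nat using (_+_; _*_)
  open ℕ-Solver.+-*-Solver
  open ≡.≡-Reasoning

  absorption : ∀ n k → suc k * (suc n C suc k) ≡ suc n * (n C k)
  absorption zero    zero    = ≡.refl
  absorption zero    (suc k) = ≡.trans (≡.cong (suc (suc k) *_) (k>n⇒nCk≡0 {1} {suc (suc k)} (s≤s (s≤s z≤n)))) (ℕₚ.*-zeroʳ (suc (suc k)))
  absorption (suc n) zero    = ≡.trans (≡.cong (1 *_) (≡.sym (nCk+nC[k+1]≡[n+1]C[k+1] (suc n) 0)))
    (≡.trans (≡.cong (λ z → 1 * (1 + z)) (≡.trans (≡.sym (ℕₚ.*-identityˡ _)) (absorption n 0)))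
      (solve 1 (λ n → con 1 :* (con 1 :+ (con 1 :+ n) :* con 1) := (con 2 :+ n) :* con 1) ≡.refl n))
  absorption (suc n) (suc k) = begin
    suc (suc k) * (suc (suc n) C suc (suc k))
      ≡⟨ ≡.cong (suc (suc k) *_) (nCk+nC[k+1]≡[n+1]C[k+1] (suc n) (suc k)) ⟨
    suc (suc k) * (suc n C suc k + suc n C suc (suc k))
      ≡⟨ solve 3 (λ k x y → (con 2 :+ k) :* (x :+ y) := x :+ (con 1 :+ k) :* x :+ (con 2 :+ k) :* y) ≡.refl k (suc n C suc k) _ ⟩
    suc n C suc k + suc k * (suc n C suc k) + suc (suc k) * (suc n C suc (suc k))
      ≡⟨ ≡.cong₂ (λ x y → suc n C suc k + x + y) (absorption n k) (absorption n (suc k)) ⟩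
    suc n C suc k + suc n * (n C k) + suc n * (n C suc k)
      ≡⟨ solve 4 (λ n z x y → z :+ (con 1 :+ n) :* x :+ (con 1 :+ n) :* y := z :+ (con 1 :+ n) :* (x :+ y)) ≡.refl n (suc n C suc k) (n C k) (n C suc k) ⟩
    suc n C suc k + suc n * (n C k + n C suc k)
      ≡⟨ ≡.cong (λ z → suc n C suc k + suc n * z) (nCk+nC[k+1]≡[n+1]C[k+1] n k) ⟩
    suc (suc n) * (suc n C suc k) ∎

  consecutive : ∀ n k → suc k * (n C suc k) + k * (n C k) ≡ n * (n C k)
  consecutive n k = ℕₚ.+-cancelʳ-≡ (n C k) _ _ (begin
    suc k * (n C suc k) + k * (n C k) + n C k
      ≡⟨ solve 3 (λ k x y → (con 1 :+ k) :* y :+ k :* x :+ x := (con 1 :+ k) :* (x :+ y)) ≡.refl k (n C k) (n C suc k) ⟩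
    suc k * (n C k + n C suc k)  ≡⟨ ≡.cong (suc k *_) (nCk+nC[k+1]≡[n+1]C[k+1] n k) ⟩
    suc k * (suc n C suc k)      ≡⟨ absorption n k ⟩
    n C k + n * (n C k)          ≡⟨ ℕₚ.+-comm (n C k) _ ⟩
    n * (n C k) + n C k          ∎)

  -- Pascal's rule writes C(2k+2,k+1) as C(2k+1,k) + C(2k+1,k+1); these are equal by symmetry, and
  -- absorption evaluates them.
  central : ∀ k → suc k * ((2 * suc k) C suc k) ≡ 2 * (suc (2 * k) * ((2 * k) C k))
  central k = begin
    suc k * ((2 * suc k) C suc k)              ≡⟨ ≡.cong (λ n → suc k * (n C suc k)) (ℕₚ.*-suc 2 k) ⟩
    suc k * (suc (suc (2 * k)) C suc k)        ≡⟨ ≡.cong (suc k *_) (nCk+nC[k+1]≡[n+1]C[k+1] (suc (2 * k)) k) ⟨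
    suc k * (suc (2 * k) C k + suc (2 * k) C suc k)
      ≡⟨ ≡.cong (λ z → suc k * (z + suc (2 * k) C suc k)) (≡.trans (nCk≡nC[n∸k] k≤) (≡.cong (suc (2 * k) C_) flip)) ⟩
    suc k * (suc (2 * k) C suc k + suc (2 * k) C suc k)
      ≡⟨ solve 2 (λ k x → (con 1 :+ k) :* (x :+ x) := con 2 :* ((con 1 :+ k) :* x)) ≡.refl k (suc (2 * k) C suc k) ⟩
    2 * (suc k * (suc (2 * k) C suc k))        ≡⟨ ≡.cong (2 *_) (absorption (2 * k) k) ⟩
    2 * (suc (2 * k) * ((2 * k) C k))          ∎
    where
    k≤ : k ≤ suc (2 * k)
    k≤ = ℕₚ.≤-trans (ℕₚ.m≤m+n k _) (ℕₚ.n≤1+n _)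
    flip : suc (2 * k) ∸ k ≡ suc k
    flip = ≡.trans (≡.cong (_∸ k) (solve 1 (λ k → con 1 :+ con 2 :* k := k :+ (con 1 :+ k)) ≡.refl k)) (ℕₚ.m+n∸m≡n k (suc k))

  multinomial : ∀ {n k} → k ≤ n → (n C k) * (k ! * (n ∸ k) !) ≡ n !
  multinomial {n} {k} k≤n = ≡.trans (≡.cong (_* (k ! * (n ∸ k) !)) (nCk≡n!/k![n-k]! k≤n)) (m/n*n≡m (k![n∸k]!∣n! k≤n))
    where instance _ = k ℕₚ.!* (n ∸ k) !≢0

  private
    -- Both sides equal (a+b+c)! / (a! b! c!).
    trinomial-≤ : ∀ a b c → ((a + b + c) C (a + b)) * ((a + b) C a) ≡ ((a + b + c) C a) * ((b + c) C c)
    trinomial-≤ a b c = ℕₚ.*-cancelʳ-≡ _ _ (a ! * (b ! * c !)) {{nz}} (begin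
      P * Q * (a ! * (b ! * c !))
        ≡⟨ solve 5 (λ P Q a b c → P :* Q :* (a :* (b :* c)) := P :* ((Q :* (a :* b)) :* c)) ≡.refl P Q (a !) (b !) (c !) ⟩
      P * (Q * (a ! * b !) * c !)
        ≡⟨ ≡.cong (λ z → P * (z * c !)) (m a b) ⟩
      P * ((a + b) ! * c !)
        ≡⟨ m (a + b) c ⟩
      (a + b + c) !
        ≡⟨ ≡.cong _! (ℕₚ.+-assoc a b c) ⟩
      (a + (b + c)) !
        ≡⟨ m a (b + c) ⟨
      ((a + (b + c)) C a) * (a ! * (b + c) !)
        ≡⟨ ≡.cong₂ (λ x y → (x C a) * (a ! * y)) (≡.sym (ℕₚ.+-assoc a b c)) (≡.sym (m b c)) ⟩
      R * (a ! * (((b + c) C b) * (b ! * c !)))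
        ≡⟨ ≡.cong (λ z → R * (a ! * (z * (b ! * c !)))) (≡.trans (nCk≡nC[n∸k] (ℕₚ.m≤m+n b c)) (≡.cong ((b + c) C_) (ℕₚ.m+n∸m≡n b c))) ⟩
      R * (a ! * (S * (b ! * c !)))
        ≡⟨ solve 5 (λ R S a b c → R :* (a :* (S :* (b :* c))) := R :* S :* (a :* (b :* c))) ≡.refl R S (a !) (b !) (c !) ⟩
      R * S * (a ! * (b ! * c !)) ∎)
      where
      P = (a + b + c) C (a + b)
      Q = (a + b) C a
      R = (a + b + c) C a
      S = (b + c) C c
      nz : ℕ.NonZero (a ! * (b ! * c !))
      nz = ℕₚ.m*n≢0 (a !) (b ! * c !) {{a ℕₚ.!≢0}} {{b ℕₚ.!* c !≢0}}
      m : ∀ a b → ((a + b) C a) * (a ! * b !) ≡ (a + b) !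
      m a b = ≡.trans (≡.cong (λ z → ((a + b) C a) * (a ! * z !)) (≡.sym (ℕₚ.m+n∸m≡n a b))) (multinomial (ℕₚ.m≤m+n a b))

  trinomial-revision : ∀ {m n j} → n ≤ m → (m C n) * (n C j) ≡ (m C j) * ((m ∸ j) C (m ∸ n))
  trinomial-revision {m} {n} {j} n≤m with j ℕ.≤? n
  ... | yes j≤n = begin
    (m C n) * (n C j)
      ≡⟨ ≡.cong₂ (λ x y → (y C x) * (x C j)) (≡.sym n≡) (≡.sym m≡) ⟩
    ((j + b + c) C (j + b)) * ((j + b) C j)
      ≡⟨ trinomial-≤ j b c ⟩
    ((j + b + c) C j) * ((b + c) C c)
      ≡⟨ ≡.cong₂ (λ x y → (x C j) * (y C c)) m≡ (≡.sym m∸j≡) ⟩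
    (m C j) * ((m ∸ j) C (m ∸ n)) ∎
    where
    b = n ∸ j
    c = m ∸ n
    n≡ : j + b ≡ n
    n≡ = ℕₚ.m+[n∸m]≡n j≤n
    m≡ : j + b + c ≡ m
    m≡ = ≡.trans (≡.cong (_+ c) n≡) (ℕₚ.m+[n∸m]≡n n≤m)
    m∸j≡ : m ∸ j ≡ b + c
    m∸j≡ = ≡.trans (≡.cong (_∸ j) (≡.trans (≡.sym m≡) (ℕₚ.+-assoc j b c))) (ℕₚ.m+n∸m≡n j (b + c))
  -- For j > n the left side has the factor C(n,j) = 0. On the right either m - n > m - j, or j > m.
  ... | no j≰n = ≡.trans (≡.trans (≡.cong ((m C n) *_) (k>n⇒nCk≡0 (ℕₚ.≰⇒> j≰n))) (ℕₚ.*-zeroʳ (m C n)))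
    (≡.sym vanish)
    where
    vanish : (m C j) * ((m ∸ j) C (m ∸ n)) ≡ 0
    vanish with j ℕ.≤? m
    ... | yes j≤m = ≡.trans (≡.cong ((m C j) *_) (k>n⇒nCk≡0 (ℕₚ.∸-monoʳ-< (ℕₚ.≰⇒> j≰n) j≤m))) (ℕₚ.*-zeroʳ (m C j))
    ... | no j≰m = ≡.cong (_* ((m ∸ j) C (m ∸ n))) (k>n⇒nCk≡0 (ℕₚ.≰⇒> j≰m))


-- Vandermonde convolution and the sum of cubes

module BinomialSums {c ℓ : Level} (R : CommutativeRing c ℓ) where
  open BinomialCoefficients using (trinomial-revision)
  open RingTools R
  open PowerSeries R
  private module S = RingTools series

  C-zero : ∀ {n k} x → n < k → ι (n C k) * x ≈ 0#
  C-zero x n<k = trans (*-congʳ (ι-cong (k>n⇒nCk≡0 n<k))) (zeroˡ x)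

  vandermonde : ∀ a b n → ι ((a ℕ.+ b) C n) ≈ ∑ (suc n) (λ k → ι (a C k) * ι (b C (n ∸ k)))
  vandermonde a b n = begin
    ι ((a ℕ.+ b) C n)                                 ≈⟨ [1+X]^ (a ℕ.+ b) n ⟨
    ((𝟙 ⊕ X) S.^ (a ℕ.+ b)) n                         ≈⟨ at (S.^-homo-* (𝟙 ⊕ X) a b) n ⟩
    ((𝟙 ⊕ X) S.^ a ⊛ (𝟙 ⊕ X) S.^ b) n                 ≈⟨ ⊛-∑ ((𝟙 ⊕ X) S.^ a) ((𝟙 ⊕ X) S.^ b) n ⟩
    ∑ (suc n) (λ k → ((𝟙 ⊕ X) S.^ a) k * ((𝟙 ⊕ X) S.^ b) (n ∸ k))
      ≈⟨ ∑-cong (suc n) (λ k _ → *-cong ([1+X]^ a k) ([1+X]^ b (n ∸ k))) ⟩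
    ∑ (suc n) (λ k → ι (a C k) * ι (b C (n ∸ k)))     ∎

  -- Vandermonde for (m - j) + j = m after C(j,r) = C(j,j-r). The range up to m, where the extra
  -- terms vanish, is the one that arises in `franel`.
  vandermonde-square : ∀ {m j} → j ≤ m → ∑ (suc m) (λ r → ι ((m ∸ j) C r) * ι (j C r)) ≈ ι (m C j)
  vandermonde-square {m} {j} j≤m = begin
    ∑ (suc m) (λ r → ι ((m ∸ j) C r) * ι (j C r))
      ≈⟨ ∑-truncate _ (s≤s j≤m) (λ r j<r → trans (*-comm _ _) (C-zero _ j<r)) ⟩
    ∑ (suc j) (λ r → ι ((m ∸ j) C r) * ι (j C r))
      ≈⟨ ∑-cong (suc j) (λ { r (s≤s r≤j) → *-congˡ (ι-cong (nCk≡nC[n∸k] r≤j)) }) ⟩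
    ∑ (suc j) (λ r → ι ((m ∸ j) C r) * ι (j C (j ∸ r)))
      ≈⟨ vandermonde (m ∸ j) j j ⟨
    ι ((m ∸ j ℕ.+ j) C j)
      ≈⟨ ι-cong (≡.cong (_C j) (ℕₚ.m∸n+n≡m j≤m)) ⟩
    ι (m C j) ∎

  -- Vandermonde splits C(2n,m) into Σ C(n,j) C(n,m-j). Trinomial revision, once for each factor
  -- C(m,n), produces C(m,j)² and leaves n only in C(m-j,m-n) C(j,m-n); the sum of these over n is a
  -- third C(m,j).
  franel : ∀ m → ∑ (suc m) (λ n → ι (m C n) * ι (m C n) * ι ((2 ℕ.* n) C m))
               ≈ ∑ (suc m) (λ j → ι (m C j) * ι (m C j) * ι (m C j))
  franel m = begin
    ∑ (suc m) (λ n → ι (m C n) * ι (m C n) * ι ((2 ℕ.* n) C m))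
      ≈⟨ ∑-cong (suc m) (λ n _ → trans (*-congˡ (trans (ι-cong (≡.cong (λ k → (n ℕ.+ k) C m) (ℕₚ.+-identityʳ n))) (vandermonde n n m))) (∑-*ˡ (suc m) _ _)) ⟩
    ∑ (suc m) (λ n → ∑ (suc m) (λ j → ι (m C n) * ι (m C n) * (ι (n C j) * ι (n C (m ∸ j)))))
      ≈⟨ ∑-swap (suc m) (suc m) _ ⟩
    ∑ (suc m) (λ j → ∑ (suc m) (λ n → ι (m C n) * ι (m C n) * (ι (n C j) * ι (n C (m ∸ j)))))
      ≈⟨ ∑-cong (suc m) (λ { j (s≤s j≤m) → inner j j≤m }) ⟩
    ∑ (suc m) (λ j → ι (m C j) * ι (m C j) * ι (m C j)) ∎
    where
    inner : ∀ j → j ≤ m → ∑ (suc m) (λ n → ι (m C n) * ι (m C n) * (ι (n C j) * ι (n C (m ∸ j))))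
                        ≈ ι (m C j) * ι (m C j) * ι (m C j)
    inner j j≤m = begin
      ∑ (suc m) (λ n → ι (m C n) * ι (m C n) * (ι (n C j) * ι (n C (m ∸ j))))
        ≈⟨ ∑-cong (suc m) (λ { n (s≤s n≤m) → revise n n≤m }) ⟩
      ∑ (suc m) (λ n → ι (m C j) * ι (m C j) * (ι ((m ∸ j) C (m ∸ n)) * ι (j C (m ∸ n))))
        ≈⟨ ∑-*ˡ (suc m) _ _ ⟨
      ι (m C j) * ι (m C j) * ∑ (suc m) (λ n → ι ((m ∸ j) C (m ∸ n)) * ι (j C (m ∸ n)))
        ≈⟨ *-congˡ (trans (sym (∑-reverse (suc m) (λ r → ι ((m ∸ j) C r) * ι (j C r)))) (vandermonde-square j≤m)) ⟩
      ι (m C j) * ι (m C j) * ι (m C j) ∎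
      where
      revise : ∀ n → n ≤ m → ι (m C n) * ι (m C n) * (ι (n C j) * ι (n C (m ∸ j)))
                           ≈ ι (m C j) * ι (m C j) * (ι ((m ∸ j) C (m ∸ n)) * ι (j C (m ∸ n)))
      revise n n≤m = begin
        ι (m C n) * ι (m C n) * (ι (n C j) * ι (n C (m ∸ j)))
          ≈⟨ solve 3 (λ a x y → a :* a :* (x :* y) := a :* x :* (a :* y)) refl _ _ _ ⟩
        ι (m C n) * ι (n C j) * (ι (m C n) * ι (n C (m ∸ j)))
          ≈⟨ *-cong (cast j) (trans (cast (m ∸ j)) (*-cong (ι-cong (≡.sym (nCk≡nC[n∸k] j≤m))) (ι-cong (≡.cong (_C (m ∸ n)) (ℕₚ.m∸[m∸n]≡n j≤m))))) ⟩
        ι (m C j) * ι ((m ∸ j) C (m ∸ n)) * (ι (m C j) * ι (j C (m ∸ n)))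
          ≈⟨ solve 3 (λ a x y → a :* x :* (a :* y) := a :* a :* (x :* y)) refl _ _ _ ⟩
        ι (m C j) * ι (m C j) * (ι ((m ∸ j) C (m ∸ n)) * ι (j C (m ∸ n))) ∎
        where
        cast : ∀ j → ι (m C n) * ι (n C j) ≈ ι (m C j) * ι ((m ∸ j) C (m ∸ n))
        cast j = trans (sym (ι-* (m C n) (n C j))) (trans (ι-cong (trinomial-revision {m} {n} {j} n≤m)) (ι-* (m C j) _))

-- Landen's transformation as a polynomial identity

module Landen {c ℓ : Level} (R : CommutativeRing c ℓ) where
  open RingTools R
  open PowerSeries R
  private module S = RingTools series

  -- Σ C(m,i)² λⁱ, the Hasse invariant of the Legendre curve up to sign, made homogeneous at λ = a² / b².
  squareSum : ℕ → Carrier → Carrier → Carrier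
  squareSum m a b = ∑ (suc m) (λ i → ι (m C i) * ι (m C i) * ((a * a) ^ i * (b * b) ^ (m ∸ i)))

  module _ (m : ℕ) (a b : Carrier) where
    private
      A B S₊ W : Series
      A  = constant a
      B  = constant b
      S₊ = constant ((a + b) * (a + b))
      W  = constant (- (a * b))

      s w : Carrier
      s = (a + b) * (a + b)
      w = - (a * b)

      factorisation : W ⊛ ((𝟙 ⊕ X) ⊛ (𝟙 ⊕ X)) ⊕ X ⊛ S₊
                    ≋ (constant (- b) ⊕ A ⊛ X) ⊛ (A ⊕ constant (- b) ⊛ X)
      factorisation = S.begin
        W ⊛ ((𝟙 ⊕ X) ⊛ (𝟙 ⊕ X)) ⊕ X ⊛ S₊
          S.≈⟨ S.+-cong (S.*-congʳ (S.trans (constant-neg (a * b)) (S.-‿cong (constant-* a b))))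
                        (S.*-congˡ (S.trans (constant-* (a + b) (a + b)) (S.*-cong (constant-+ a b) (constant-+ a b)))) ⟩
        ⊖ (A ⊛ B) ⊛ ((𝟙 ⊕ X) ⊛ (𝟙 ⊕ X)) ⊕ X ⊛ ((A ⊕ B) ⊛ (A ⊕ B))
          S.≈⟨ S.solve 3 (λ a b x → S.:- (a S.:* b) S.:* ((S.con (+ 1) S.:+ x) S.:* (S.con (+ 1) S.:+ x)) S.:+ x S.:* ((a S.:+ b) S.:* (a S.:+ b))
                          S.:= (S.:- b S.:+ a S.:* x) S.:* (a S.:+ S.:- b S.:* x)) S.refl A B X ⟩
        (⊖ B ⊕ A ⊛ X) ⊛ (A ⊕ ⊖ B ⊛ X)
          S.≈⟨ S.*-cong (S.+-congʳ (S.sym (constant-neg b))) (S.+-congˡ (S.*-congʳ (S.sym (constant-neg b)))) ⟩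
        (constant (- b) ⊕ A ⊛ X) ⊛ (A ⊕ constant (- b) ⊛ X) S.∎

      -- The factor X^(m-n) moves the coefficient of X^m to that of Xⁿ in (1+X)^(2n), which is the
      -- central one.
      term : ∀ {n} → n ≤ m → ((W ⊛ ((𝟙 ⊕ X) ⊛ (𝟙 ⊕ X))) S.^ n ⊛ (X ⊛ S₊) S.^ (m ∸ n)) m
                           ≈ w ^ n * s ^ (m ∸ n) * ι ((2 ℕ.* n) C n)
      term {n} n≤m = begin
        ((W ⊛ ((𝟙 ⊕ X) ⊛ (𝟙 ⊕ X))) S.^ n ⊛ (X ⊛ S₊) S.^ (m ∸ n)) m
          ≈⟨ at regroup m ⟩
        (X S.^ (m ∸ n) ⊛ Q) m
          ≡⟨ ≡.cong (X S.^ (m ∸ n) ⊛ Q) (ℕₚ.m∸n+n≡m n≤m) ⟨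
        (X S.^ (m ∸ n) ⊛ Q) (m ∸ n ℕ.+ n)
          ≈⟨ X^-⊛ (m ∸ n) Q n ⟩
        Q n
          ≈⟨ constant-⊛ (w ^ n * s ^ (m ∸ n)) _ n ⟩
        w ^ n * s ^ (m ∸ n) * ((𝟙 ⊕ X) S.^ (2 ℕ.* n)) n
          ≈⟨ *-congˡ ([1+X]^ (2 ℕ.* n) n) ⟩
        w ^ n * s ^ (m ∸ n) * ι ((2 ℕ.* n) C n) ∎
        where
        Q : Series
        Q = constant (w ^ n * s ^ (m ∸ n)) ⊛ (𝟙 ⊕ X) S.^ (2 ℕ.* n)
        regroup : (W ⊛ ((𝟙 ⊕ X) ⊛ (𝟙 ⊕ X))) S.^ n ⊛ (X ⊛ S₊) S.^ (m ∸ n) ≋ X S.^ (m ∸ n) ⊛ Q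
        regroup = S.begin
          (W ⊛ ((𝟙 ⊕ X) ⊛ (𝟙 ⊕ X))) S.^ n ⊛ (X ⊛ S₊) S.^ (m ∸ n)
            S.≈⟨ S.*-cong (S.trans (S.^-distrib-* W ((𝟙 ⊕ X) ⊛ (𝟙 ⊕ X)) n) (S.*-cong (S.sym (constant-^ w n)) (S.square-^ (𝟙 ⊕ X) n)))
                          (S.trans (S.^-distrib-* X S₊ (m ∸ n)) (S.*-congˡ (S.sym (constant-^ s (m ∸ n))))) ⟩
          constant (w ^ n) ⊛ (𝟙 ⊕ X) S.^ (2 ℕ.* n) ⊛ (X S.^ (m ∸ n) ⊛ constant (s ^ (m ∸ n)))
            S.≈⟨ S.solve 4 (λ a p x b → a S.:* p S.:* (x S.:* b) S.:= x S.:* (a S.:* b S.:* p)) S.refl _ _ _ _ ⟩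
          X S.^ (m ∸ n) ⊛ (constant (w ^ n) ⊛ constant (s ^ (m ∸ n)) ⊛ (𝟙 ⊕ X) S.^ (2 ℕ.* n))
            S.≈⟨ S.*-congˡ (S.*-congʳ (S.sym (constant-* (w ^ n) (s ^ (m ∸ n))))) ⟩
          X S.^ (m ∸ n) ⊛ Q S.∎

      -- The coefficients at i and m - i carry the same monomial in a and -b, so each power, and
      -- with it the sign, occurs squared.
      product-term : ∀ {i} → i ≤ m → ((constant (- b) ⊕ A ⊛ X) S.^ m) i * ((A ⊕ constant (- b) ⊛ X) S.^ m) (m ∸ i)
                   ≈ ι (m C i) * ι (m C i) * ((a * a) ^ i * (b * b) ^ (m ∸ i))
      product-term {i} i≤m = begin
        ((constant (- b) ⊕ A ⊛ X) S.^ m) i * ((A ⊕ constant (- b) ⊛ X) S.^ m) (m ∸ i)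
          ≈⟨ *-cong (linear-^ (- b) a m i) (linear-^ a (- b) m (m ∸ i)) ⟩
        ι (m C i) * (a ^ i * (- b) ^ (m ∸ i)) * (ι (m C (m ∸ i)) * ((- b) ^ (m ∸ i) * a ^ (m ∸ (m ∸ i))))
          ≈⟨ *-congˡ (*-cong (ι-cong (≡.sym (nCk≡nC[n∸k] i≤m))) (*-congˡ (^-congʳ a (ℕₚ.m∸[m∸n]≡n i≤m)))) ⟩
        ι (m C i) * (a ^ i * (- b) ^ (m ∸ i)) * (ι (m C i) * ((- b) ^ (m ∸ i) * a ^ i))
          ≈⟨ solve 3 (λ k x y → k :* (x :* y) :* (k :* (y :* x)) := k :* k :* ((x :* x) :* (y :* y))) refl _ _ _ ⟩
        ι (m C i) * ι (m C i) * ((a ^ i * a ^ i) * ((- b) ^ (m ∸ i) * (- b) ^ (m ∸ i)))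
          ≈⟨ *-congˡ (*-cong (^-distrib-* a a i) (^-distrib-* (- b) (- b) (m ∸ i))) ⟨
        ι (m C i) * ι (m C i) * ((a * a) ^ i * (- b * - b) ^ (m ∸ i))
          ≈⟨ *-congˡ (*-congˡ (^-congˡ (m ∸ i) (solve 1 (λ b → :- b :* :- b := b :* b) refl b))) ⟩
        ι (m C i) * ι (m C i) * ((a * a) ^ i * (b * b) ^ (m ∸ i)) ∎

    -- Both sides are the coefficient of zᵐ in the m-th power of z (a+b)² − a b (1+z)² = (a z − b)(a − b z).
    landen : ∑ (suc m) (λ n → ι (m C n) * ι ((2 ℕ.* n) C n) * ((- (a * b)) ^ n * ((a + b) * (a + b)) ^ (m ∸ n)))
           ≈ squareSum m a b
    landen = begin
      ∑ (suc m) (λ n → ι (m C n) * ι ((2 ℕ.* n) C n) * (w ^ n * s ^ (m ∸ n)))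
        ≈⟨ ∑-cong (suc m) (λ { n (s≤s n≤m) → trans (*-assoc _ _ _) (*-congˡ (trans (*-comm _ _) (sym (term n≤m)))) }) ⟩
      ∑ (suc m) (λ n → ι (m C n) * ((W ⊛ ((𝟙 ⊕ X) ⊛ (𝟙 ⊕ X))) S.^ n ⊛ (X ⊛ S₊) S.^ (m ∸ n)) m)
        ≈⟨ ∑-cong (suc m) (λ n _ → sym (ι-⊛ (m C n) ((W ⊛ ((𝟙 ⊕ X) ⊛ (𝟙 ⊕ X))) S.^ n ⊛ (X ⊛ S₊) S.^ (m ∸ n)) m)) ⟩
      ∑ (suc m) (λ n → (S.ι (m C n) ⊛ ((W ⊛ ((𝟙 ⊕ X) ⊛ (𝟙 ⊕ X))) S.^ n ⊛ (X ⊛ S₊) S.^ (m ∸ n))) m)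
        ≈⟨ ∑-at (suc m) (λ n → S.ι (m C n) ⊛ ((W ⊛ ((𝟙 ⊕ X) ⊛ (𝟙 ⊕ X))) S.^ n ⊛ (X ⊛ S₊) S.^ (m ∸ n))) m ⟨
      S.∑ (suc m) (λ n → S.ι (m C n) ⊛ ((W ⊛ ((𝟙 ⊕ X) ⊛ (𝟙 ⊕ X))) S.^ n ⊛ (X ⊛ S₊) S.^ (m ∸ n))) m
        ≈⟨ at (S.binomial-theorem m (W ⊛ ((𝟙 ⊕ X) ⊛ (𝟙 ⊕ X))) (X ⊛ S₊)) m ⟨
      ((W ⊛ ((𝟙 ⊕ X) ⊛ (𝟙 ⊕ X)) ⊕ X ⊛ S₊) S.^ m) m
        ≈⟨ at (S.trans (S.^-congˡ m factorisation) (S.^-distrib-* _ _ m)) m ⟩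
      ((constant (- b) ⊕ A ⊛ X) S.^ m ⊛ (A ⊕ constant (- b) ⊛ X) S.^ m) m
        ≈⟨ ⊛-∑ ((constant (- b) ⊕ A ⊛ X) S.^ m) ((A ⊕ constant (- b) ⊛ X) S.^ m) m ⟩
      ∑ (suc m) (λ i → ((constant (- b) ⊕ A ⊛ X) S.^ m) i * ((A ⊕ constant (- b) ⊛ X) S.^ m) (m ∸ i))
        ≈⟨ ∑-cong (suc m) (λ { i (s≤s i≤m) → product-term i≤m }) ⟩
      squareSum m a b ∎

-- Diagonals of series in two variables

module Diagonal {c ℓ : Level} (R : CommutativeRing c ℓ) where
  open RingTools R
  open PowerSeries R
  open BinomialSums R using (C-zero)
  private
    module S = RingTools series
    module P² = PowerSeries series
    module B = RingTools P².series

  open P² using () renaming (_≋_ to _≋²_; at to at²)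

  diagonal : (ℕ → Series) → Series
  diagonal F k = F k k

  diagonal-cong : ∀ {F G} → F ≋² G → diagonal F ≋ diagonal G
  diagonal-cong e = coefficients λ k → at (at² e k) k

  -- Series in u over series in z: the outer index is the exponent of u, the inner one that of z.
  u z zu 1+z+u+zu : P².Series
  u         = P².X
  z         = P².constant X
  zu        = z B.* u
  1+z+u+zu  = (B.1# B.+ z) B.* (B.1# B.+ u)

  scalar : Carrier → P².Series
  scalar a = P².constant (constant a)

  diagonal-scalar : ∀ a F → diagonal (scalar a B.* F) ≋ constant a ⊛ diagonal F
  diagonal-scalar a F = coefficients λ k → trans (at (P².constant-⊛ (constant a) F k) k)
    (trans (constant-⊛ a (F k) k) (sym (constant-⊛ a (diagonal F) k)))

  scalar-ι : ∀ n → scalar (ι n) ≋² B.ι n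
  scalar-ι n = B.trans (P².constant-cong (constant-ι n)) (P².constant-ι n)

  scalar-* : ∀ a b → scalar (a * b) ≋² scalar a B.* scalar b
  scalar-* a b = B.trans (P².constant-cong (constant-* a b)) (P².constant-* _ _)

  scalar-^ : ∀ a n → scalar (a ^ n) ≋² scalar a B.^ n
  scalar-^ a n = B.trans (P².constant-cong (constant-^ a n)) (P².constant-^ _ n)

  -- Multiplication by zu raises both exponents by one, so on diagonals zu acts as X.
  diagonal-zu : ∀ F → diagonal (zu B.* F) ≋ X ⊛ diagonal F
  diagonal-zu F = coefficients λ
    { zero    → trans (at (at² e 0) 0) (trans (at (P².X-⊛-zero (z B.* F)) 0) (sym (X-⊛-zero (diagonal F))))
    ; (suc k) → trans (at (at² e (suc k)) (suc k)) (trans (at (P².X-⊛-suc (z B.* F) k) (suc k))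
        (trans (at (P².constant-⊛ X F k) (suc k)) (trans (X-⊛-suc (F k) k) (sym (X-⊛-suc (diagonal F) k))))) }
    where
    e : zu B.* F ≋² u B.* (z B.* F)
    e = B.trans (B.*-congʳ (B.*-comm z u)) (B.*-assoc u z F)

  diagonal-zu^ : ∀ j F → diagonal (zu B.^ j B.* F) ≋ X S.^ j ⊛ diagonal F
  diagonal-zu^ zero    F = S.trans (diagonal-cong (B.*-identityˡ F)) (S.sym (S.*-identityˡ (diagonal F)))
  diagonal-zu^ (suc j) F = S.trans (diagonal-cong (B.*-assoc zu (zu B.^ j) F))
    (S.trans (diagonal-zu (zu B.^ j B.* F)) (S.trans (S.*-congˡ (diagonal-zu^ j F)) (S.sym (S.*-assoc X _ _))))

  -- -(1-zu)² = -1 + 2zu - (zu)² is a polynomial in zu, hence passes through the diagonal with X in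
  -- place of zu.
  diagonal-1-zu² : ∀ n F → diagonal ((B.- ((B.1# B.- zu) B.* (B.1# B.- zu))) B.^ n B.* F)
                         ≋ (S.- ((S.1# S.- X) S.* (S.1# S.- X))) S.^ n ⊛ diagonal F
  diagonal-1-zu² zero    F = S.trans (diagonal-cong (B.*-identityˡ F)) (S.sym (S.*-identityˡ (diagonal F)))
  diagonal-1-zu² (suc n) F = S.begin
    diagonal (B.- (q B.* q) B.* Q B.* F)
      S.≈⟨ diagonal-cong (B.solve 3 (λ x Q F → B.:- ((B.con (+ 1) B.:- x) B.:* (B.con (+ 1) B.:- x)) B.:* Q B.:* F
            B.:= B.:- (Q B.:* F) B.:+ B.con (+ 2) B.:* (x B.:* (Q B.:* F)) B.:- x B.:* (x B.:* (Q B.:* F))) B.refl zu Q F) ⟩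
    diagonal (B.- G B.+ B.ι 2 B.* (zu B.* G) B.- zu B.* (zu B.* G))
      S.≈⟨ S.+-cong (S.+-congˡ (S.trans (diagonal-cong (B.*-congʳ (B.sym (scalar-ι 2)))) (S.trans (diagonal-scalar (ι 2) (zu B.* G)) (S.*-cong (constant-ι 2) (diagonal-zu G)))))
                    (S.-‿cong (S.trans (diagonal-zu (zu B.* G)) (S.*-congˡ (diagonal-zu G)))) ⟩
    ⊖ diagonal G ⊕ S.ι 2 ⊛ (X ⊛ diagonal G) ⊕ ⊖ (X ⊛ (X ⊛ diagonal G))
      S.≈⟨ S.solve 2 (λ x G → S.:- G S.:+ S.con (+ 2) S.:* (x S.:* G) S.:- x S.:* (x S.:* G)
            S.:= S.:- ((S.con (+ 1) S.:- x) S.:* (S.con (+ 1) S.:- x)) S.:* G) S.refl X (diagonal G) ⟩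
    S.- ((S.1# S.- X) S.* (S.1# S.- X)) ⊛ diagonal G
      S.≈⟨ S.*-congˡ (diagonal-1-zu² n F) ⟩
    S.- ((S.1# S.- X) S.* (S.1# S.- X)) ⊛ ((S.- ((S.1# S.- X) S.* (S.1# S.- X))) S.^ n ⊛ diagonal F)
      S.≈⟨ S.*-assoc (S.- ((S.1# S.- X) S.* (S.1# S.- X))) _ _ ⟨
    (S.- ((S.1# S.- X) S.* (S.1# S.- X))) S.^ suc n ⊛ diagonal F S.∎
    where
    q = B.1# B.- zu
    Q = (B.- (q B.* q)) B.^ n
    G = Q B.* F

  -- The two variables separate in (1+z)^N (1+u)^N, and each contributes one C(N,k).
  diagonal-v^ : ∀ N k → diagonal (1+z+u+zu B.^ N) k ≈ ι (N C k) * ι (N C k)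
  diagonal-v^ N k = begin
    (1+z+u+zu B.^ N) k k
      ≈⟨ at (at² (B.^-distrib-* (B.1# B.+ z) (B.1# B.+ u) N) k) k ⟩
    ((B.1# B.+ z) B.^ N B.* (B.1# B.+ u) B.^ N) k k
      ≈⟨ at (at² (B.*-congʳ (B.trans (B.^-congˡ N (B.trans (B.+-congʳ (B.sym P².constant-1)) (B.sym (P².constant-+ S.1# X)))) (B.sym (P².constant-^ (S.1# S.+ X) N)))) k) k ⟩
    (P².constant ((S.1# S.+ X) S.^ N) B.* (B.1# B.+ u) B.^ N) k k
      ≈⟨ at (P².constant-⊛ ((S.1# S.+ X) S.^ N) ((B.1# B.+ u) B.^ N) k) k ⟩
    ((S.1# S.+ X) S.^ N S.* ((B.1# B.+ u) B.^ N) k) k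
      ≈⟨ at (S.*-congˡ (P².[1+X]^ N k)) k ⟩
    ((S.1# S.+ X) S.^ N S.* S.ι (N C k)) k
      ≈⟨ at (S.*-comm ((S.1# S.+ X) S.^ N) (S.ι (N C k))) k ⟩
    (S.ι (N C k) S.* (S.1# S.+ X) S.^ N) k
      ≈⟨ ι-⊛ (N C k) ((S.1# S.+ X) S.^ N) k ⟩
    ι (N C k) * ((S.1# S.+ X) S.^ N) k
      ≈⟨ *-congˡ ([1+X]^ N k) ⟩
    ι (N C k) * ι (N C k) ∎

  -- (z+u)^(2l) is homogeneous of degree 2l, so its only diagonal monomial is zˡuˡ.
  diagonal-[z+u]^ : ∀ l → diagonal ((z B.+ u) B.^ (2 ℕ.* l)) ≋ constant (ι ((2 ℕ.* l) C l)) ⊛ X S.^ l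
  diagonal-[z+u]^ l = coefficients λ k → begin
    ((z B.+ u) B.^ N) k k
      ≈⟨ at (at² (B.^-congˡ N (B.+-congˡ (B.sym (B.trans (B.*-congʳ P².constant-1) (B.*-identityˡ u))))) k) k ⟩
    ((P².constant X B.+ P².constant S.1# B.* P².X) B.^ N) k k
      ≈⟨ at (P².linear-^ X S.1# N k) k ⟩
    (S.ι (N C k) S.* (S.1# S.^ k S.* X S.^ (N ∸ k))) k
      ≈⟨ ι-⊛ (N C k) (S.1# S.^ k S.* X S.^ (N ∸ k)) k ⟩
    ι (N C k) * (S.1# S.^ k S.* X S.^ (N ∸ k)) k
      ≈⟨ *-congˡ (at (S.trans (S.*-congʳ (S.1^n≈1 k)) (S.*-identityˡ _)) k) ⟩
    ι (N C k) * (X S.^ (N ∸ k)) k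
      ≈⟨ pointwise k (k ℕ.≟ l) (k ℕ.≤? N) ⟩
    ι (N C l) * (X S.^ l) k
      ≈⟨ constant-⊛ (ι (N C l)) (X S.^ l) k ⟨
    (constant (ι (N C l)) ⊛ X S.^ l) k ∎
    where
    N = 2 ℕ.* l
    N∸l≡l : N ∸ l ≡ l
    N∸l≡l = ≡.trans (ℕₚ.m+n∸m≡n l (l ℕ.+ 0)) (ℕₚ.+-identityʳ l)
    pointwise : ∀ k → Dec (k ≡ l) → Dec (k ≤ N) → ι (N C k) * (X S.^ (N ∸ k)) k ≈ ι (N C l) * (X S.^ l) k
    pointwise k (yes ≡.refl) _ = *-congˡ (reflexive (≡.cong (λ j → (X S.^ j) k) N∸l≡l))
    pointwise k (no k≢l) (no k≰N) = trans (C-zero _ (ℕₚ.≰⇒> k≰N)) (sym (trans (*-congˡ (X^-at-≢ l k k≢l)) (zeroʳ _)))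
    pointwise k (no k≢l) (yes k≤N) = trans (trans (*-congˡ (X^-at-≢ (N ∸ k) k off)) (zeroʳ _))
                                           (sym (trans (*-congˡ (X^-at-≢ l k k≢l)) (zeroʳ _)))
      where
      off : k ≢ N ∸ k
      off k≡ = k≢l (ℕₚ.*-cancelˡ-≡ k l 2 (≡.trans (≡.cong (k ℕ.+_) (≡.trans (ℕₚ.+-identityʳ k) k≡)) (ℕₚ.m+[n∸m]≡n k≤N)))

  -- The sign (-1)ⁿ of the middle coefficient of (1-X)^(2n) cancels against the minus sign inside
  -- the power.
  [1-X]²-central : ∀ n → ((S.- ((S.1# S.- X) S.* (S.1# S.- X))) S.^ n) n ≈ ι ((2 ℕ.* n) C n)
  [1-X]²-central n = begin
    ((S.- ((S.1# S.- X) S.* (S.1# S.- X))) S.^ n) n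
      ≈⟨ at (S.^-congˡ n (S.trans (S.solve 2 (λ x m → S.:- (x S.:* x) S.:= S.:- S.con (+ 1) S.:* (x S.:* x)) S.refl (S.1# S.- X) X)
             (S.*-cong (S.trans (S.-‿cong (S.sym constant-1)) (S.sym (constant-neg 1#))) (S.*-cong L≋ L≋)))) n ⟩
    ((constant (- 1#) S.* (L S.* L)) S.^ n) n
      ≈⟨ at (S.trans (S.^-distrib-* _ _ n) (S.*-cong (S.sym (constant-^ (- 1#) n)) (S.square-^ L n))) n ⟩
    (constant ((- 1#) ^ n) S.* L S.^ (2 ℕ.* n)) n
      ≈⟨ constant-⊛ ((- 1#) ^ n) (L S.^ (2 ℕ.* n)) n ⟩
    (- 1#) ^ n * (L S.^ (2 ℕ.* n)) n
      ≈⟨ *-congˡ (linear-^ 1# (- 1#) (2 ℕ.* n) n) ⟩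
    (- 1#) ^ n * (ι ((2 ℕ.* n) C n) * ((- 1#) ^ n * 1# ^ (2 ℕ.* n ∸ n)))
      ≈⟨ *-congˡ (*-congˡ (*-congˡ (1^n≈1 (2 ℕ.* n ∸ n)))) ⟩
    (- 1#) ^ n * (ι ((2 ℕ.* n) C n) * ((- 1#) ^ n * 1#))
      ≈⟨ solve 2 (λ x y → x :* (y :* (x :* con (+ 1))) := (x :* x) :* y) refl _ _ ⟩
    ((- 1#) ^ n * (- 1#) ^ n) * ι ((2 ℕ.* n) C n)
      ≈⟨ *-congʳ (trans (sym (^-distrib-* (- 1#) (- 1#) n)) (trans (^-congˡ n (solve 0 (:- con (+ 1) :* :- con (+ 1) := con (+ 1)) refl)) (1^n≈1 n))) ⟩
    1# * ι ((2 ℕ.* n) C n)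
      ≈⟨ *-identityˡ _ ⟩
    ι ((2 ℕ.* n) C n) ∎
    where
    L : Series
    L = constant 1# S.+ constant (- 1#) S.* X
    L≋ : S.1# S.- X ≋ L
    L≋ = S.+-cong (S.sym constant-1) (S.trans (S.solve 1 (λ x → S.:- x S.:= S.:- S.con (+ 1) S.:* x) S.refl X)
      (S.*-congʳ (S.trans (S.-‿cong (S.sym constant-1)) (S.sym (constant-neg 1#)))))

  -- With v = (1+z)(1+u) and 2y = −1, 2(yv + zu) · 2(yv + 1) = (z+u)² − (1−zu)².
  domb : ∀ m y → ι 2 * y ≈ - 1# →
    ι 2 ^ m * ι 2 ^ m * ∑ (suc m) (λ k → ∑ (suc m) (λ j → ι (m C k) * ι (m C j) * (y ^ (k ℕ.+ j) * (ι ((k ℕ.+ j) C k) * ι ((k ℕ.+ j) C k)))))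
    ≈ ∑ (suc m) (λ l → ι (m C l) * (ι ((2 ℕ.* l) C l) * ι ((2 ℕ.* (m ∸ l)) C (m ∸ l))))
  domb m y 2y≈-1 = begin
    ι 2 ^ m * ι 2 ^ m * ∑ (suc m) (λ k → ∑ (suc m) (λ j → ι (m C k) * ι (m C j) * (y ^ (k ℕ.+ j) * (ι ((k ℕ.+ j) C k) * ι ((k ℕ.+ j) C k)))))
      ≈⟨ *-congˡ (sym expand-left) ⟩
    ι 2 ^ m * ι 2 ^ m * ((V B.+ zu) B.^ m B.* (V B.+ B.1#) B.^ m) m m
      ≈⟨ trans (sym (constant-⊛ _ (diagonal ((V B.+ zu) B.^ m B.* (V B.+ B.1#) B.^ m)) m))
               (at (S.sym (diagonal-scalar _ ((V B.+ zu) B.^ m B.* (V B.+ B.1#) B.^ m))) m) ⟩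
    (scalar (ι 2 ^ m * ι 2 ^ m) B.* ((V B.+ zu) B.^ m B.* (V B.+ B.1#) B.^ m)) m m
      ≈⟨ at (at² refactor m) m ⟩
    (((z B.+ u) B.* (z B.+ u) B.- (B.1# B.- zu) B.* (B.1# B.- zu)) B.^ m) m m
      ≈⟨ expand-right ⟩
    ∑ (suc m) (λ l → ι (m C l) * (ι ((2 ℕ.* l) C l) * ι ((2 ℕ.* (m ∸ l)) C (m ∸ l)))) ∎
    where
    Y V : P².Series
    Y = scalar y
    V = Y B.* 1+z+u+zu

    2Y≈-1 : B.ι 2 B.* Y ≋² B.- B.1#
    2Y≈-1 = B.trans (B.*-congʳ (B.sym (scalar-ι 2))) (B.trans (B.sym (scalar-* (ι 2) y))
      (B.trans (P².constant-cong (S.trans (constant-cong 2y≈-1) (S.trans (constant-neg 1#) (S.-‿cong constant-1))))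
        (B.trans (P².constant-neg S.1#) (B.-‿cong P².constant-1))))

    -- With 2y = -1 the two factors become -((1-zu) + (z+u)) and (1-zu) - (z+u), hence a difference
    -- of squares.
    factorisation : (B.ι 2 B.* (V B.+ zu)) B.* (B.ι 2 B.* (V B.+ B.1#)) ≋² (z B.+ u) B.* (z B.+ u) B.- (B.1# B.- zu) B.* (B.1# B.- zu)
    factorisation = B.begin
      (B.ι 2 B.* (V B.+ zu)) B.* (B.ι 2 B.* (V B.+ B.1#))
        B.≈⟨ B.solve 3 (λ y v t → (B.con (+ 2) B.:* (y B.:* v B.:+ t)) B.:* (B.con (+ 2) B.:* (y B.:* v B.:+ B.con (+ 1)))
              B.:= ((B.con (+ 2) B.:* y) B.:* v B.:+ B.con (+ 2) B.:* t) B.:* ((B.con (+ 2) B.:* y) B.:* v B.:+ B.con (+ 2))) B.refl Y 1+z+u+zu zu ⟩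
      ((B.ι 2 B.* Y) B.* 1+z+u+zu B.+ B.ι 2 B.* zu) B.* ((B.ι 2 B.* Y) B.* 1+z+u+zu B.+ B.ι 2)
        B.≈⟨ B.*-cong (B.+-congʳ (B.*-congʳ 2Y≈-1)) (B.+-congʳ (B.*-congʳ 2Y≈-1)) ⟩
      ((B.- B.1#) B.* 1+z+u+zu B.+ B.ι 2 B.* zu) B.* ((B.- B.1#) B.* 1+z+u+zu B.+ B.ι 2)
        B.≈⟨ B.solve 2 (λ z u → (B.:- B.con (+ 1) B.:* ((B.con (+ 1) B.:+ z) B.:* (B.con (+ 1) B.:+ u)) B.:+ B.con (+ 2) B.:* (z B.:* u))
                  B.:* (B.:- B.con (+ 1) B.:* ((B.con (+ 1) B.:+ z) B.:* (B.con (+ 1) B.:+ u)) B.:+ B.con (+ 2))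
              B.:= (z B.:+ u) B.:* (z B.:+ u) B.:- (B.con (+ 1) B.:- z B.:* u) B.:* (B.con (+ 1) B.:- z B.:* u)) B.refl z u ⟩
      (z B.+ u) B.* (z B.+ u) B.- (B.1# B.- zu) B.* (B.1# B.- zu) B.∎

    refactor : scalar (ι 2 ^ m * ι 2 ^ m) B.* ((V B.+ zu) B.^ m B.* (V B.+ B.1#) B.^ m)
             ≋² ((z B.+ u) B.* (z B.+ u) B.- (B.1# B.- zu) B.* (B.1# B.- zu)) B.^ m
    refactor = B.begin
      scalar (ι 2 ^ m * ι 2 ^ m) B.* ((V B.+ zu) B.^ m B.* (V B.+ B.1#) B.^ m)
        B.≈⟨ B.*-congʳ (B.trans (scalar-* _ _) (B.*-cong 2^m 2^m)) ⟩
      (B.ι 2 B.^ m B.* B.ι 2 B.^ m) B.* ((V B.+ zu) B.^ m B.* (V B.+ B.1#) B.^ m)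
        B.≈⟨ B.solve 3 (λ a b c → (a B.:* a) B.:* (b B.:* c) B.:= (a B.:* b) B.:* (a B.:* c)) B.refl _ _ _ ⟩
      (B.ι 2 B.^ m B.* (V B.+ zu) B.^ m) B.* (B.ι 2 B.^ m B.* (V B.+ B.1#) B.^ m)
        B.≈⟨ B.*-cong (B.^-distrib-* (B.ι 2) (V B.+ zu) m) (B.^-distrib-* (B.ι 2) (V B.+ B.1#) m) ⟨
      (B.ι 2 B.* (V B.+ zu)) B.^ m B.* (B.ι 2 B.* (V B.+ B.1#)) B.^ m
        B.≈⟨ B.^-distrib-* _ _ m ⟨
      ((B.ι 2 B.* (V B.+ zu)) B.* (B.ι 2 B.* (V B.+ B.1#))) B.^ m
        B.≈⟨ B.^-congˡ m factorisation ⟩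
      ((z B.+ u) B.* (z B.+ u) B.- (B.1# B.- zu) B.* (B.1# B.- zu)) B.^ m B.∎
      where
      2^m : scalar (ι 2 ^ m) ≋² B.ι 2 B.^ m
      2^m = B.trans (scalar-^ (ι 2) m) (B.^-congˡ m (scalar-ι 2))

    ∑-diagonal : ∀ (F : ℕ → P².Series) n → B.∑ n F m m ≈ ∑ n (λ k → F k m m)
    ∑-diagonal F n = trans (at (P².∑-at n F m) m) (∑-at n (λ k → F k m) m)

    ι-diagonal : ∀ n (F : P².Series) k → (B.ι n B.* F) k k ≈ ι n * F k k
    ι-diagonal n F k = trans (at (P².ι-⊛ n F k) k) (ι-⊛ n (F k) k)

    -- (zu)^(m-k) moves the diagonal coefficient from m to k, where ((1+z)(1+u))^(k+j) contributes
    -- C(k+j,k)².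
    left-term : ∀ k j → k ≤ m → (V B.^ k B.* zu B.^ (m ∸ k) B.* (V B.^ j B.* B.1# B.^ (m ∸ j))) m m
                      ≈ y ^ (k ℕ.+ j) * (ι ((k ℕ.+ j) C k) * ι ((k ℕ.+ j) C k))
    left-term k j k≤m = begin
      (V B.^ k B.* zu B.^ (m ∸ k) B.* (V B.^ j B.* B.1# B.^ (m ∸ j))) m m
        ≈⟨ at (at² regroup m) m ⟩
      (zu B.^ (m ∸ k) B.* Q) m m
        ≈⟨ at (diagonal-zu^ (m ∸ k) Q) m ⟩
      (X S.^ (m ∸ k) ⊛ diagonal Q) m
        ≡⟨ ≡.cong (X S.^ (m ∸ k) ⊛ diagonal Q) (ℕₚ.m∸n+n≡m k≤m) ⟨
      (X S.^ (m ∸ k) ⊛ diagonal Q) (m ∸ k ℕ.+ k)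
        ≈⟨ X^-⊛ (m ∸ k) (diagonal Q) k ⟩
      Q k k
        ≈⟨ at (diagonal-scalar (y ^ (k ℕ.+ j)) (1+z+u+zu B.^ (k ℕ.+ j))) k ⟩
      (constant (y ^ (k ℕ.+ j)) ⊛ diagonal (1+z+u+zu B.^ (k ℕ.+ j))) k
        ≈⟨ constant-⊛ _ (diagonal (1+z+u+zu B.^ (k ℕ.+ j))) k ⟩
      y ^ (k ℕ.+ j) * diagonal (1+z+u+zu B.^ (k ℕ.+ j)) k
        ≈⟨ *-congˡ (diagonal-v^ (k ℕ.+ j) k) ⟩
      y ^ (k ℕ.+ j) * (ι ((k ℕ.+ j) C k) * ι ((k ℕ.+ j) C k)) ∎
      where
      Q : P².Series
      Q = scalar (y ^ (k ℕ.+ j)) B.* 1+z+u+zu B.^ (k ℕ.+ j)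
      regroup : V B.^ k B.* zu B.^ (m ∸ k) B.* (V B.^ j B.* B.1# B.^ (m ∸ j)) ≋² zu B.^ (m ∸ k) B.* Q
      regroup = B.begin
        V B.^ k B.* zu B.^ (m ∸ k) B.* (V B.^ j B.* B.1# B.^ (m ∸ j))
          B.≈⟨ B.*-congˡ (B.trans (B.*-congˡ (B.1^n≈1 (m ∸ j))) (B.*-identityʳ _)) ⟩
        V B.^ k B.* zu B.^ (m ∸ k) B.* V B.^ j
          B.≈⟨ B.solve 3 (λ a b c → a B.:* b B.:* c B.:= b B.:* (a B.:* c)) B.refl _ _ _ ⟩
        zu B.^ (m ∸ k) B.* (V B.^ k B.* V B.^ j)
          B.≈⟨ B.*-congˡ (B.trans (B.sym (B.^-homo-* V k j)) (B.trans (B.^-distrib-* Y 1+z+u+zu (k ℕ.+ j)) (B.*-congʳ (B.sym (scalar-^ y (k ℕ.+ j)))))) ⟩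
        zu B.^ (m ∸ k) B.* Q B.∎

    expand-left : ((V B.+ zu) B.^ m B.* (V B.+ B.1#) B.^ m) m m
      ≈ ∑ (suc m) (λ k → ∑ (suc m) (λ j → ι (m C k) * ι (m C j) * (y ^ (k ℕ.+ j) * (ι ((k ℕ.+ j) C k) * ι ((k ℕ.+ j) C k)))))
    expand-left = begin
      ((V B.+ zu) B.^ m B.* (V B.+ B.1#) B.^ m) m m
        ≈⟨ at (at² expand m) m ⟩
      B.∑ (suc m) (λ k → B.∑ (suc m) (λ j → T k j)) m m
        ≈⟨ ∑-diagonal (λ k → B.∑ (suc m) (T k)) (suc m) ⟩
      ∑ (suc m) (λ k → B.∑ (suc m) (λ j → T k j) m m)
        ≈⟨ ∑-cong (suc m) (λ { k (s≤s k≤m) → trans (∑-diagonal (T k) (suc m)) (∑-cong (suc m) (λ j _ → each k j k≤m)) }) ⟩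
      ∑ (suc m) (λ k → ∑ (suc m) (λ j → ι (m C k) * ι (m C j) * (y ^ (k ℕ.+ j) * (ι ((k ℕ.+ j) C k) * ι ((k ℕ.+ j) C k))))) ∎
      where
      P Q : ℕ → P².Series
      P k = V B.^ k B.* zu B.^ (m ∸ k)
      Q j = V B.^ j B.* B.1# B.^ (m ∸ j)
      T : ℕ → ℕ → P².Series
      T k j = (B.ι (m C k) B.* P k) B.* (B.ι (m C j) B.* Q j)
      expand : (V B.+ zu) B.^ m B.* (V B.+ B.1#) B.^ m ≋² B.∑ (suc m) (λ k → B.∑ (suc m) (λ j → T k j))
      expand = B.trans (B.*-cong (B.binomial-theorem m V zu) (B.binomial-theorem m V B.1#))
        (B.trans (B.∑-*ʳ (suc m) _ (λ k → B.ι (m C k) B.* P k))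
          (B.∑-cong (suc m) (λ k _ → B.∑-*ˡ (suc m) _ (λ j → B.ι (m C j) B.* Q j))))
      each : ∀ k j → k ≤ m → T k j m m ≈ ι (m C k) * ι (m C j) * (y ^ (k ℕ.+ j) * (ι ((k ℕ.+ j) C k) * ι ((k ℕ.+ j) C k)))
      each k j k≤m = begin
        T k j m m
          ≈⟨ at (at² (B.solve 4 (λ a p b q → (a B.:* p) B.:* (b B.:* q) B.:= a B.:* (b B.:* (p B.:* q))) B.refl (B.ι (m C k)) (P k) (B.ι (m C j)) (Q j)) m) m ⟩
        (B.ι (m C k) B.* (B.ι (m C j) B.* (P k B.* Q j))) m m
          ≈⟨ trans (ι-diagonal (m C k) (B.ι (m C j) B.* (P k B.* Q j)) m) (*-congˡ (ι-diagonal (m C j) (P k B.* Q j) m)) ⟩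
        ι (m C k) * (ι (m C j) * (P k B.* Q j) m m)
          ≈⟨ trans (sym (*-assoc _ _ _)) (*-congˡ (left-term k j k≤m)) ⟩
        ι (m C k) * ι (m C j) * (y ^ (k ℕ.+ j) * (ι ((k ℕ.+ j) C k) * ι ((k ℕ.+ j) C k))) ∎

    -- The diagonal of (z+u)^(2l) is C(2l,l) Xˡ, which leaves the central coefficient of the power
    -- with exponent m - l.
    right-term : ∀ l → l ≤ m → (((z B.+ u) B.* (z B.+ u)) B.^ l B.* (B.- ((B.1# B.- zu) B.* (B.1# B.- zu))) B.^ (m ∸ l)) m m
                             ≈ ι ((2 ℕ.* l) C l) * ι ((2 ℕ.* (m ∸ l)) C (m ∸ l))
    right-term l l≤m = begin
      (((z B.+ u) B.* (z B.+ u)) B.^ l B.* (B.- ((B.1# B.- zu) B.* (B.1# B.- zu))) B.^ n) m m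
        ≈⟨ at (at² (B.trans (B.*-comm _ _) (B.*-congˡ (B.square-^ (z B.+ u) l))) m) m ⟩
      ((B.- ((B.1# B.- zu) B.* (B.1# B.- zu))) B.^ n B.* (z B.+ u) B.^ (2 ℕ.* l)) m m
        ≈⟨ at (diagonal-1-zu² n ((z B.+ u) B.^ (2 ℕ.* l))) m ⟩
      (Q ⊛ diagonal ((z B.+ u) B.^ (2 ℕ.* l))) m
        ≈⟨ at (S.*-congˡ (diagonal-[z+u]^ l)) m ⟩
      (Q ⊛ (constant (ι ((2 ℕ.* l) C l)) ⊛ X S.^ l)) m
        ≈⟨ at (S.solve 3 (λ q c x → q S.:* (c S.:* x) S.:= c S.:* (x S.:* q)) S.refl Q _ _) m ⟩
      (constant (ι ((2 ℕ.* l) C l)) ⊛ (X S.^ l ⊛ Q)) m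
        ≈⟨ constant-⊛ _ (X S.^ l ⊛ Q) m ⟩
      ι ((2 ℕ.* l) C l) * (X S.^ l ⊛ Q) m
        ≈⟨ *-congˡ (trans (reflexive (≡.cong (X S.^ l ⊛ Q) (≡.sym (ℕₚ.m+[n∸m]≡n l≤m)))) (X^-⊛ l Q n)) ⟩
      ι ((2 ℕ.* l) C l) * Q n
        ≈⟨ *-congˡ ([1-X]²-central n) ⟩
      ι ((2 ℕ.* l) C l) * ι ((2 ℕ.* n) C n) ∎
      where
      n = m ∸ l
      Q : Series
      Q = (S.- ((S.1# S.- X) S.* (S.1# S.- X))) S.^ n

    expand-right : (((z B.+ u) B.* (z B.+ u) B.- (B.1# B.- zu) B.* (B.1# B.- zu)) B.^ m) m m
      ≈ ∑ (suc m) (λ l → ι (m C l) * (ι ((2 ℕ.* l) C l) * ι ((2 ℕ.* (m ∸ l)) C (m ∸ l))))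
    expand-right = begin
      (((z B.+ u) B.* (z B.+ u) B.- (B.1# B.- zu) B.* (B.1# B.- zu)) B.^ m) m m
        ≈⟨ at (at² (B.binomial-theorem m ((z B.+ u) B.* (z B.+ u)) (B.- ((B.1# B.- zu) B.* (B.1# B.- zu)))) m) m ⟩
      B.∑ (suc m) T m m
        ≈⟨ ∑-diagonal T (suc m) ⟩
      ∑ (suc m) (λ l → T l m m)
        ≈⟨ ∑-cong (suc m) (λ { l (s≤s l≤m) → trans (ι-diagonal (m C l) (G l) m) (*-congˡ (right-term l l≤m)) }) ⟩
      ∑ (suc m) (λ l → ι (m C l) * (ι ((2 ℕ.* l) C l) * ι ((2 ℕ.* (m ∸ l)) C (m ∸ l)))) ∎
      where
      G T : ℕ → P².Series
      G l = ((z B.+ u) B.* (z B.+ u)) B.^ l B.* (B.- ((B.1# B.- zu) B.* (B.1# B.- zu))) B.^ (m ∸ l)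
      T l = B.ι (m C l) B.* G l

-- Cancellation stands in for inverses because it passes to power series coefficient by coefficient.
record HasCharacteristic {c ℓ : Level} (R : CommutativeRing c ℓ) (p : ℕ) : Set (c ⊔ ℓ) where
  open RingTools R
  field
    ι-p      : ι p ≈ 0#
    ι-cancel : ∀ {n x} → p ∤ n → ι n * x ≈ 0# → x ≈ 0#

-- From triangular to rectangular double sums

module Triangle {c ℓ : Level} (R : CommutativeRing c ℓ) where
  open RingTools R

  triangle-step : ∀ N (g : ℕ → ℕ → Carrier) → ∑ (suc N) (λ n → ∑ (suc n) (λ k → g k (n ∸ k)))
                ≈ ∑ (suc N) (g 0) + ∑ N (λ n → ∑ (suc n) (λ k → g (suc k) (n ∸ k)))
  triangle-step N g = begin
    ∑ (suc N) (λ n → ∑ (suc n) (λ k → g k (n ∸ k)))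
      ≈⟨ ∑-cong (suc N) (λ n _ → ∑-suc n (λ k → g k (n ∸ k))) ⟩
    ∑ (suc N) (λ n → g 0 n + ∑ n (λ k → g (suc k) (n ∸ suc k)))
      ≈⟨ ∑-+ (suc N) (g 0) _ ⟩
    ∑ (suc N) (g 0) + ∑ (suc N) (λ n → ∑ n (λ k → g (suc k) (n ∸ suc k)))
      ≈⟨ +-congˡ (trans (∑-suc N _) (trans (+-congʳ (∑-empty _)) (+-identityˡ _))) ⟩
    ∑ (suc N) (g 0) + ∑ N (λ n → ∑ (suc n) (λ k → g (suc k) (n ∸ k))) ∎

  -- The largest k + j in the rectangle is M + J - 2, which is below N exactly when M + J ≤ N + 1;
  -- so the support of g lies inside the triangle. Rows are peeled off one value of k at a time.
  triangle≈rectangle : ∀ M J N (g : ℕ → ℕ → Carrier) → 0 < J → M ℕ.+ J ≤ suc N →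
    (∀ k j → M ≤ k → g k j ≈ 0#) → (∀ k j → J ≤ j → g k j ≈ 0#) →
    ∑ N (λ n → ∑ (suc n) (λ k → g k (n ∸ k))) ≈ ∑ M (λ k → ∑ J (g k))
  triangle≈rectangle zero J N g _ _ e _ =
    trans (∑-zero N (λ n _ → ∑-zero (suc n) (λ k _ → e k (n ∸ k) z≤n))) (sym (∑-empty _))
  triangle≈rectangle (suc M) (suc J) zero g _ (s≤s le) _ _ =
    contradiction (ℕₚ.≤-trans (ℕₚ.≤-reflexive (≡.sym (ℕₚ.+-suc M J))) le) (λ ())
  triangle≈rectangle (suc M) J (suc N) g 0<J (s≤s le) e e′ = begin
    ∑ (suc N) (λ n → ∑ (suc n) (λ k → g k (n ∸ k)))
      ≈⟨ triangle-step N g ⟩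
    ∑ (suc N) (g 0) + ∑ N (λ n → ∑ (suc n) (λ k → g (suc k) (n ∸ k)))
      ≈⟨ +-cong (∑-truncate (g 0) (ℕₚ.≤-trans (ℕₚ.m≤n+m J M) le) (e′ 0))
                (triangle≈rectangle M J N (λ k → g (suc k)) 0<J le (λ k j M≤k → e (suc k) j (s≤s M≤k)) (λ k → e′ (suc k))) ⟩
    ∑ J (g 0) + ∑ M (λ k → ∑ J (g (suc k)))
      ≈⟨ ∑-suc M _ ⟨
    ∑ (suc M) (λ k → ∑ J (g k)) ∎

  ι-sum : ∀ f N → ι (sum (map f (upTo N))) ≈ ∑ N (λ k → ι (f k))
  ι-sum f N = go (λ k → k) N
    where
    go : ∀ (h : ℕ → ℕ) N → ι (sum (map f (applyUpTo h N))) ≈ ∑ N (λ k → ι (f (h k)))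
    go h zero    = sym (∑-empty _)
    go h (suc N) = trans (ι-+ (f (h 0)) _) (trans (+-congˡ (go (λ k → h (suc k)) N)) (sym (∑-suc N _)))

-- Binomial coefficients modulo p and reduction to a sum of cubes

module DombModP {c ℓ : Level} (R : CommutativeRing c ℓ) (m : ℕ) (χ : HasCharacteristic R (suc (2 ℕ.* m))) where
  open RingTools R
  open BinomialCoefficients using (consecutive; central)
  open BinomialSums R using (C-zero)
  open Triangle R
  open HasCharacteristic χ public

  ι-cancel-≤ : ∀ {k x} → k < 2 ℕ.* m → ι (suc k) * x ≈ 0# → x ≈ 0#
  ι-cancel-≤ k<2m = ι-cancel (>⇒∤ (s≤s k<2m))

  1+2m≈0 : 1# + ι 2 * ι m ≈ 0#
  1+2m≈0 = trans (+-congˡ (sym (ι-* 2 m))) (trans (sym (ι-suc (2 ℕ.* m))) ι-p)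

  ι-consecutive : ∀ n k → (1# + ι k) * ι (n C suc k) + ι k * ι (n C k) ≈ ι n * ι (n C k)
  ι-consecutive n k = begin
    (1# + ι k) * ι (n C suc k) + ι k * ι (n C k)
      ≈⟨ +-cong (trans (*-congʳ (sym (ι-suc k))) (sym (ι-* (suc k) (n C suc k)))) (sym (ι-* k (n C k))) ⟩
    ι (suc k ℕ.* (n C suc k)) + ι (k ℕ.* (n C k))
      ≈⟨ ι-+ (suc k ℕ.* (n C suc k)) _ ⟨
    ι (suc k ℕ.* (n C suc k) ℕ.+ k ℕ.* (n C k))
      ≈⟨ ι-cong (consecutive n k) ⟩
    ι (n ℕ.* (n C k))
      ≈⟨ ι-* n (n C k) ⟩
    ι n * ι (n C k) ∎

  ι-central : ∀ k → (1# + ι k) * ι ((2 ℕ.* suc k) C suc k) ≈ ι 2 * ((1# + ι 2 * ι k) * ι ((2 ℕ.* k) C k))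
  ι-central k = begin
    (1# + ι k) * ι ((2 ℕ.* suc k) C suc k)
      ≈⟨ trans (*-congʳ (sym (ι-suc k))) (sym (ι-* (suc k) ((2 ℕ.* suc k) C suc k))) ⟩
    ι (suc k ℕ.* ((2 ℕ.* suc k) C suc k))
      ≈⟨ ι-cong (central k) ⟩
    ι (2 ℕ.* (suc (2 ℕ.* k) ℕ.* ((2 ℕ.* k) C k)))
      ≈⟨ trans (ι-* 2 (suc (2 ℕ.* k) ℕ.* ((2 ℕ.* k) C k))) (*-congˡ (ι-* (suc (2 ℕ.* k)) ((2 ℕ.* k) C k))) ⟩
    ι 2 * (ι (suc (2 ℕ.* k)) * ι ((2 ℕ.* k) C k))
      ≈⟨ *-congˡ (*-congʳ (trans (ι-suc (2 ℕ.* k)) (+-congˡ (ι-* 2 k)))) ⟩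
    ι 2 * ((1# + ι 2 * ι k) * ι ((2 ℕ.* k) C k)) ∎

  -- Both sides satisfy the same recursion: k + 1 times the next value is 2(2k+1) times the present
  -- one on the left and -4(m-k) times it on the right, and these agree as 2m ≡ -1. The factor k + 1
  -- ≤ 2m is prime to p.
  central-binomial : ∀ k → k ≤ 2 ℕ.* m → ι ((2 ℕ.* k) C k) ≈ (- ι 4) ^ k * ι (m C k)
  central-binomial zero    _ = sym (*-identityˡ 1#)
  central-binomial (suc k) k<2m = x∙y⁻¹≈ε⇒x≈y _ _ (ι-cancel-≤ k<2m (begin
    ι (suc k) * (C₂′ - - ι 4 * P * C₁′)
      ≈⟨ *-congʳ (ι-suc k) ⟩
    (1# + ι k) * (C₂′ - - ι 4 * P * C₁′)
      -- k C(m,k) is added and subtracted to complete the left side of `ι-consecutive`, which avoids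
      -- the difference m - k.
      ≈⟨ solve 5 (λ k x p y z → (con (+ 1) :+ k) :* (x :- :- con (+ 4) :* p :* y)
           := (con (+ 1) :+ k) :* x :+ con (+ 4) :* p :* ((con (+ 1) :+ k) :* y :+ k :* z) :- con (+ 4) :* p :* (k :* z)) refl (ι k) C₂′ P C₁′ C₁ ⟩
    (1# + ι k) * C₂′ + ι 4 * P * ((1# + ι k) * C₁′ + ι k * C₁) - ι 4 * P * (ι k * C₁)
      ≈⟨ +-congʳ (+-cong (trans (ι-central k) (*-congˡ (*-congˡ (central-binomial k (ℕₚ.<⇒≤ k<2m))))) (*-congˡ (ι-consecutive m k))) ⟩
    ι 2 * ((1# + ι 2 * ι k) * (P * C₁)) + ι 4 * P * (ι m * C₁) - ι 4 * P * (ι k * C₁)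
      ≈⟨ solve 4 (λ k m p z → con (+ 2) :* ((con (+ 1) :+ con (+ 2) :* k) :* (p :* z)) :+ con (+ 4) :* p :* (m :* z) :- con (+ 4) :* p :* (k :* z)
           := (con (+ 1) :+ con (+ 2) :* m) :* (con (+ 2) :* p :* z)) refl (ι k) (ι m) P C₁ ⟩
    (1# + ι 2 * ι m) * (ι 2 * P * C₁)
      ≈⟨ trans (*-congʳ 1+2m≈0) (zeroˡ _) ⟩
    0# ∎))
    where
    P = (- ι 4) ^ k
    C₁ = ι (m C k)
    C₁′ = ι (m C suc k)
    C₂′ = ι ((2 ℕ.* suc k) C suc k)

  -- The ratio of consecutive values is (2m-k)/(k+1), which is -1 because 2m ≡ -1.
  2m-binomial : ∀ k → k ≤ 2 ℕ.* m → ι ((2 ℕ.* m) C k) ≈ (- 1#) ^ k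
  2m-binomial zero    _ = refl
  2m-binomial (suc k) k<2m = x∙y⁻¹≈ε⇒x≈y _ _ (ι-cancel-≤ k<2m (begin
    ι (suc k) * (C′ - - 1# * P)
      ≈⟨ *-congʳ (ι-suc k) ⟩
    (1# + ι k) * (C′ - - 1# * P)
      ≈⟨ solve 3 (λ k x p → (con (+ 1) :+ k) :* (x :- :- con (+ 1) :* p) := ((con (+ 1) :+ k) :* x :+ k :* p) :+ p) refl (ι k) C′ P ⟩
    (1# + ι k) * C′ + ι k * P + P
      ≈⟨ +-congʳ (trans (+-congˡ (*-congˡ (sym IH))) (trans (ι-consecutive (2 ℕ.* m) k) (*-cong (ι-* 2 m) IH))) ⟩
    ι 2 * ι m * P + P
      ≈⟨ solve 2 (λ x p → x :* p :+ p := (con (+ 1) :+ x) :* p) refl (ι 2 * ι m) P ⟩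
    (1# + ι 2 * ι m) * P
      ≈⟨ trans (*-congʳ 1+2m≈0) (zeroˡ _) ⟩
    0# ∎))
    where
    P = (- 1#) ^ k
    C′ = ι ((2 ℕ.* m) C suc k)
    IH = 2m-binomial k (ℕₚ.<⇒≤ k<2m)

  [-1]^-square : ∀ n → (- 1#) ^ n * (- 1#) ^ n ≈ 1#
  [-1]^-square n = trans (sym (^-distrib-* (- 1#) (- 1#) n))
    (trans (^-congˡ n (solve 0 (:- con (+ 1) :* :- con (+ 1) := con (+ 1)) refl)) (1^n≈1 n))

  -- Two evaluations of C(2m,m) are compared; this gives 4^m ≡ 1, the case of Fermat's theorem used
  -- below, from binomial coefficients alone.
  [-4]^m : (- ι 4) ^ m ≈ (- 1#) ^ m
  [-4]^m = begin
    (- ι 4) ^ m              ≈⟨ *-identityʳ _ ⟨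
    (- ι 4) ^ m * 1#         ≈⟨ *-congˡ (ι-cong (nCn≡1 m)) ⟨
    (- ι 4) ^ m * ι (m C m)  ≈⟨ central-binomial m (ℕₚ.m≤m+n m _) ⟨
    ι ((2 ℕ.* m) C m)        ≈⟨ 2m-binomial m (ℕₚ.m≤m+n m _) ⟩
    (- 1#) ^ m               ∎

  4^m≈1 : ι 2 ^ m * ι 2 ^ m ≈ 1#
  4^m≈1 = begin
    ι 2 ^ m * ι 2 ^ m             ≈⟨ ^-distrib-* (ι 2) (ι 2) m ⟨
    (ι 2 * ι 2) ^ m               ≈⟨ ^-congˡ m (solve 0 (con (+ 2) :* con (+ 2) := :- con (+ 1) :* :- con (+ 4)) refl) ⟩
    (- 1# * - ι 4) ^ m            ≈⟨ ^-distrib-* (- 1#) (- ι 4) m ⟩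
    (- 1#) ^ m * (- ι 4) ^ m      ≈⟨ *-congˡ [-4]^m ⟩
    (- 1#) ^ m * (- 1#) ^ m       ≈⟨ [-1]^-square m ⟩
    1#                            ∎

  cubes : Carrier
  cubes = ∑ (suc m) (λ j → ι (m C j) * ι (m C j) * ι (m C j))

  domb-sum : ∀ h → ι 8 * h ≈ 1# → ∑ (suc (2 ℕ.* m)) (λ n → h ^ n * ι (Defs.A n)) ≈ (- 1#) ^ m * cubes
  domb-sum h 8h≈1 = begin
    ∑ (suc (2 ℕ.* m)) (λ n → h ^ n * ι (Defs.A n))
      ≈⟨ ∑-cong (suc (2 ℕ.* m)) (λ { n (s≤s n≤2m) → summand n n≤2m }) ⟩
    ∑ (suc (2 ℕ.* m)) (λ n → ∑ (suc n) (λ k → g k (n ∸ k)))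
      -- The cut-off p - 1 = 2m is exactly the largest k + j with k, j ≤ m, so the square fits into
      -- the triangle with nothing to spare.
      ≈⟨ triangle≈rectangle (suc m) (suc m) (suc (2 ℕ.* m)) g (s≤s z≤n)
           (ℕₚ.≤-reflexive (≡.cong suc (≡.trans (ℕₚ.+-suc m m) (≡.cong (λ k → suc (m ℕ.+ k)) (≡.sym (ℕₚ.+-identityʳ m))))))
           (λ k j m<k → trans (*-assoc _ _ _) (C-zero _ m<k))
           (λ k j m<j → trans (*-congʳ (*-comm _ _)) (trans (*-assoc _ _ _) (C-zero _ m<j))) ⟩
    ∑ (suc m) (λ k → ∑ (suc m) (g k))
      ≈⟨ trans (sym (*-identityˡ _)) (*-congʳ (sym 4^m≈1)) ⟩
    ι 2 ^ m * ι 2 ^ m * ∑ (suc m) (λ k → ∑ (suc m) (g k))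
      ≈⟨ Diagonal.domb R m y 2y≈-1 ⟩
    ∑ (suc m) (λ l → ι (m C l) * (ι ((2 ℕ.* l) C l) * ι ((2 ℕ.* (m ∸ l)) C (m ∸ l))))
      ≈⟨ ∑-cong (suc m) (λ { l (s≤s l≤m) → cube l l≤m }) ⟩
    ∑ (suc m) (λ l → (- 1#) ^ m * (ι (m C l) * ι (m C l) * ι (m C l)))
      ≈⟨ ∑-*ˡ (suc m) _ _ ⟨
    (- 1#) ^ m * cubes ∎
    where
    y : Carrier
    y = - ι 4 * h

    2y≈-1 : ι 2 * y ≈ - 1#
    2y≈-1 = trans (solve 1 (λ h → con (+ 2) :* (:- con (+ 4) :* h) := :- (con (+ 8) :* h)) refl h) (-‿cong 8h≈1)

    g : ℕ → ℕ → Carrier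
    g k j = ι (m C k) * ι (m C j) * (y ^ (k ℕ.+ j) * (ι ((k ℕ.+ j) C k) * ι ((k ℕ.+ j) C k)))

    2m≥m : m ≤ 2 ℕ.* m
    2m≥m = ℕₚ.m≤m+n m _

    cube : ∀ l → l ≤ m → ι (m C l) * (ι ((2 ℕ.* l) C l) * ι ((2 ℕ.* (m ∸ l)) C (m ∸ l)))
                       ≈ (- 1#) ^ m * (ι (m C l) * ι (m C l) * ι (m C l))
    cube l l≤m = begin
      ι (m C l) * (ι ((2 ℕ.* l) C l) * ι ((2 ℕ.* (m ∸ l)) C (m ∸ l)))
        ≈⟨ *-congˡ (*-cong (central-binomial l (ℕₚ.≤-trans l≤m 2m≥m))
                           (trans (central-binomial (m ∸ l) (ℕₚ.≤-trans (ℕₚ.m∸n≤m m l) 2m≥m)) (*-congˡ (ι-cong (≡.sym (nCk≡nC[n∸k] l≤m)))))) ⟩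
      ι (m C l) * ((- ι 4) ^ l * ι (m C l) * ((- ι 4) ^ (m ∸ l) * ι (m C l)))
        ≈⟨ solve 3 (λ c a b → c :* (a :* c :* (b :* c)) := (a :* b) :* (c :* c :* c)) refl _ _ _ ⟩
      ((- ι 4) ^ l * (- ι 4) ^ (m ∸ l)) * (ι (m C l) * ι (m C l) * ι (m C l))
        ≈⟨ *-congʳ (trans (sym (^-homo-* (- ι 4) l (m ∸ l))) (trans (^-congʳ (- ι 4) (ℕₚ.m+[n∸m]≡n l≤m)) [-4]^m)) ⟩
      (- 1#) ^ m * (ι (m C l) * ι (m C l) * ι (m C l)) ∎

    summand : ∀ n → n ≤ 2 ℕ.* m → h ^ n * ι (Defs.A n) ≈ ∑ (suc n) (λ k → g k (n ∸ k))
    summand n n≤2m = trans (*-congˡ (ι-sum F (suc n))) (trans (∑-*ˡ (suc n) (h ^ n) (λ k → ι (F k))) (∑-cong (suc n) (λ { k (s≤s k≤n) → each k k≤n })))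
      where
      F : ℕ → ℕ
      F k = ((2 ℕ.* k) C k) ℕ.* (((2 ℕ.* n) ∸ (2 ℕ.* k)) C (n ∸ k)) ℕ.* ((n C k) ℕ.* (n C k))
      each : ∀ k → k ≤ n → h ^ n * ι (F k) ≈ g k (n ∸ k)
      each k k≤n = begin
        h ^ n * ι (F k)
          ≈⟨ *-cong (^-congʳ h (≡.sym k+j≡n)) (trans (ι-* (((2 ℕ.* k) C k) ℕ.* ((2 ℕ.* n ∸ 2 ℕ.* k) C j)) ((n C k) ℕ.* (n C k))) (*-cong (ι-* ((2 ℕ.* k) C k) ((2 ℕ.* n ∸ 2 ℕ.* k) C j)) (ι-* (n C k) (n C k)))) ⟩
        h ^ (k ℕ.+ j) * (ι ((2 ℕ.* k) C k) * ι ((2 ℕ.* n ∸ 2 ℕ.* k) C j) * (ι (n C k) * ι (n C k)))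
          ≈⟨ *-cong (^-homo-* h k j) (*-congʳ (*-cong (central-binomial k (ℕₚ.≤-trans k≤n n≤2m))
               (trans (ι-cong (≡.cong (_C j) (≡.sym (ℕₚ.*-distribˡ-∸ 2 n k)))) (central-binomial j (ℕₚ.≤-trans (ℕₚ.m∸n≤m n k) n≤2m))))) ⟩
        h ^ k * h ^ j * ((- ι 4) ^ k * ι (m C k) * ((- ι 4) ^ j * ι (m C j)) * (ι (n C k) * ι (n C k)))
          ≈⟨ solve 7 (λ h h′ f a f′ b e → h :* h′ :* (f :* a :* (f′ :* b) :* e) := a :* b :* (((f :* h) :* (f′ :* h′)) :* e)) refl (h ^ k) (h ^ j) _ _ _ _ _ ⟩
        ι (m C k) * ι (m C j) * (((- ι 4) ^ k * h ^ k) * ((- ι 4) ^ j * h ^ j) * (ι (n C k) * ι (n C k)))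
          ≈⟨ *-congˡ (*-cong (trans (*-cong (sym (^-distrib-* (- ι 4) h k)) (sym (^-distrib-* (- ι 4) h j))) (sym (^-homo-* y k j)))
               (*-cong (ι-cong (≡.cong (_C k) (≡.sym k+j≡n))) (ι-cong (≡.cong (_C k) (≡.sym k+j≡n))))) ⟩
        g k j ∎
        where
        j = n ∸ k
        k+j≡n : k ℕ.+ j ≡ n
        k+j≡n = ℕₚ.m+[n∸m]≡n k≤n

-- The derivation q d/dq and the Wronskian

module Derivation {c ℓ : Level} (R : CommutativeRing c ℓ) where
  open RingTools R
  open PowerSeries R
  private module S = RingTools series

  D : Series → Series
  D f n = ι n * f n

  D-+ : ∀ f g → D (f ⊕ g) ≋ D f ⊕ D g
  D-+ f g = coefficients λ n → distribˡ _ _ _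

  D-cong : ∀ {f g} → f ≋ g → D f ≋ D g
  D-cong e = coefficients λ n → *-congˡ (at e n)

  D-⊛ : ∀ f g → D (f ⊛ g) ≋ D f ⊛ g ⊕ f ⊛ D g
  D-⊛ f g = coefficients (go f)
    where
    D-tail : ∀ f → tail (D f) ≋ D (tail f) ⊕ tail f
    D-tail f = coefficients λ n → trans (*-congʳ (ι-suc n))
      (solve 2 (λ k x → (con (+ 1) :+ k) :* x := k :* x :+ x) refl _ _)
    go : ∀ f n → D (f ⊛ g) n ≈ (D f ⊛ g ⊕ f ⊛ D g) n
    go f zero    = solve 2 (λ x y → con (+ 0) :* (x :* y) := con (+ 0) :* x :* y :+ x :* (con (+ 0) :* y)) refl (f 0) (g 0)
    go f (suc n) = begin
      ι (suc n) * (f 0 * g (suc n) + (tail f ⊛ g) n)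
        ≈⟨ trans (distribˡ _ _ _) (+-congˡ (trans (*-congʳ (ι-suc n)) (distribʳ _ _ _))) ⟩
      ι (suc n) * (f 0 * g (suc n)) + (1# * (tail f ⊛ g) n + ι n * (tail f ⊛ g) n)
        ≈⟨ +-congˡ (+-congˡ (go (tail f) n)) ⟩
      ι (suc n) * (f 0 * g (suc n)) + (1# * (tail f ⊛ g) n + ((D (tail f) ⊛ g) n + (tail f ⊛ D g) n))
        ≈⟨ solve 7 (λ k a b z x y w → k :* (a :* b) :+ (con (+ 1) :* x :+ (y :+ w)) := (con (+ 0) :* a :* b :+ (y :+ x)) :+ (a :* (k :* b) :+ w)) refl (ι (suc n)) (f 0) (g (suc n)) 0# _ _ _ ⟩
      (ι 0 * f 0 * g (suc n) + ((D (tail f) ⊛ g) n + (tail f ⊛ g) n)) + (f 0 * (ι (suc n) * g (suc n)) + (tail f ⊛ D g) n)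
        ≈⟨ +-congʳ (+-congˡ (trans (at (S.*-congʳ (D-tail f)) n) (at (S.distribʳ g (D (tail f)) (tail f)) n))) ⟨
      (D f ⊛ g ⊕ f ⊛ D g) (suc n) ∎

  D-^ : ∀ f n → D (f S.^ suc n) ≋ S.ι (suc n) ⊛ (f S.^ n ⊛ D f)
  D-^ f zero = S.begin
    D (f ⊛ 𝟙)           S.≈⟨ D-cong (S.*-identityʳ f) ⟩
    D f                 S.≈⟨ S.solve 1 (λ x → x S.:= S.con (+ 1) S.:* (S.con (+ 1) S.:* x)) S.refl (D f) ⟩
    𝟙 ⊛ (𝟙 ⊛ D f)       S.∎
  D-^ f (suc n) = S.begin
    D (f ⊛ f S.^ suc n)
      S.≈⟨ D-⊛ f (f S.^ suc n) ⟩
    D f ⊛ f S.^ suc n ⊕ f ⊛ D (f S.^ suc n)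
      S.≈⟨ S.+-congˡ (S.*-congˡ (D-^ f n)) ⟩
    D f ⊛ (f ⊛ f S.^ n) ⊕ f ⊛ (S.ι (suc n) ⊛ (f S.^ n ⊛ D f))
      S.≈⟨ S.solve 4 (λ x g k d → d S.:* (x S.:* g) S.:+ x S.:* (k S.:* (g S.:* d)) S.:= (S.con (+ 1) S.:+ k) S.:* (x S.:* g S.:* d)) S.refl f (f S.^ n) (S.ι (suc n)) (D f) ⟩
    S.ι (suc (suc n)) ⊛ (f S.^ suc n ⊛ D f) S.∎

  wronskian : Series → Series → Series
  wronskian f g = g ⊛ D f ⊕ ⊖ (f ⊛ D g)

  -- The Wronskian is additive in f and vanishes on the pair g, g. This is what allows f - g to
  -- replace f.
  wronskian-shift : ∀ f g → wronskian (f ⊕ g) g ≋ wronskian f g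
  wronskian-shift f g = S.trans (S.+-congʳ (S.*-congˡ (D-+ f g)))
    (S.solve 4 (λ f g f′ g′ → g S.:* (f′ S.:+ g′) S.:- (f S.:+ g) S.:* g′ S.:= g S.:* f′ S.:- f S.:* g′) S.refl f g (D f) (D g))

  D-X⊛ : ∀ f → D (X ⊛ f) ≋ X ⊛ (f ⊕ D f)
  D-X⊛ f = S.trans (D-⊛ X f) (S.trans (S.+-congʳ (S.*-congʳ D-X)) (S.sym (S.distribˡ X f (D f))))
    where
    D-X : D X ≋ X
    D-X = coefficients λ { zero → zeroˡ _ ; (suc zero) → *-identityˡ _ ; (suc (suc n)) → zeroʳ _ }

  ^-at-0 : ∀ f n → (f S.^ n) 0 ≈ f 0 ^ n
  ^-at-0 f zero    = refl
  ^-at-0 f (suc n) = *-congˡ (^-at-0 f n)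

-- The coefficient of q^p in a Wronskian

module WronskianModP {c ℓ : Level} (R : CommutativeRing c ℓ) (m : ℕ) (χ : HasCharacteristic R (suc (2 ℕ.* m))) where
  open RingTools R
  open PowerSeries R
  open Derivation R
  open BinomialSums R using (C-zero; franel)
  open DombModP R m χ using (ι-p; ι-cancel; [-1]^-square; 4^m≈1; cubes)
  private
    module S = RingTools series
    p : ℕ
    p = suc (2 ℕ.* m)

  -- By Leibniz, i + 1 times the series is D(f^(i+1) g^(j+1)) minus (i+j+2) f^(i+1) gʲ D g. At q^p
  -- the derivative carries the factor p, and i + j + 2 = 2p; then i + 1 is cancelled.
  vanishing : ∀ f g i j → suc i ℕ.+ suc j ≡ p ℕ.+ p → p ∤ suc i → (f S.^ i ⊛ g S.^ j ⊛ wronskian f g) p ≈ 0#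
  vanishing f g i j i+j p∤ = ι-cancel p∤ (begin
    ι (suc i) * W p
      ≈⟨ ι-⊛ (suc i) W p ⟨
    (S.ι (suc i) ⊛ W) p
      ≈⟨ at rearranged p ⟩
    ι p * (f S.^ suc i ⊛ g S.^ suc j) p + - (S.ι (p ℕ.+ p) ⊛ V) p
      ≈⟨ +-cong (trans (*-congʳ ι-p) (zeroˡ _)) (-‿cong (trans (ι-⊛ (p ℕ.+ p) V p)
           (trans (*-congʳ (trans (ι-+ p p) (trans (+-cong ι-p ι-p) (+-identityˡ 0#)))) (zeroˡ _)))) ⟩
    0# + - 0#
      ≈⟨ -‿inverseʳ 0# ⟩
    0# ∎)
    where
    W V : Series
    W = f S.^ i ⊛ g S.^ j ⊛ wronskian f g
    V = f S.^ suc i ⊛ (g S.^ j ⊛ D g)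
    rearranged : S.ι (suc i) ⊛ W ≋ D (f S.^ suc i ⊛ g S.^ suc j) ⊕ ⊖ (S.ι (p ℕ.+ p) ⊛ V)
    rearranged = S.begin
      S.ι (suc i) ⊛ W
        S.≈⟨ S.solve 8 (λ k l f g F G f′ g′ → k S.:* (F S.:* G S.:* (g S.:* f′ S.:- f S.:* g′))
              S.:= (k S.:* (F S.:* f′)) S.:* (g S.:* G) S.:+ (f S.:* F) S.:* (l S.:* (G S.:* g′)) S.:- (k S.:+ l) S.:* (f S.:* F S.:* (G S.:* g′)))
              S.refl (S.ι (suc i)) (S.ι (suc j)) f g (f S.^ i) (g S.^ j) (D f) (D g) ⟩
      (S.ι (suc i) ⊛ (f S.^ i ⊛ D f)) ⊛ g S.^ suc j ⊕ f S.^ suc i ⊛ (S.ι (suc j) ⊛ (g S.^ j ⊛ D g)) ⊕ ⊖ ((S.ι (suc i) ⊕ S.ι (suc j)) ⊛ V)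
        S.≈⟨ S.+-cong (S.trans (S.+-cong (S.*-congʳ (S.sym (D-^ f i))) (S.*-congˡ (S.sym (D-^ g j)))) (S.sym (D-⊛ (f S.^ suc i) (g S.^ suc j))))
                      (S.-‿cong (S.*-congʳ (S.trans (S.sym (S.ι-+ (suc i) (suc j))) (S.ι-cong i+j)))) ⟩
      D (f S.^ suc i ⊛ g S.^ suc j) ⊕ ⊖ (S.ι (p ℕ.+ p) ⊛ V) S.∎

  module _ (ε g : Series) (ε₀ : ε 0 ≈ ι 2) (g₀ : g 0 ≈ 1#) where
    private
      δ f w : Series
      δ = X ⊛ ε
      f = δ ⊕ g
      w = wronskian f g

    -- Here i + 1 = p, so `vanishing` does not apply to f and g. After f = δ + g it applies to δ and
    -- g for every power δʳ with r < 2m. The term r = 2m is divisible by X^p because δ = Xε, and its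
    -- leading coefficient is 2^(2m) · 2 ≡ 2.
    middle-coefficient : (f S.^ (2 ℕ.* m) ⊛ g S.^ (2 ℕ.* m) ⊛ w) p ≈ ι 2
    middle-coefficient = begin
      (f S.^ (2 ℕ.* m) ⊛ g S.^ (2 ℕ.* m) ⊛ w) p
        ≈⟨ at expand p ⟩
      S.∑ p (λ r → S.ι ((2 ℕ.* m) C r) ⊛ T r) p
        ≈⟨ trans (∑-at p _ p) (∑-cong p (λ r _ → ι-⊛ ((2 ℕ.* m) C r) (T r) p)) ⟩
      ∑ p (λ r → ι ((2 ℕ.* m) C r) * T r p)
        ≈⟨ ∑-last (2 ℕ.* m) _ ⟩
      ∑ (2 ℕ.* m) (λ r → ι ((2 ℕ.* m) C r) * T r p) + ι ((2 ℕ.* m) C (2 ℕ.* m)) * T (2 ℕ.* m) p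
        ≈⟨ +-cong (∑-zero (2 ℕ.* m) (λ r r<2m → trans (*-congˡ (lower r r<2m)) (zeroʳ _)))
                  (trans (*-cong (ι-cong (nCn≡1 (2 ℕ.* m))) top) (*-identityˡ _)) ⟩
      0# + ι 2
        ≈⟨ +-identityˡ _ ⟩
      ι 2 ∎
      where
      T : ℕ → Series
      T r = δ S.^ r ⊛ g S.^ (2 ℕ.* m ∸ r ℕ.+ 2 ℕ.* m) ⊛ wronskian δ g
      expand : f S.^ (2 ℕ.* m) ⊛ g S.^ (2 ℕ.* m) ⊛ w ≋ S.∑ p (λ r → S.ι ((2 ℕ.* m) C r) ⊛ T r)
      expand = S.begin
        f S.^ (2 ℕ.* m) ⊛ g S.^ (2 ℕ.* m) ⊛ w
          S.≈⟨ S.trans (S.*-assoc _ _ w) (S.*-cong (S.binomial-theorem (2 ℕ.* m) δ g) (S.*-congˡ (wronskian-shift δ g))) ⟩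
        S.∑ p (λ r → S.ι ((2 ℕ.* m) C r) ⊛ (δ S.^ r ⊛ g S.^ (2 ℕ.* m ∸ r))) ⊛ (g S.^ (2 ℕ.* m) ⊛ wronskian δ g)
          S.≈⟨ S.∑-*ʳ p _ _ ⟩
        S.∑ p (λ r → S.ι ((2 ℕ.* m) C r) ⊛ (δ S.^ r ⊛ g S.^ (2 ℕ.* m ∸ r)) ⊛ (g S.^ (2 ℕ.* m) ⊛ wronskian δ g))
          S.≈⟨ S.∑-cong p (λ r _ → S.trans (S.solve 5 (λ k a b d e → k S.:* (a S.:* b) S.:* (d S.:* e) S.:= k S.:* (a S.:* (b S.:* d) S.:* e)) S.refl _ _ _ _ _)
                (S.*-congˡ (S.*-congʳ (S.*-congˡ (S.sym (S.^-homo-* g (2 ℕ.* m ∸ r) (2 ℕ.* m))))))) ⟩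
        S.∑ p (λ r → S.ι ((2 ℕ.* m) C r) ⊛ T r) S.∎
      lower : ∀ r → r < 2 ℕ.* m → T r p ≈ 0#
      lower r r<2m = vanishing δ g r (2 ℕ.* m ∸ r ℕ.+ 2 ℕ.* m) eq (>⇒∤ (s≤s r<2m))
        where
        open ℕ-Solver.+-*-Solver using () renaming (solve to solveℕ; _:=_ to _:≡_; _:+_ to _:⊹_; con to conℕ)
        eq : suc r ℕ.+ suc (2 ℕ.* m ∸ r ℕ.+ 2 ℕ.* m) ≡ p ℕ.+ p
        eq = ≡.trans (solveℕ 3 (λ r s t → (conℕ 1 :⊹ r) :⊹ (conℕ 1 :⊹ (s :⊹ t)) :≡ (conℕ 1 :⊹ (r :⊹ s)) :⊹ (conℕ 1 :⊹ t)) ≡.refl r (2 ℕ.* m ∸ r) (2 ℕ.* m))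
          (≡.cong (λ k → suc k ℕ.+ p) (ℕₚ.m+[n∸m]≡n (ℕₚ.<⇒≤ r<2m)))
      top : T (2 ℕ.* m) p ≈ ι 2
      top = begin
        T (2 ℕ.* m) p
          ≈⟨ at factor p ⟩
        (X S.^ p ⊛ H) p
          ≡⟨ ≡.cong (X S.^ p ⊛ H) (ℕₚ.+-identityʳ p) ⟨
        (X S.^ p ⊛ H) (p ℕ.+ 0)
          ≈⟨ X^-⊛ p H 0 ⟩
        H 0
          ≈⟨ *-congʳ (*-cong (trans (^-at-0 ε (2 ℕ.* m)) (^-congˡ (2 ℕ.* m) ε₀)) (trans (^-at-0 g e) (trans (^-congˡ e g₀) (1^n≈1 e)))) ⟩
        ι 2 ^ (2 ℕ.* m) * 1# * (g 0 * (ε 0 + ι 0 * ε 0) + - (ε 0 * (ι 0 * g 0)))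
          ≈⟨ solve 3 (λ a g e → a :* con (+ 1) :* (g :* (e :+ con (+ 0) :* e) :- e :* (con (+ 0) :* g)) := a :* (g :* e)) refl _ (g 0) (ε 0) ⟩
        ι 2 ^ (2 ℕ.* m) * (g 0 * ε 0)
          ≈⟨ *-cong (trans (sym (square-^ (ι 2) m)) (trans (^-distrib-* (ι 2) (ι 2) m) 4^m≈1)) (trans (*-cong g₀ ε₀) (*-identityˡ _)) ⟩
        1# * ι 2
          ≈⟨ *-identityˡ _ ⟩
        ι 2 ∎
        where
        e : ℕ
        e = 2 ℕ.* m ∸ 2 ℕ.* m ℕ.+ 2 ℕ.* m
        H : Series
        H = ε S.^ (2 ℕ.* m) ⊛ g S.^ e ⊛ (g ⊛ (ε ⊕ D ε) ⊕ ⊖ (ε ⊛ D g))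
        factor : T (2 ℕ.* m) ≋ X S.^ p ⊛ H
        factor = S.begin
          δ S.^ (2 ℕ.* m) ⊛ g S.^ e ⊛ (g ⊛ D (X ⊛ ε) ⊕ ⊖ (X ⊛ ε ⊛ D g))
            S.≈⟨ S.*-cong (S.*-congʳ (S.^-distrib-* X ε (2 ℕ.* m))) (S.+-congʳ (S.*-congˡ (D-X⊛ ε))) ⟩
          X S.^ (2 ℕ.* m) ⊛ ε S.^ (2 ℕ.* m) ⊛ g S.^ e ⊛ (g ⊛ (X ⊛ (ε ⊕ D ε)) ⊕ ⊖ (X ⊛ ε ⊛ D g))
            S.≈⟨ S.solve 8 (λ x y z h g t e g′ → y S.:* z S.:* h S.:* (g S.:* (x S.:* t) S.:- x S.:* e S.:* g′)
                  S.:= x S.:* y S.:* (z S.:* h S.:* (g S.:* t S.:- e S.:* g′))) S.refl X (X S.^ (2 ℕ.* m)) _ _ g (ε ⊕ D ε) ε (D g) ⟩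
          X S.^ p ⊛ H S.∎

    wronskian-coefficient : Landen.squareSum series m (f ⊛ f ⊕ ⊖ (g ⊛ g)) (g ⊛ g) ≋ 𝟙 → w p ≈ (- 1#) ^ m * cubes * ι 2
    wronskian-coefficient hasse = begin
      w p
        ≈⟨ at (S.trans (S.sym (S.*-identityˡ w)) (S.*-congʳ (S.sym hasse))) p ⟩
      (Landen.squareSum series m a b ⊛ w) p
        ≈⟨ trans (at (S.∑-*ʳ (suc m) w _) p) (∑-at (suc m) _ p) ⟩
      ∑ (suc m) (λ n → (S.ι (m C n) ⊛ S.ι (m C n) ⊛ ((a ⊛ a) S.^ n ⊛ (b ⊛ b) S.^ (m ∸ n)) ⊛ w) p)
        ≈⟨ ∑-cong (suc m) (λ { n (s≤s n≤m) → each n n≤m }) ⟩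
      ∑ (suc m) (λ n → (- 1#) ^ m * ι 2 * (ι (m C n) * ι (m C n) * ι ((2 ℕ.* n) C m)))
        ≈⟨ trans (sym (∑-*ˡ (suc m) _ _)) (*-congˡ (franel m)) ⟩
      (- 1#) ^ m * ι 2 * cubes
        ≈⟨ solve 3 (λ x y z → x :* y :* z := x :* z :* y) refl _ _ _ ⟩
      (- 1#) ^ m * cubes * ι 2 ∎
      where
      a b : Series
      a = f ⊛ f ⊕ ⊖ (g ⊛ g)
      b = g ⊛ g

      each : ∀ n → n ≤ m → (S.ι (m C n) ⊛ S.ι (m C n) ⊛ ((a ⊛ a) S.^ n ⊛ (b ⊛ b) S.^ (m ∸ n)) ⊛ w) p
                         ≈ (- 1#) ^ m * ι 2 * (ι (m C n) * ι (m C n) * ι ((2 ℕ.* n) C m))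
      each n n≤m = begin
        (S.ι (m C n) ⊛ S.ι (m C n) ⊛ ((a ⊛ a) S.^ n ⊛ (b ⊛ b) S.^ (m ∸ n)) ⊛ w) p
          ≈⟨ at (S.trans (S.solve 4 (λ k x y w → k S.:* k S.:* (x S.:* y) S.:* w S.:= k S.:* (k S.:* (x S.:* (y S.:* w)))) S.refl _ _ _ w)
                   (S.*-congˡ (S.*-congˡ expand))) p ⟩
        (S.ι (m C n) ⊛ (S.ι (m C n) ⊛ S.∑ (suc (2 ℕ.* n)) (λ r → S.ι ((2 ℕ.* n) C r) ⊛ T r))) p
          ≈⟨ trans (ι-⊛ (m C n) _ p) (*-congˡ (ι-⊛ (m C n) _ p)) ⟩
        ι (m C n) * (ι (m C n) * S.∑ (suc (2 ℕ.* n)) (λ r → S.ι ((2 ℕ.* n) C r) ⊛ T r) p)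
          ≈⟨ *-congˡ (*-congˡ (trans (∑-at (suc (2 ℕ.* n)) _ p) (∑-cong (suc (2 ℕ.* n)) (λ r _ → ι-⊛ ((2 ℕ.* n) C r) (T r) p)))) ⟩
        ι (m C n) * (ι (m C n) * ∑ (suc (2 ℕ.* n)) t)
          -- The range r ≤ 2n is extended by zeros to r ≤ 2m, so that r = m lies in it for every n.
          ≈⟨ *-congˡ (*-congˡ (trans (sym (∑-truncate t (s≤s (ℕₚ.*-monoʳ-≤ 2 n≤m)) (λ r 2n<r → C-zero _ 2n<r))) (∑-single p m t (s≤s (ℕₚ.m≤m+n m _)) off))) ⟩
        ι (m C n) * (ι (m C n) * t m)
          ≈⟨ *-congˡ (*-congˡ central) ⟩
        ι (m C n) * (ι (m C n) * (ι ((2 ℕ.* n) C m) * ((- 1#) ^ m * ι 2)))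
          ≈⟨ solve 4 (λ k x y z → k :* (k :* (x :* (y :* z))) := y :* z :* (k :* k :* x)) refl _ _ _ _ ⟩
        (- 1#) ^ m * ι 2 * (ι (m C n) * ι (m C n) * ι ((2 ℕ.* n) C m)) ∎
        where
        T : ℕ → Series
        T r = (f ⊛ f) S.^ r ⊛ (⊖ b) S.^ (2 ℕ.* n ∸ r) ⊛ ((b ⊛ b) S.^ (m ∸ n) ⊛ w)
        t : ℕ → Carrier
        t r = ι ((2 ℕ.* n) C r) * T r p
        expand : (a ⊛ a) S.^ n ⊛ ((b ⊛ b) S.^ (m ∸ n) ⊛ w) ≋ S.∑ (suc (2 ℕ.* n)) (λ r → S.ι ((2 ℕ.* n) C r) ⊛ T r)
        expand = S.trans (S.*-congʳ (S.trans (S.square-^ a n) (S.binomial-theorem (2 ℕ.* n) (f ⊛ f) (⊖ b))))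
          (S.trans (S.∑-*ʳ (suc (2 ℕ.* n)) _ _) (S.∑-cong (suc (2 ℕ.* n)) (λ r _ → S.*-assoc _ _ _)))

        -- The power of g beside f^(2r): b = g² occurs 2n - r times from the binomial theorem and
        -- 2(m - n) times from (b²)^(m-n).
        exponent : ℕ → ℕ
        exponent r = 2 ℕ.* (2 ℕ.* n ∸ r ℕ.+ 2 ℕ.* (m ∸ n))

        T-normal : ∀ r → T r p ≈ (- 1#) ^ (2 ℕ.* n ∸ r) * (f S.^ (2 ℕ.* r) ⊛ g S.^ exponent r ⊛ w) p
        T-normal r = trans (at (S.begin
          (f ⊛ f) S.^ r ⊛ (⊖ b) S.^ s ⊛ ((b ⊛ b) S.^ (m ∸ n) ⊛ w)
            S.≈⟨ S.*-cong (S.*-cong (S.square-^ f r) (S.trans (S.^-congˡ s (S.trans (S.solve 1 (λ b → S.:- b S.:= S.:- S.con (+ 1) S.:* b) S.refl b)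
                                     (S.*-congʳ (S.trans (S.-‿cong (S.sym constant-1)) (S.sym (constant-neg 1#))))))
                                   (S.trans (S.^-distrib-* _ b s) (S.*-congʳ (S.sym (constant-^ (- 1#) s))))))
                          (S.*-congʳ (S.square-^ b (m ∸ n))) ⟩
          f S.^ (2 ℕ.* r) ⊛ (constant ((- 1#) ^ s) ⊛ b S.^ s) ⊛ (b S.^ (2 ℕ.* (m ∸ n)) ⊛ w)
            S.≈⟨ S.solve 5 (λ x c y z w → x S.:* (c S.:* y) S.:* (z S.:* w) S.:= c S.:* (x S.:* (y S.:* z) S.:* w)) S.refl _ _ _ _ w ⟩
          constant ((- 1#) ^ s) ⊛ (f S.^ (2 ℕ.* r) ⊛ (b S.^ s ⊛ b S.^ (2 ℕ.* (m ∸ n))) ⊛ w)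
            S.≈⟨ S.*-congˡ (S.*-congʳ (S.*-congˡ (S.trans (S.sym (S.^-homo-* b s (2 ℕ.* (m ∸ n)))) (S.square-^ g (s ℕ.+ 2 ℕ.* (m ∸ n)))))) ⟩
          constant ((- 1#) ^ s) ⊛ (f S.^ (2 ℕ.* r) ⊛ g S.^ exponent r ⊛ w) S.∎) p)
          (constant-⊛ _ _ p)
          where
          s : ℕ
          s = 2 ℕ.* n ∸ r

        exponent-sum : ∀ {r} → r ≤ 2 ℕ.* n → r ℕ.+ (2 ℕ.* n ∸ r ℕ.+ 2 ℕ.* (m ∸ n)) ≡ 2 ℕ.* m
        exponent-sum {r} r≤2n = ≡.trans (≡.sym (ℕₚ.+-assoc r _ _)) (≡.trans (≡.cong (ℕ._+ 2 ℕ.* (m ∸ n)) (ℕₚ.m+[n∸m]≡n r≤2n))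
          (≡.trans (≡.sym (ℕₚ.*-distribˡ-+ 2 n (m ∸ n))) (≡.cong (2 ℕ.*_) (ℕₚ.m+[n∸m]≡n n≤m))))

        off : ∀ r → r < p → r ≢ m → t r ≈ 0#
        off r (s≤s r≤2m) r≢m with r ℕ.≤? 2 ℕ.* n
        ... | no r≰2n  = C-zero _ (ℕₚ.≰⇒> r≰2n)
        ... | yes r≤2n = trans (*-congˡ (trans (T-normal r) (trans (*-congˡ (vanishing f g (2 ℕ.* r) (exponent r) eq p∤)) (zeroʳ _)))) (zeroʳ _)
          where
          open ℕ-Solver.+-*-Solver using () renaming (solve to solveℕ; _:=_ to _:≡_; _:+_ to _:⊹_; _:*_ to _:×_; con to conℕ)
          eq : suc (2 ℕ.* r) ℕ.+ suc (exponent r) ≡ p ℕ.+ p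
          eq = ≡.trans (solveℕ 2 (λ r s → (conℕ 1 :⊹ conℕ 2 :× r) :⊹ (conℕ 1 :⊹ conℕ 2 :× s) :≡ (conℕ 1 :⊹ (r :⊹ s)) :⊹ (conℕ 1 :⊹ (r :⊹ s))) ≡.refl r (2 ℕ.* n ∸ r ℕ.+ 2 ℕ.* (m ∸ n)))
            (≡.cong (λ k → suc k ℕ.+ suc k) (exponent-sum r≤2n))
          -- 0 < 2r + 1 < 2p leaves p itself as the only possible multiple of p, and that would mean
          -- r = m.
          p∤ : p ∤ suc (2 ℕ.* r)
          p∤ (ℕ∣.divides zero ())
          p∤ (ℕ∣.divides (suc zero) e) = r≢m (ℕₚ.*-cancelˡ-≡ r m 2 (ℕₚ.suc-injective (≡.trans e (ℕₚ.*-identityˡ p))))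
          p∤ (ℕ∣.divides (suc (suc q)) e) = ℕₚ.<-irrefl e (ℕₚ.<-≤-trans bound (ℕₚ.+-monoʳ-≤ p (ℕₚ.m≤m+n p (q ℕ.* p))))
            where
            bound : suc (2 ℕ.* r) < p ℕ.+ p
            bound = s≤s (ℕₚ.≤-trans (ℕₚ.≤-reflexive (≡.cong suc (≡.cong (r ℕ.+_) (ℕₚ.+-identityʳ r))))
              (ℕₚ.≤-trans (s≤s (ℕₚ.+-mono-≤ r≤2m r≤2m)) (ℕₚ.≤-reflexive (≡.sym (ℕₚ.+-suc (2 ℕ.* m) (2 ℕ.* m))))))

        central : t m ≈ ι ((2 ℕ.* n) C m) * ((- 1#) ^ m * ι 2)
        central with m ℕ.≤? 2 ℕ.* n
        ... | no m≰2n  = trans (C-zero _ (ℕₚ.≰⇒> m≰2n)) (sym (C-zero _ (ℕₚ.≰⇒> m≰2n)))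
        ... | yes m≤2n = *-congˡ (trans (T-normal m) (*-cong sign
            (trans (reflexive (≡.cong (λ k → (f S.^ (2 ℕ.* m) ⊛ g S.^ k ⊛ w) p) (≡.cong (2 ℕ.*_) exponent≡m))) middle-coefficient)))
          where
          exponent≡m : 2 ℕ.* n ∸ m ℕ.+ 2 ℕ.* (m ∸ n) ≡ m
          exponent≡m = ℕₚ.+-cancelˡ-≡ m _ _ (≡.trans (exponent-sum m≤2n) (≡.cong (m ℕ.+_) (ℕₚ.+-identityʳ m)))
          sign : (- 1#) ^ (2 ℕ.* n ∸ m) ≈ (- 1#) ^ m
          sign = begin
            (- 1#) ^ (2 ℕ.* n ∸ m)
              ≈⟨ trans (*-congˡ ([-1]^-square m)) (*-identityʳ _) ⟨
            (- 1#) ^ (2 ℕ.* n ∸ m) * ((- 1#) ^ m * (- 1#) ^ m)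
              ≈⟨ *-assoc _ _ _ ⟨
            (- 1#) ^ (2 ℕ.* n ∸ m) * (- 1#) ^ m * (- 1#) ^ m
              ≈⟨ *-congʳ (trans (sym (^-homo-* (- 1#) (2 ℕ.* n ∸ m) m)) (trans (^-congʳ (- 1#) (ℕₚ.m∸n+n≡m m≤2n)) (trans (sym (square-^ (- 1#) n)) (trans (^-distrib-* _ _ n) ([-1]^-square n))))) ⟩
            1# * (- 1#) ^ m
              ≈⟨ *-identityˡ _ ⟩
            (- 1#) ^ m ∎

parity : ∀ n → ∃ λ k → n ≡ k ℕ.+ k ⊎ n ≡ suc (k ℕ.+ k)
parity zero = 0 , inj₁ ≡.refl
parity (suc n) with parity n
... | k , inj₁ e = k , inj₂ (≡.cong suc e)
... | k , inj₂ e = suc k , inj₁ (≡.trans (≡.cong suc e) (≡.cong suc (≡.sym (ℕₚ.+-suc k k))))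

-- The substitution q ↦ q² and its fixed points

module Dilation {c ℓ : Level} (R : CommutativeRing c ℓ) where
  open RingTools R
  open PowerSeries R
  private module S = RingTools series

  -- The substitution q ↦ q².
  σ : Series → Series
  σ f zero          = f 0
  σ f (suc zero)    = 0#
  σ f (suc (suc n)) = σ (tail f) n

  σ-even : ∀ f k → σ f (k ℕ.+ k) ≈ f k
  σ-even f zero    = refl
  σ-even f (suc k) = trans (reflexive (≡.cong (λ j → σ f (suc j)) (ℕₚ.+-suc k k))) (σ-even (tail f) k)

  σ-odd : ∀ f k → σ f (suc (k ℕ.+ k)) ≈ 0#
  σ-odd f zero    = refl
  σ-odd f (suc k) = trans (reflexive (≡.cong (λ j → σ f (suc (suc j))) (ℕₚ.+-suc k k))) (σ-odd (tail f) k)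

  σ-cong : ∀ {f g} → f ≋ g → σ f ≋ σ g
  σ-cong e = coefficients (go (at e))
    where
    go : ∀ {f g} → (∀ n → f n ≈ g n) → ∀ n → σ f n ≈ σ g n
    go e zero          = e 0
    go e (suc zero)    = refl
    go e (suc (suc n)) = go (λ k → e (suc k)) n

  σ-⊕ : ∀ f g → σ (f ⊕ g) ≋ σ f ⊕ σ g
  σ-⊕ f g = coefficients (go f g)
    where
    go : ∀ f g n → σ (f ⊕ g) n ≈ σ f n + σ g n
    go f g zero          = refl
    go f g (suc zero)    = sym (+-identityˡ 0#)
    go f g (suc (suc n)) = go (tail f) (tail g) n

  σ-⊖ : ∀ f → σ (⊖ f) ≋ ⊖ σ f
  σ-⊖ f = coefficients (go f)
    where
    go : ∀ f n → σ (⊖ f) n ≈ - σ f n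
    go f zero          = refl
    go f (suc zero)    = sym ε⁻¹≈ε
    go f (suc (suc n)) = go (tail f) n

  σ-𝟘 : σ 𝟘 ≋ 𝟘
  σ-𝟘 = coefficients go
    where
    go : ∀ n → σ 𝟘 n ≈ 0#
    go zero          = refl
    go (suc zero)    = refl
    go (suc (suc n)) = go n

  σ-𝟙 : σ 𝟙 ≋ 𝟙
  σ-𝟙 = coefficients λ { zero → refl ; (suc zero) → refl ; (suc (suc n)) → at σ-𝟘 n }

  σ-⊛ : ∀ f g → σ (f ⊛ g) ≋ σ f ⊛ σ g
  σ-⊛ f g = coefficients (go f)
    where
    σ-scale : ∀ a f n → σ (λ k → a * f k) n ≈ a * σ f n
    σ-scale a f zero          = refl
    σ-scale a f (suc zero)    = sym (zeroʳ a)
    σ-scale a f (suc (suc n)) = σ-scale a (tail f) n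
    go : ∀ f n → σ (f ⊛ g) n ≈ (σ f ⊛ σ g) n
    go f zero          = refl
    go f (suc zero)    = sym (trans (+-cong (zeroʳ _) (zeroˡ _)) (+-identityˡ 0#))
    go f (suc (suc n)) = begin
      σ (tail (f ⊛ g)) n
        ≈⟨ at (σ-⊕ (λ k → f 0 * g (suc k)) (tail f ⊛ g)) n ⟩
      σ (λ k → f 0 * g (suc k)) n + σ (tail f ⊛ g) n
        ≈⟨ +-cong (σ-scale (f 0) (tail g) n) (go (tail f) n) ⟩
      f 0 * σ (tail g) n + (σ (tail f) ⊛ σ g) n
        ≈⟨ +-congˡ (trans (+-congʳ (zeroˡ _)) (+-identityˡ _)) ⟨
      (σ f ⊛ σ g) (suc (suc n)) ∎

  σ-^ : ∀ f n → σ (f S.^ n) ≋ σ f S.^ n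
  σ-^ f zero    = σ-𝟙
  σ-^ f (suc n) = S.trans (σ-⊛ f (f S.^ n)) (S.*-congˡ (σ-^ f n))

  σ-ι : ∀ n → σ (S.ι n) ≋ S.ι n
  σ-ι zero          = σ-𝟘
  σ-ι (suc zero)    = σ-𝟙
  σ-ι (suc (suc n)) = S.trans (σ-⊕ 𝟙 (S.ι (suc n))) (S.+-cong σ-𝟙 (σ-ι (suc n)))

  σ-∑ : ∀ n F → σ (S.∑ n F) ≋ S.∑ n (λ k → σ (F k))
  σ-∑ zero    F = S.trans (σ-cong (S.∑-empty F)) (S.trans σ-𝟘 (S.sym (S.∑-empty _)))
  σ-∑ (suc n) F = S.trans (σ-cong (S.∑-suc n F))
    (S.trans (σ-⊕ (F 0) (S.∑ n (λ k → F (suc k)))) (S.trans (S.+-congˡ (σ-∑ n (λ k → F (suc k)))) (S.sym (S.∑-suc n _))))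

  σ-squareSum : ∀ m a b → σ (Landen.squareSum series m a b) ≋ Landen.squareSum series m (σ a) (σ b)
  σ-squareSum m a b = S.trans (σ-∑ (suc m) _) (S.∑-cong (suc m) (λ i _ →
    S.trans (σ-⊛ _ _) (S.*-cong (S.trans (σ-⊛ _ _) (S.*-cong (σ-ι (m C i)) (σ-ι (m C i))))
      (S.trans (σ-⊛ _ _) (S.*-cong (square-σ a i) (square-σ b (m ∸ i)))))))
    where
    square-σ : ∀ a i → σ ((a ⊛ a) S.^ i) ≋ (σ a ⊛ σ a) S.^ i
    square-σ a i = S.trans (σ-^ (a ⊛ a) i) (S.^-congˡ i (σ-⊛ a a))

  -- A fixed series has zero odd coefficients, and its coefficient at 2k equals the one at k < 2k;
  -- strong induction removes every positive exponent.
  σ-fixed : ∀ f → σ f ≋ f → f ≋ constant (f 0)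
  σ-fixed f e = coefficients λ { zero → refl ; (suc n) → <-rec (λ n → f (suc n) ≈ 0#) step n }
    where
    step : ∀ n → (∀ {k} → k < n → f (suc k) ≈ 0#) → f (suc n) ≈ 0#
    step n rec with parity (suc n)
    ... | k , inj₂ eq     = trans (sym (at e (suc n))) (trans (reflexive (≡.cong (σ f) eq)) (σ-odd f k))
    ... | suc k , inj₁ eq = trans (sym (at e (suc n))) (trans (reflexive (≡.cong (σ f) eq))
      (trans (σ-even f (suc k)) (rec (ℕₚ.≤-trans (ℕₚ.m≤n+m (suc k) k) (ℕₚ.≤-reflexive (≡.sym (ℕₚ.suc-injective eq)))))))

HasCharacteristic-series : ∀ {c ℓ} {R : CommutativeRing c ℓ} {p} → HasCharacteristic R p → HasCharacteristic (PowerSeries.series R) p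
HasCharacteristic-series {R = R} {p} χ = record
  { ι-p      = coefficients λ n → trans (sym (at (constant-ι p) n)) (constant-zero n)
  ; ι-cancel = λ {n} {f} p∤n e → coefficients λ k → ι-cancel p∤n (trans (sym (ι-⊛ n f k)) (at e k)) }
  where
  open RingTools R
  open PowerSeries R
  open HasCharacteristic χ
  constant-zero : ∀ n → constant (ι p) n ≈ 0#
  constant-zero zero    = ι-p
  constant-zero (suc n) = refl

-- The Hasse invariant modulo p

module HasseInvariant {c ℓ : Level} (R : CommutativeRing c ℓ) (m : ℕ) (χ : HasCharacteristic R (suc (2 ℕ.* m))) where
  open RingTools R
  open PowerSeries R
  open Dilation R
  private
    module S = RingTools series
  open Landen series using (squareSum; landen)
  open DombModP series m (HasCharacteristic-series χ) using (central-binomial)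

  -- After the substitution for (a-b)², `central-binomial` over power series turns C(m,n)(-4)ⁿ into
  -- C(2n,n). What results is the left side of `landen` for b - c and c, whose sum is b.
  landen-mod-p : ∀ a b c → (a ⊕ ⊖ b) ⊛ (a ⊕ ⊖ b) ≋ S.ι 4 ⊛ (c ⊛ (b ⊕ ⊖ c)) →
                 squareSum m (a ⊕ ⊖ b) b ≋ squareSum m (b ⊕ ⊖ c) c
  landen-mod-p a b c agm = S.begin
    squareSum m (a ⊕ ⊖ b) b
      S.≈⟨ S.∑-cong (suc m) (λ { i (s≤s i≤m) → term i i≤m }) ⟩
    S.∑ (suc m) (λ n → S.ι (m C n) ⊛ S.ι ((2 ℕ.* n) C n) ⊛ ((⊖ ((b ⊕ ⊖ c) ⊛ c)) S.^ n ⊛ (((b ⊕ ⊖ c) ⊕ c) ⊛ ((b ⊕ ⊖ c) ⊕ c)) S.^ (m ∸ n)))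
      S.≈⟨ landen m (b ⊕ ⊖ c) c ⟩
    squareSum m (b ⊕ ⊖ c) c S.∎
    where
    term : ∀ n → n ≤ m → S.ι (m C n) ⊛ S.ι (m C n) ⊛ (((a ⊕ ⊖ b) ⊛ (a ⊕ ⊖ b)) S.^ n ⊛ (b ⊛ b) S.^ (m ∸ n))
      ≋ S.ι (m C n) ⊛ S.ι ((2 ℕ.* n) C n) ⊛ ((⊖ ((b ⊕ ⊖ c) ⊛ c)) S.^ n ⊛ (((b ⊕ ⊖ c) ⊕ c) ⊛ ((b ⊕ ⊖ c) ⊕ c)) S.^ (m ∸ n))
    term n n≤m = S.begin
      S.ι (m C n) ⊛ S.ι (m C n) ⊛ (((a ⊕ ⊖ b) ⊛ (a ⊕ ⊖ b)) S.^ n ⊛ (b ⊛ b) S.^ (m ∸ n))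
        S.≈⟨ S.*-congˡ (S.*-cong
               (S.trans (S.^-congˡ n (S.trans agm (S.solve 2 (λ b c → S.con (+ 4) S.:* (c S.:* (b S.:- c)) S.:= S.:- S.con (+ 4) S.:* S.:- ((b S.:- c) S.:* c)) S.refl b c)))
                        (S.^-distrib-* (S.- S.ι 4) _ n))
               (S.^-congˡ (m ∸ n) (S.solve 2 (λ b c → b S.:* b S.:= ((b S.:- c) S.:+ c) S.:* ((b S.:- c) S.:+ c)) S.refl b c))) ⟩
      S.ι (m C n) ⊛ S.ι (m C n) ⊛ ((S.- S.ι 4) S.^ n ⊛ (⊖ ((b ⊕ ⊖ c) ⊛ c)) S.^ n ⊛ (((b ⊕ ⊖ c) ⊕ c) ⊛ ((b ⊕ ⊖ c) ⊕ c)) S.^ (m ∸ n))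
        S.≈⟨ S.solve 4 (λ k x y z → k S.:* k S.:* (x S.:* y S.:* z) S.:= k S.:* (x S.:* k) S.:* (y S.:* z)) S.refl _ _ _ _ ⟩
      S.ι (m C n) ⊛ ((S.- S.ι 4) S.^ n ⊛ S.ι (m C n)) ⊛ ((⊖ ((b ⊕ ⊖ c) ⊛ c)) S.^ n ⊛ (((b ⊕ ⊖ c) ⊕ c) ⊛ ((b ⊕ ⊖ c) ⊕ c)) S.^ (m ∸ n))
        S.≈⟨ S.*-congʳ (S.*-congˡ (S.sym (central-binomial n (ℕₚ.≤-trans n≤m (ℕₚ.m≤m+n m _))))) ⟩
      S.ι (m C n) ⊛ S.ι ((2 ℕ.* n) C n) ⊛ ((⊖ ((b ⊕ ⊖ c) ⊛ c)) S.^ n ⊛ (((b ⊕ ⊖ c) ⊕ c) ⊛ ((b ⊕ ⊖ c) ⊕ c)) S.^ (m ∸ n)) S.∎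

  -- By Landen's identity the Hasse invariant of the period a, b is fixed by q ↦ q², hence constant.
  hasse≈1 : ∀ a → a 0 ≈ 1# →
    (a ⊕ ⊖ σ a) ⊛ (a ⊕ ⊖ σ a) ≋ S.ι 4 ⊛ (σ (σ a) ⊛ (σ a ⊕ ⊖ σ (σ a))) →
    squareSum m (a ⊕ ⊖ σ a) (σ a) ≋ 𝟙
  hasse≈1 a a₀ agm = S.trans (σ-fixed H fixed) (S.trans (constant-cong H₀) constant-1)
    where
    H : Series
    H = squareSum m (a ⊕ ⊖ σ a) (σ a)
    fixed : σ H ≋ H
    fixed = S.trans (σ-squareSum m (a ⊕ ⊖ σ a) (σ a))
      (S.trans (S.∑-cong (suc m) (λ i _ → S.*-congˡ (S.*-congʳ (S.^-congˡ i (S.*-cong e e)))))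
        (S.sym (landen-mod-p a (σ a) (σ (σ a)) agm)))
      where
      e : σ (a ⊕ ⊖ σ a) ≋ σ a ⊕ ⊖ σ (σ a)
      e = S.trans (σ-⊕ a (⊖ σ a)) (S.+-congˡ (σ-⊖ (σ a)))
    -- a and σ a have the same constant term, so only the summand i = 0 reaches exponent 0.
    H₀ : H 0 ≈ 1#
    H₀ = begin
      H 0
        ≈⟨ ∑-at (suc m) _ 0 ⟩
      ∑ (suc m) t
        ≈⟨ ∑-single (suc m) 0 t (s≤s z≤n) off ⟩
      t 0
        ≈⟨ *-cong (*-identityˡ 1#) (trans (*-identityˡ _) (trans (Derivation.^-at-0 R (σ a ⊛ σ a) m)
             (trans (^-congˡ m (trans (*-cong a₀ a₀) (*-identityˡ 1#))) (1^n≈1 m)))) ⟩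
      1# * 1#
        ≈⟨ *-identityˡ 1# ⟩
      1# ∎
      where
      t : ℕ → Carrier
      t i = (S.ι (m C i) ⊛ S.ι (m C i) ⊛ (((a ⊕ ⊖ σ a) ⊛ (a ⊕ ⊖ σ a)) S.^ i ⊛ (σ a ⊛ σ a) S.^ (m ∸ i))) 0
      off : ∀ k → k < suc m → k ≢ 0 → t k ≈ 0#
      off zero    _ k≢0 with () ← k≢0 ≡.refl
      off (suc k) _ _   = trans (*-congˡ (trans (*-congʳ (trans (*-congʳ (trans (*-congʳ (-‿inverseʳ (a 0))) (zeroˡ _))) (zeroˡ _))) (zeroˡ _))) (zeroʳ _)

-- Counting fibres inside finite lists

module Counting where
  open ≡

  private variable
    A B : Set

  count : (A → ℕ) → List A → ℕ → ℕ
  count φ L n = length (filter (λ a → φ a ℕ.≟ n) L)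

  Complete : (A → ℕ) → ℕ → List A → Set
  Complete φ n L = ∀ a → φ a ≡ n → a ∈ L

  -- A duplicate-free list that contains the whole fibre over n, once filtered, enumerates that
  -- fibre exactly once. Changes of variables thereby reduce to injectivity and surjectivity, and
  -- the size of the box becomes irrelevant.
  count-complete : (φ : A → ℕ) → ∀ n {L L′} → Unique L → Unique L′ → Complete φ n L → Complete φ n L′ →
                   count φ L n ≡ count φ L′ n
  count-complete φ n {L} {L′} u u′ c c′ = ↭-length (∼bag⇒↭ (unique∧set⇒bag
    (Uniqueₚ.filter⁺ φ≟n u) (Uniqueₚ.filter⁺ φ≟n u′)
    (λ {a} → mk⇔ (λ a∈ → let e = proj₂ (∈-filter⁻ φ≟n {xs = L} a∈) in ∈-filter⁺ φ≟n (c′ a e) e)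
                 (λ a∈ → let e = proj₂ (∈-filter⁻ φ≟n {xs = L′} a∈) in ∈-filter⁺ φ≟n (c a e) e))))
    where
    φ≟n = λ a → φ a ℕ.≟ n

  count-++ : (φ : A → ℕ) → ∀ L L′ n → count φ (L ++ L′) n ≡ count φ L n ℕ.+ count φ L′ n
  count-++ φ L L′ n = trans (cong length (Listₚ.filter-++ (λ a → φ a ℕ.≟ n) L L′)) (Listₚ.length-++ (filter (λ a → φ a ℕ.≟ n) L))

  count-accept : (φ : A → ℕ) → ∀ {a n} L → φ a ≡ n → count φ (a ∷ L) n ≡ suc (count φ L n)
  count-accept φ {n = n} L e = cong length (Listₚ.filter-accept (λ a → φ a ℕ.≟ n) {xs = L} e)

  count-reject : (φ : A → ℕ) → ∀ {a n} L → φ a ≢ n → count φ (a ∷ L) n ≡ count φ L n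
  count-reject φ {n = n} L e = cong length (Listₚ.filter-reject (λ a → φ a ℕ.≟ n) {xs = L} e)

  count-map : (φ : B → ℕ) (ψ : A → ℕ) (f : A → B) → (∀ a → φ (f a) ≡ ψ a) → ∀ L n → count φ (map f L) n ≡ count ψ L n
  count-map φ ψ f e []      n = refl
  count-map φ ψ f e (a ∷ L) n with ψ a ℕ.≟ n
  ... | yes ψa≡n = trans (count-accept φ (map f L) (trans (e a) ψa≡n)) (trans (cong suc (count-map φ ψ f e L n)) (sym (count-accept ψ L ψa≡n)))
  ... | no ψa≢n  = trans (count-reject φ (map f L) (ψa≢n ∘ trans (sym (e a)))) (trans (count-map φ ψ f e L n) (sym (count-reject ψ L ψa≢n)))

  count-witness : (φ : A → ℕ) → ∀ L n → ∃ (λ a → φ a ≡ n) ⊎ count φ L n ≡ 0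
  count-witness φ []      n = inj₂ refl
  count-witness φ (a ∷ L) n with φ a ℕ.≟ n
  ... | yes e = inj₁ (a , e)
  ... | no ne with count-witness φ L n
  ...   | inj₁ w = inj₁ w
  ...   | inj₂ e = inj₂ (trans (count-reject φ L ne) e)

-- Counts of squares and of sums of two squares

module Squares where
  open ≡
  private module ℤ-group = GroupProperties (AbelianGroup.group ℤₚ.+-0-abelianGroup)
  open Counting
  open ℤ-Solver.+-*-Solver

  sq : ℤ → ℕ
  sq x = ∣ x ∣ ℕ.* ∣ x ∣

  +sq : ∀ x → + sq x ≡ x ℤ.* x
  +sq (+ n)    = ℤₚ.pos-* n n
  +sq -[1+ n ] = refl

  ∣x∣≤sq : ∀ x → ∣ x ∣ ≤ sq x
  ∣x∣≤sq x = n≤n*n ∣ x ∣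
    where
    n≤n*n : ∀ n → n ≤ n ℕ.* n
    n≤n*n zero    = z≤n
    n≤n*n (suc n) = ℕₚ.m≤m+n (suc n) (n ℕ.* suc n)

  -- The integers from -N to N; `-[1+_]` starts at -1, hence one entry fewer on the negative side.
  integers : ℕ → List ℤ
  integers N = map +_ (upTo (suc N)) ++ map -[1+_] (upTo N)

  ∈-integers : ∀ {N} x → ∣ x ∣ ≤ N → x ∈ integers N
  ∈-integers (+ n)    n≤N = ∈-++⁺ˡ (∈-map⁺ +_ (∈-upTo⁺ (s≤s n≤N)))
  ∈-integers -[1+ n ] n<N = ∈-++⁺ʳ (map +_ _) (∈-map⁺ -[1+_] (∈-upTo⁺ n<N))

  integers-unique : ∀ N → Unique (integers N)
  integers-unique N = Uniqueₚ.++⁺ (Uniqueₚ.map⁺ ℤₚ.+-injective (Uniqueₚ.upTo⁺ (suc N)))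
    (Uniqueₚ.map⁺ ℤₚ.-[1+-injective (Uniqueₚ.upTo⁺ N))
    λ { (a∈ , b∈) → disjoint (∈-map⁻ +_ a∈) (∈-map⁻ -[1+_] b∈) }
    where
    disjoint : ∀ {x : ℤ} {P Q : ℕ → Set} → ∃ (λ n → P n × x ≡ + n) → ¬ ∃ (λ n → Q n × x ≡ -[1+ n ])
    disjoint (_ , _ , refl) (_ , _ , ())

  double double+1 : ℤ → ℤ
  double x   = x ℤ.+ x
  double+1 x = x ℤ.+ x ℤ.+ + 1

  data Parity (x : ℤ) : Set where
    even : ∀ u → x ≡ double u → Parity x
    odd  : ∀ u → x ≡ double+1 u → Parity x

  parityℤ : ∀ x → Parity x
  parityℤ (+ n) with parity n
  ... | k , inj₁ e = even (+ k) (cong +_ e)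
  ... | k , inj₂ e = odd (+ k) (cong +_ (trans e (ℕₚ.+-comm 1 (k ℕ.+ k))))
  parityℤ -[1+ n ] with parity n
  ... | k , inj₁ e = odd -[1+ k ] (cong -[1+_] e)
  ... | k , inj₂ e = even -[1+ k ] (cong -[1+_] e)

  double-injective : ∀ {x y} → double x ≡ double y → x ≡ y
  double-injective {x} {y} e = ℤₚ.*-cancelˡ-≡ (+ 2) x y
    (trans (solve 1 (λ x → con (+ 2) :* x := x :+ x) refl x) (trans e (solve 1 (λ x → x :+ x := con (+ 2) :* x) refl y)))

  double+1-injective : ∀ {x y} → double+1 x ≡ double+1 y → x ≡ y
  double+1-injective {x} {y} e = double-injective (ℤ-group.∙-cancelʳ (+ 1) (double x) (double y) e)

  double≢double+1 : ∀ {x y} → double x ≢ double+1 y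
  double≢double+1 {x} {y} e = odd-one (x ℤ.- y)
    (trans (solve 2 (λ x y → (x :- y) :+ (x :- y) := (x :+ x) :- (y :+ y)) refl x y)
      (trans (cong (ℤ._- double y) e) (solve 1 (λ y → y :+ con (+ 1) :- y := con (+ 1)) refl (double y))))
    where
    odd-one : ∀ z → double z ≢ + 1
    odd-one (+ suc n) e with () ← trans (sym (ℕₚ.+-suc n n)) (ℕₚ.suc-injective (ℤₚ.+-injective e))

  ∣x∣≤∣double+1∣ : ∀ x → ∣ x ∣ ≤ ∣ double+1 x ∣
  ∣x∣≤∣double+1∣ (+ n)    = ℕₚ.≤-trans (ℕₚ.m≤m+n n n) (ℕₚ.m≤m+n (n ℕ.+ n) 1)
  ∣x∣≤∣double+1∣ -[1+ n ] = s≤s (ℕₚ.m≤m+n n n)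

  sq-double : ∀ x → sq (double x) ≡ 2 ℕ.* (2 ℕ.* sq x)
  sq-double x = ℤₚ.+-injective (begin
    + sq (double x)               ≡⟨ +sq (double x) ⟩
    double x ℤ.* double x         ≡⟨ solve 1 (λ x → (x :+ x) :* (x :+ x) := con (+ 2) :* (con (+ 2) :* (x :* x))) refl x ⟩
    + 2 ℤ.* (+ 2 ℤ.* (x ℤ.* x))   ≡⟨ cong (λ z → + 2 ℤ.* (+ 2 ℤ.* z)) (+sq x) ⟨
    + 2 ℤ.* (+ 2 ℤ.* + sq x)      ≡⟨ cong (+ 2 ℤ.*_) (ℤₚ.pos-* 2 (sq x)) ⟨
    + 2 ℤ.* + (2 ℕ.* sq x)        ≡⟨ ℤₚ.pos-* 2 (2 ℕ.* sq x) ⟨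
    + (2 ℕ.* (2 ℕ.* sq x))        ∎)
    where open ≡-Reasoning

  -- The exponents occurring in θ(q²)².
  twice : ℤ × ℤ → ℕ
  twice (u , v) = 2 ℕ.* sq u ℕ.+ 2 ℕ.* sq v

  +twice : ∀ u v → + twice (u , v) ≡ + 2 ℤ.* (u ℤ.* u) ℤ.+ + 2 ℤ.* (v ℤ.* v)
  +twice u v = trans (ℤₚ.pos-+ (2 ℕ.* sq u) (2 ℕ.* sq v))
    (cong₂ ℤ._+_ (trans (ℤₚ.pos-* 2 (sq u)) (cong (+ 2 ℤ.*_) (+sq u))) (trans (ℤₚ.pos-* 2 (sq v)) (cong (+ 2 ℤ.*_) (+sq v))))

  -- 2u² + 2v² = (u + v)² + (u − v)², and u + v, u − v have equal parity: they are 2s, 2t or 2s + 1, 2t + 1.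
  rotate₀ rotate₁ : ℤ × ℤ → ℤ × ℤ
  rotate₀ (s , t) = s ℤ.+ t , s ℤ.- t
  rotate₁ (s , t) = s ℤ.+ t ℤ.+ + 1 , s ℤ.- t

  -- The exponents occurring in e² and d², for e and d the even and odd parts of θ(q); the factor 4
  -- is nested as two applications of q ↦ q² produce it.
  evenPairs oddPairs : ℤ × ℤ → ℕ
  evenPairs (s , t) = 2 ℕ.* (2 ℕ.* sq s) ℕ.+ 2 ℕ.* (2 ℕ.* sq t)
  oddPairs  (s , t) = sq (double+1 s) ℕ.+ sq (double+1 t)

  twice-rotate₀ : ∀ st → twice (rotate₀ st) ≡ evenPairs st
  twice-rotate₀ (s , t) = ℤₚ.+-injective (trans (+twice (s ℤ.+ t) (s ℤ.- t))
    (trans (solve 2 (λ s t → con (+ 2) :* ((s :+ t) :* (s :+ t)) :+ con (+ 2) :* ((s :- t) :* (s :- t)) := (s :+ s) :* (s :+ s) :+ (t :+ t) :* (t :+ t)) refl s t)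
      (trans (cong₂ ℤ._+_ (sym (+sq (double s))) (sym (+sq (double t))))
        (trans (sym (ℤₚ.pos-+ (sq (double s)) (sq (double t)))) (cong +_ (cong₂ ℕ._+_ (sq-double s) (sq-double t)))))))

  twice-rotate₁ : ∀ st → twice (rotate₁ st) ≡ oddPairs st
  twice-rotate₁ (s , t) = ℤₚ.+-injective (trans (+twice (s ℤ.+ t ℤ.+ + 1) (s ℤ.- t))
    (trans (solve 2 (λ s t → con (+ 2) :* ((s :+ t :+ con (+ 1)) :* (s :+ t :+ con (+ 1))) :+ con (+ 2) :* ((s :- t) :* (s :- t))
              := (s :+ s :+ con (+ 1)) :* (s :+ s :+ con (+ 1)) :+ (t :+ t :+ con (+ 1)) :* (t :+ t :+ con (+ 1))) refl s t)
      (trans (cong₂ ℤ._+_ (sym (+sq (double+1 s))) (sym (+sq (double+1 t))))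
        (sym (ℤₚ.pos-+ (sq (double+1 s)) (sq (double+1 t)))))))

  rotate-sum : ∀ s t → (s ℤ.+ t) ℤ.+ (s ℤ.- t) ≡ double s
  rotate-sum = solve 2 (λ s t → (s :+ t) :+ (s :- t) := s :+ s) refl

  rotate₁-sum : ∀ s t → (s ℤ.+ t ℤ.+ + 1) ℤ.+ (s ℤ.- t) ≡ double+1 s
  rotate₁-sum = solve 2 (λ s t → (s :+ t :+ con (+ 1)) :+ (s :- t) := s :+ s :+ con (+ 1)) refl

  rotate₀-injective : ∀ {a b} → rotate₀ a ≡ rotate₀ b → a ≡ b
  rotate₀-injective {s , t} {s′ , t′} e = cong₂ _,_ s≡ (ℤ-group.∙-cancelˡ s′ t t′ (trans (cong (ℤ._+ t) (sym s≡)) (cong proj₁ e)))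
    where
    s≡ : s ≡ s′
    s≡ = double-injective (trans (sym (rotate-sum s t)) (trans (cong (λ z → proj₁ z ℤ.+ proj₂ z) e) (rotate-sum s′ t′)))

  rotate₁-injective : ∀ {a b} → rotate₁ a ≡ rotate₁ b → a ≡ b
  rotate₁-injective {s , t} {s′ , t′} e = rotate₀-injective
    (cong₂ _,_ (ℤ-group.∙-cancelʳ (+ 1) (s ℤ.+ t) (s′ ℤ.+ t′) (cong proj₁ e)) (cong proj₂ e))

  rotate₀≢rotate₁ : ∀ {a b} → rotate₀ a ≢ rotate₁ b
  rotate₀≢rotate₁ {s , t} {s′ , t′} e = double≢double+1 {s} {s′}
    (trans (sym (rotate-sum s t)) (trans (cong (λ z → proj₁ z ℤ.+ proj₂ z) e) (rotate₁-sum s′ t′)))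

  box : ℕ → List (ℤ × ℤ)
  box N = cartesianProduct (integers N) (integers N)

  box-unique : ∀ N → Unique (box N)
  box-unique N = Uniqueₚ.cartesianProduct⁺ (integers-unique N) (integers-unique N)

  bounded : ∀ {n} k u v → k ℕ.* sq u ℕ.+ k ℕ.* sq v ≡ n → .{{ℕ.NonZero k}} → (u , v) ∈ box n
  bounded k u v refl = ∈-cartesianProduct⁺ (∈-integers u (ℕₚ.≤-trans (∣x∣≤sq u) (ℕₚ.≤-trans (ℕₚ.m≤n*m (sq u) k) (ℕₚ.m≤m+n (k ℕ.* sq u) (k ℕ.* sq v)))))
                                            (∈-integers v (ℕₚ.≤-trans (∣x∣≤sq v) (ℕₚ.≤-trans (ℕₚ.m≤n*m (sq v) k) (ℕₚ.m≤n+m (k ℕ.* sq v) (k ℕ.* sq u)))))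

  -- Coefficient form of θ(q²)² = e² + d²: the two rotations are injective and their disjoint images
  -- together fill ℤ².
  count-twice : ∀ n → count twice (box n) n ≡ count evenPairs (box n) n ℕ.+ count oddPairs (box n) n
  count-twice n = begin
    count twice (box n) n
      ≡⟨ count-complete twice n (box-unique n) unique (λ { (u , v) e → bounded 2 u v e }) complete ⟩
    count twice (map rotate₀ (box n) ++ map rotate₁ (box n)) n
      ≡⟨ count-++ twice (map rotate₀ (box n)) (map rotate₁ (box n)) n ⟩
    count twice (map rotate₀ (box n)) n ℕ.+ count twice (map rotate₁ (box n)) n
      ≡⟨ cong₂ ℕ._+_ (count-map twice evenPairs rotate₀ twice-rotate₀ (box n) n) (count-map twice oddPairs rotate₁ twice-rotate₁ (box n) n) ⟩
    count evenPairs (box n) n ℕ.+ count oddPairs (box n) n ∎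
    where
    open ≡-Reasoning
    unique : Unique (map rotate₀ (box n) ++ map rotate₁ (box n))
    unique = Uniqueₚ.++⁺ (Uniqueₚ.map⁺ (λ {a} {b} → rotate₀-injective {a} {b}) (box-unique n)) (Uniqueₚ.map⁺ (λ {a} {b} → rotate₁-injective {a} {b}) (box-unique n))
      λ { (a∈ , b∈) → disjoint (∈-map⁻ rotate₀ {xs = box n} a∈) (∈-map⁻ rotate₁ {xs = box n} b∈) }
      where
      disjoint : ∀ {x} {P Q : ℤ × ℤ → Set} → ∃ (λ a → P a × x ≡ rotate₀ a) → ¬ ∃ (λ b → Q b × x ≡ rotate₁ b)
      disjoint (a , _ , e) (b , _ , e′) = rotate₀≢rotate₁ {a} {b} (trans (sym e) e′)
    complete : Complete twice n (map rotate₀ (box n) ++ map rotate₁ (box n))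
    -- The parity of u - v selects the rotation. Its preimage is (v + t, t), where u - v is 2t or 2t
    -- + 1.
    complete (u , v) e with parityℤ (u ℤ.- v)
    ... | even t eq = ∈-++⁺ˡ (subst (_∈ map rotate₀ (box n)) st≡ (∈-map⁺ rotate₀ (bounded′ (v ℤ.+ t) t st≡)))
      where
      st≡ : rotate₀ (v ℤ.+ t , t) ≡ (u , v)
      st≡ = cong₂ _,_ (trans (solve 2 (λ v t → v :+ t :+ t := v :+ (t :+ t)) refl v t) (trans (cong (λ z → v ℤ.+ z) (sym eq)) (solve 2 (λ u v → v :+ (u :- v) := u) refl u v)))
                      (solve 2 (λ v t → v :+ t :- t := v) refl v t)
      bounded′ : ∀ s t → rotate₀ (s , t) ≡ (u , v) → (s , t) ∈ box n
      bounded′ s t e′ = bounded 4 s t (trans (cong₂ ℕ._+_ (ℕₚ.*-assoc 2 2 (sq s)) (ℕₚ.*-assoc 2 2 (sq t)))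
        (trans (sym (twice-rotate₀ (s , t))) (trans (cong twice e′) e)))
    ... | odd t eq = ∈-++⁺ʳ (map rotate₀ (box n)) (subst (_∈ map rotate₁ (box n)) st≡ (∈-map⁺ rotate₁ (bounded′ (v ℤ.+ t) t st≡)))
      where
      st≡ : rotate₁ (v ℤ.+ t , t) ≡ (u , v)
      st≡ = cong₂ _,_ (trans (solve 2 (λ v t → v :+ t :+ t :+ con (+ 1) := v :+ (t :+ t :+ con (+ 1))) refl v t) (trans (cong (λ z → v ℤ.+ z) (sym eq)) (solve 2 (λ u v → v :+ (u :- v) := u) refl u v)))
                      (solve 2 (λ v t → v :+ t :- t := v) refl v t)
      bounded′ : ∀ s t → rotate₁ (s , t) ≡ (u , v) → (s , t) ∈ box n
      bounded′ s t e′ = ∈-cartesianProduct⁺ (∈-integers s (ℕₚ.≤-trans (b s) (ℕₚ.≤-trans (ℕₚ.m≤m+n _ _) (ℕₚ.≤-reflexive e″))))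
                                            (∈-integers t (ℕₚ.≤-trans (b t) (ℕₚ.≤-trans (ℕₚ.m≤n+m _ _) (ℕₚ.≤-reflexive e″))))
        where
        e″ : oddPairs (s , t) ≡ n
        e″ = trans (sym (twice-rotate₁ (s , t))) (trans (cong twice e′) e)
        b : ∀ x → ∣ x ∣ ≤ sq (double+1 x)
        b x = ℕₚ.≤-trans (∣x∣≤∣double+1∣ x) (∣x∣≤sq (double+1 x))

  -- Splitting x into 2u and 2u + 1 exhibits θ(q⁴) as the even part of θ(q).
  count-sq : ∀ {n N} → n ≤ N → count sq (integers N) n ≡ count (λ u → 2 ℕ.* (2 ℕ.* sq u)) (integers N) n ℕ.+ count (sq ∘ double+1) (integers N) n
  count-sq {n} {N} n≤N = begin
    count sq (integers N) n
      ≡⟨ count-complete sq n (integers-unique N) unique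
           (λ { u refl → ∈-integers u (ℕₚ.≤-trans (∣x∣≤sq u) n≤N) }) complete ⟩
    count sq (map double (integers N) ++ map double+1 (integers N)) n
      ≡⟨ count-++ sq (map double (integers N)) (map double+1 (integers N)) n ⟩
    count sq (map double (integers N)) n ℕ.+ count sq (map double+1 (integers N)) n
      ≡⟨ cong₂ ℕ._+_ (count-map sq _ double sq-double (integers N) n) (count-map sq _ double+1 (λ _ → refl) (integers N) n) ⟩
    count (λ u → 2 ℕ.* (2 ℕ.* sq u)) (integers N) n ℕ.+ count (sq ∘ double+1) (integers N) n ∎
    where
    open ≡-Reasoning
    unique : Unique (map double (integers N) ++ map double+1 (integers N))
    unique = Uniqueₚ.++⁺ (Uniqueₚ.map⁺ (λ {x} {y} → double-injective {x} {y}) (integers-unique N)) (Uniqueₚ.map⁺ (λ {x} {y} → double+1-injective {x} {y}) (integers-unique N))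
      λ { (a∈ , b∈) → disjoint (∈-map⁻ double {xs = integers N} a∈) (∈-map⁻ double+1 {xs = integers N} b∈) }
      where
      disjoint : ∀ {x} {P Q : ℤ → Set} → ∃ (λ a → P a × x ≡ double a) → ¬ ∃ (λ b → Q b × x ≡ double+1 b)
      disjoint (a , _ , e) (b , _ , e′) = double≢double+1 {a} {b} (trans (sym e) e′)
    complete : Complete sq n (map double (integers N) ++ map double+1 (integers N))
    complete x refl with parityℤ x
    ... | even u refl = ∈-++⁺ˡ (∈-map⁺ double (∈-integers u (ℕₚ.≤-trans (∣x∣≤sq u)
            (ℕₚ.≤-trans (ℕₚ.≤-trans (ℕₚ.m≤n*m (sq u) 2) (ℕₚ.m≤n*m (2 ℕ.* sq u) 2)) (ℕₚ.≤-trans (ℕₚ.≤-reflexive (sym (sq-double u))) n≤N)))))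
    ... | odd u refl  = ∈-++⁺ʳ (map double (integers N)) (∈-map⁺ double+1 (∈-integers u (ℕₚ.≤-trans (∣x∣≤∣double+1∣ u) (ℕₚ.≤-trans (∣x∣≤sq (double+1 u)) n≤N))))

  count-sq-stable : ∀ {n N} → n ≤ N → count sq (integers n) n ≡ count sq (integers N) n
  count-sq-stable {n} {N} n≤N = count-complete sq n (integers-unique n) (integers-unique N)
    (λ { u refl → ∈-integers u (∣x∣≤sq u) }) (λ { u refl → ∈-integers u (ℕₚ.≤-trans (∣x∣≤sq u) n≤N) })

  count-sq-square : ∀ k → count sq (integers (suc k ℕ.* suc k)) (suc k ℕ.* suc k) ≡ 2
  count-sq-square k = begin
    count sq (integers n) n
      ≡⟨ count-complete sq n (integers-unique n) unique (λ u e → ∈-integers u (ℕₚ.≤-trans (∣x∣≤sq u) (ℕₚ.≤-reflexive e))) complete ⟩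
    count sq (+ suc k ∷ -[1+ k ] ∷ []) n   ≡⟨ count-accept sq {+ suc k} {n} (-[1+ k ] ∷ []) refl ⟩
    suc (count sq (-[1+ k ] ∷ []) n)       ≡⟨ cong suc (count-accept sq { -[1+ k ]} {n} [] refl) ⟩
    2                                      ∎
    where
    open ≡-Reasoning
    n : ℕ
    n = suc k ℕ.* suc k
    unique : Unique (+ suc k ∷ -[1+ k ] ∷ [])
    unique = ((λ ()) All.∷ All.[]) AllPairs.∷ All.[] AllPairs.∷ AllPairs.[]
    root : ∀ a b → a ℕ.* a ≡ b ℕ.* b → a ≡ b
    root a b e with ℕₚ.<-cmp a b
    ... | tri< a<b _ _ = contradiction e (ℕₚ.<⇒≢ (ℕₚ.*-mono-< a<b a<b))
    ... | tri≈ _ a≡b _ = a≡b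
    ... | tri> _ _ b<a = contradiction (sym e) (ℕₚ.<⇒≢ (ℕₚ.*-mono-< b<a b<a))
    complete : Complete sq n (+ suc k ∷ -[1+ k ] ∷ [])
    complete (+ j)    e = here (cong +_ (root j (suc k) e))
    complete -[1+ j ] e = there (here (cong -[1+_] (ℕₚ.suc-injective (root (suc j) (suc k) e))))

-- The theta series and its arithmetic-geometric mean relation

module Theta {c ℓ : Level} (R : CommutativeRing c ℓ) where
  open Counting
  open Squares
  open RingTools R
  open PowerSeries R
  open Dilation R
  private
    module S = RingTools series
    variable
      A B : Set

  -- The generating polynomial Σ X^(φ a) over the list, in terms of its coefficients.
  mono : (A → ℕ) → List A → Series
  mono φ L n = ι (count φ L n)

  mono-[] : (φ : A → ℕ) → mono φ [] ≋ 𝟘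
  mono-[] φ = coefficients λ n → refl

  mono-∷ : (φ : A → ℕ) → ∀ a L → mono φ (a ∷ L) ≋ X S.^ φ a ⊕ mono φ L
  mono-∷ φ a L = coefficients go
    where
    go : ∀ n → mono φ (a ∷ L) n ≈ (X S.^ φ a ⊕ mono φ L) n
    go n with φ a ℕ.≟ n
    ... | yes ≡.refl = trans (ι-cong (count-accept φ {a} {φ a} L ≡.refl)) (trans (ι-suc (count φ L (φ a))) (+-congʳ (sym (X^-at (φ a)))))
    ... | no φa≢n = trans (ι-cong (count-reject φ {a} {n} L φa≢n))
      (sym (trans (+-congʳ (X^-at-≢ (φ a) n (λ e → φa≢n (≡.sym e)))) (+-identityˡ _)))

  mono-++ : (φ : A → ℕ) → ∀ L L′ → mono φ (L ++ L′) ≋ mono φ L ⊕ mono φ L′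
  mono-++ φ L L′ = coefficients λ n → trans (ι-cong (count-++ φ L L′ n)) (ι-+ (count φ L n) (count φ L′ n))

  X^-⊛-mono : ∀ k (φ : A → ℕ) L → X S.^ k ⊛ mono φ L ≋ mono (λ a → k ℕ.+ φ a) L
  X^-⊛-mono k φ []      = S.trans (S.*-congˡ (mono-[] φ)) (S.trans (S.zeroʳ _) (S.sym (mono-[] (λ a → k ℕ.+ φ a))))
  X^-⊛-mono k φ (a ∷ L) = S.trans (S.*-congˡ (mono-∷ φ a L)) (S.trans (S.distribˡ _ _ _)
    (S.trans (S.+-cong (S.sym (S.^-homo-* X k (φ a))) (X^-⊛-mono k φ L)) (S.sym (mono-∷ (λ a → k ℕ.+ φ a) a L))))

  mono-⊛ : (φ : A → ℕ) (ψ : B → ℕ) → ∀ L M →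
           mono φ L ⊛ mono ψ M ≋ mono (λ ab → φ (proj₁ ab) ℕ.+ ψ (proj₂ ab)) (cartesianProduct L M)
  mono-⊛ φ ψ []      M = S.trans (S.*-congʳ (mono-[] φ)) (S.trans (S.zeroˡ _) (S.sym (mono-[] (λ ab → φ (proj₁ ab) ℕ.+ ψ (proj₂ ab)))))
  mono-⊛ φ ψ (a ∷ L) M = S.begin
    mono φ (a ∷ L) ⊛ mono ψ M
      S.≈⟨ S.trans (S.*-congʳ (mono-∷ φ a L)) (S.distribʳ _ _ _) ⟩
    X S.^ φ a ⊛ mono ψ M ⊕ mono φ L ⊛ mono ψ M
      S.≈⟨ S.+-cong (S.trans (X^-⊛-mono (φ a) ψ M) (coefficients λ n → ι-cong (≡.sym (count-map φψ _ (a ,_) (λ _ → ≡.refl) M n)))) (mono-⊛ φ ψ L M) ⟩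
    mono φψ (map (a ,_) M) ⊕ mono φψ (cartesianProduct L M)
      S.≈⟨ mono-++ φψ (map (a ,_) M) (cartesianProduct L M) ⟨
    mono φψ (cartesianProduct (a ∷ L) M) S.∎
    where
    φψ : _ → ℕ
    φψ ab = φ (proj₁ ab) ℕ.+ ψ (proj₂ ab)

  σ-X^ : ∀ k → σ (X S.^ k) ≋ X S.^ (2 ℕ.* k)
  σ-X^ k = S.trans (σ-^ X k) (S.trans (S.^-congˡ k σ-X) (S.square-^ X k))
    where
    σ-X : σ X ≋ X ⊛ X
    σ-X = coefficients λ
      { zero                → sym (X-⊛-zero X)
      ; (suc zero)          → sym (X-⊛-suc X 0)
      ; (suc (suc zero))    → sym (X-⊛-suc X 1)
      ; (suc (suc (suc n))) → trans (tail-X (suc n)) (sym (X-⊛-suc X (suc (suc n)))) }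
      where
      tail-X : ∀ n → σ (tail X) n ≈ 𝟙 n
      tail-X n = trans (at (σ-cong (coefficients λ { zero → refl ; (suc k) → refl })) n) (at σ-𝟙 n)

  σ-mono : (φ : A → ℕ) → ∀ L → σ (mono φ L) ≋ mono (λ a → 2 ℕ.* φ a) L
  σ-mono φ []      = S.trans (σ-cong (mono-[] φ)) (S.trans σ-𝟘 (S.sym (mono-[] (λ a → 2 ℕ.* φ a))))
  σ-mono φ (a ∷ L) = S.trans (σ-cong (mono-∷ φ a L)) (S.trans (σ-⊕ _ _)
    (S.trans (S.+-cong (σ-X^ (φ a)) (σ-mono φ L)) (S.sym (mono-∷ (λ a → 2 ℕ.* φ a) a L))))

  infix 4 _≈[_]_
  -- Agreement up to degree N suffices for the coefficients of a product up to N, so θ may be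
  -- replaced there by the polynomial of a finite box.
  _≈[_]_ : Series → ℕ → Series → Set ℓ
  f ≈[ N ] g = ∀ n → n ≤ N → f n ≈ g n

  ⊛-cong-≤ : ∀ {f f′ g g′ N} → f ≈[ N ] f′ → g ≈[ N ] g′ → f ⊛ g ≈[ N ] f′ ⊛ g′
  ⊛-cong-≤ e e′ zero    _   = *-cong (e 0 z≤n) (e′ 0 z≤n)
  ⊛-cong-≤ {N = suc N} e e′ (suc n) (s≤s n≤N) =
    +-cong (*-cong (e 0 z≤n) (e′ (suc n) (s≤s n≤N)))
           (⊛-cong-≤ (λ k k≤N → e (suc k) (s≤s k≤N)) (λ k k≤N → e′ k (ℕₚ.m≤n⇒m≤1+n k≤N)) n n≤N)

  σ-cong-≤ : ∀ {f f′ N} → f ≈[ N ] f′ → σ f ≈[ N ] σ f′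
  σ-cong-≤ e zero          _               = e 0 z≤n
  σ-cong-≤ e (suc zero)    _               = refl
  σ-cong-≤ {N = suc (suc N)} e (suc (suc n)) (s≤s (s≤s n≤N)) =
    σ-cong-≤ {N = N} (λ k k≤N → e (suc k) (s≤s (ℕₚ.m≤n⇒m≤1+n k≤N))) n n≤N

  -- Every root of x² = n satisfies |x| ≤ n, so a box that grows with the exponent misses nothing.
  θ : Series
  θ n = ι (count sq (integers n) n)

  θ-mono : ∀ N → θ ≈[ N ] mono sq (integers N)
  θ-mono N n n≤N = ι-cong (count-sq-stable n≤N)

  -- The even x contribute θ(q⁴), so the difference is the sum over odd x, as `θ-odd-mono` confirms.
  θ-odd : Series
  θ-odd = θ ⊕ ⊖ σ (σ θ)

  σσθ-mono : ∀ N → σ (σ θ) ≈[ N ] mono (λ u → 2 ℕ.* (2 ℕ.* sq u)) (integers N)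
  σσθ-mono N n n≤N = trans (σ-cong-≤ (σ-cong-≤ (θ-mono N)) n n≤N)
    (at (S.trans (σ-cong (σ-mono sq (integers N))) (σ-mono (λ u → 2 ℕ.* sq u) (integers N))) n)

  θ-odd-mono : ∀ N → θ-odd ≈[ N ] mono (sq ∘ double+1) (integers N)
  θ-odd-mono N n n≤N = begin
    θ n + - σ (σ θ) n
      ≈⟨ +-cong (trans (θ-mono N n n≤N) (trans (ι-cong (count-sq n≤N)) (ι-+ E O))) (-‿cong (σσθ-mono N n n≤N)) ⟩
    ι E + ι O + - ι E
      ≈⟨ solve 2 (λ x y → x :+ y :- x := y) refl (ι E) (ι O) ⟩
    ι O ∎
    where
    E O : ℕ
    E = count (λ u → 2 ℕ.* (2 ℕ.* sq u)) (integers N) n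
    O = count (sq ∘ double+1) (integers N) n

  σθ² : σ θ ⊛ σ θ ≋ σ (σ θ) ⊛ σ (σ θ) ⊕ θ-odd ⊛ θ-odd
  σθ² = coefficients λ n → begin
    (σ θ ⊛ σ θ) n
      ≈⟨ ⊛-cong-≤ (σθ-mono n) (σθ-mono n) n ℕₚ.≤-refl ⟩
    (mono (λ u → 2 ℕ.* sq u) (integers n) ⊛ mono (λ u → 2 ℕ.* sq u) (integers n)) n
      ≈⟨ at (mono-⊛ (λ u → 2 ℕ.* sq u) (λ u → 2 ℕ.* sq u) (integers n) (integers n)) n ⟩
    ι (count twice (box n) n)
      ≈⟨ trans (ι-cong (count-twice n)) (ι-+ (count evenPairs (box n) n) (count oddPairs (box n) n)) ⟩
    ι (count evenPairs (box n) n) + ι (count oddPairs (box n) n)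
      ≈⟨ +-cong (at (mono-⊛ (λ u → 2 ℕ.* (2 ℕ.* sq u)) (λ u → 2 ℕ.* (2 ℕ.* sq u)) (integers n) (integers n)) n)
                (at (mono-⊛ (sq ∘ double+1) (sq ∘ double+1) (integers n) (integers n)) n) ⟨
    (mono (λ u → 2 ℕ.* (2 ℕ.* sq u)) (integers n) ⊛ mono (λ u → 2 ℕ.* (2 ℕ.* sq u)) (integers n)) n
      + (mono (sq ∘ double+1) (integers n) ⊛ mono (sq ∘ double+1) (integers n)) n
      ≈⟨ +-cong (⊛-cong-≤ (σσθ-mono n) (σσθ-mono n) n ℕₚ.≤-refl) (⊛-cong-≤ (θ-odd-mono n) (θ-odd-mono n) n ℕₚ.≤-refl) ⟨
    (σ (σ θ) ⊛ σ (σ θ) ⊕ θ-odd ⊛ θ-odd) n ∎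
    where
    σθ-mono : ∀ N → σ θ ≈[ N ] mono (λ u → 2 ℕ.* sq u) (integers N)
    σθ-mono N n n≤N = trans (σ-cong-≤ (θ-mono N) n n≤N) (at (σ-mono sq (integers N)) n)

  -- One step of Gauss's arithmetic-geometric mean. With b = σ a, c = σ b and a′ = 2b - a, which is
  -- θ(-q)², the relation says a a′ = (2c - b)². In terms of e and d, both sides are 4e²d².
  θ²-agm : let a = θ ⊛ θ in (a ⊕ ⊖ σ a) ⊛ (a ⊕ ⊖ σ a) ≋ S.ι 4 ⊛ (σ (σ a) ⊛ (σ a ⊕ ⊖ σ (σ a)))
  θ²-agm = S.begin
    (θ ⊛ θ ⊕ ⊖ σ (θ ⊛ θ)) ⊛ (θ ⊛ θ ⊕ ⊖ σ (θ ⊛ θ))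
      S.≈⟨ S.*-cong left left ⟩
    (S.ι 2 ⊛ (e ⊛ d)) ⊛ (S.ι 2 ⊛ (e ⊛ d))
      S.≈⟨ S.solve 2 (λ e d → (S.con (+ 2) S.:* (e S.:* d)) S.:* (S.con (+ 2) S.:* (e S.:* d)) S.:= S.con (+ 4) S.:* ((e S.:* e) S.:* ((e S.:* e S.:+ d S.:* d) S.:- e S.:* e))) S.refl e d ⟩
    S.ι 4 ⊛ ((e ⊛ e) ⊛ ((e ⊛ e ⊕ d ⊛ d) ⊕ ⊖ (e ⊛ e)))
      S.≈⟨ S.*-congˡ (S.*-cong (S.sym σσa) (S.+-cong (S.sym σa) (S.-‿cong (S.sym σσa)))) ⟩
    S.ι 4 ⊛ (σ (σ (θ ⊛ θ)) ⊛ (σ (θ ⊛ θ) ⊕ ⊖ σ (σ (θ ⊛ θ)))) S.∎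
    where
    e d : Series
    e = σ (σ θ)
    d = θ-odd
    σa : σ (θ ⊛ θ) ≋ e ⊛ e ⊕ d ⊛ d
    σa = S.trans (σ-⊛ θ θ) σθ²
    σσa : σ (σ (θ ⊛ θ)) ≋ e ⊛ e
    σσa = S.trans (σ-cong (σ-⊛ θ θ)) (σ-⊛ (σ θ) (σ θ))
    left : θ ⊛ θ ⊕ ⊖ σ (θ ⊛ θ) ≋ S.ι 2 ⊛ (e ⊛ d)
    left = S.trans (S.+-congˡ (S.-‿cong σa))
      (S.solve 2 (λ t e → t S.:* t S.:- (e S.:* e S.:+ (t S.:- e) S.:* (t S.:- e)) S.:= S.con (+ 2) S.:* (e S.:* (t S.:- e))) S.refl θ e)

  θ-square : ∀ k → θ (suc k ℕ.* suc k) ≈ ι 2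
  θ-square k = ι-cong (count-sq-square k)

  θ-support : ∀ n → ∃ (λ x → n ≡ x ℕ.* x) ⊎ θ n ≈ 0#
  θ-support n with count-witness sq (integers n) n
  ... | inj₁ (x , e) = inj₁ (∣ x ∣ , ≡.sym e)
  ... | inj₂ e       = inj₂ (ι-cong e)

  σθ-support : ∀ n → ∃ (λ y → n ≡ 2 ℕ.* (y ℕ.* y)) ⊎ σ θ n ≈ 0#
  σθ-support n with parity n
  ... | k , inj₂ ≡.refl = inj₂ (σ-odd θ k)
  ... | k , inj₁ ≡.refl with θ-support k
  ...   | inj₁ (y , ≡.refl) = inj₁ (y , ≡.cong (k ℕ.+_) (≡.sym (ℕₚ.+-identityʳ k)))
  ...   | inj₂ e            = inj₂ (trans (σ-even θ k) e)

-- The sum as a coefficient of the theta Wronskian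

module DombTheta {c ℓ : Level} (R : CommutativeRing c ℓ) (m : ℕ) (χ : HasCharacteristic R (suc (2 ℕ.* m))) where
  open RingTools R
  open PowerSeries R
  open Derivation R
  open Dilation R
  open Theta R
  open DombModP R m χ
  private
    module S = RingTools series
    p : ℕ
    p = suc (2 ℕ.* m)

  -- θ and σ θ share the constant term 1, so θ = Xε + σ θ. The constant term of ε is 2, from x = 1
  -- and x = -1, since σ θ has no term in q.
  wronskian-θ : wronskian θ (σ θ) p ≈ (- 1#) ^ m * cubes * ι 2
  wronskian-θ = trans (at (wronskian-congˡ θ≋) p)
    (WronskianModP.wronskian-coefficient R m χ ε (σ θ) ε₀ refl
      (S.trans (squareSum-cong (S.+-cong (S.*-cong (S.sym θ≋) (S.sym θ≋)) (S.-‿cong (S.sym (σ-⊛ θ θ)))) (S.sym (σ-⊛ θ θ)))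
        (HasseInvariant.hasse≈1 R m χ (θ ⊛ θ) (*-identityˡ 1#) θ²-agm)))
    where
    wronskian-congˡ : ∀ {f f′ g} → f ≋ f′ → wronskian f g ≋ wronskian f′ g
    wronskian-congˡ e = S.+-cong (S.*-congˡ (D-cong e)) (S.-‿cong (S.*-congʳ e))
    ε : Series
    ε = tail (θ ⊕ ⊖ σ θ)
    ε₀ : ε 0 ≈ ι 2
    ε₀ = trans (+-congˡ ε⁻¹≈ε) (trans (+-identityʳ _) (θ-square 0))
    θ≋ : θ ≋ X ⊛ ε ⊕ σ θ
    θ≋ = coefficients λ
      { zero    → sym (trans (+-congʳ (X-⊛-zero ε)) (+-identityˡ _))
      ; (suc n) → sym (trans (+-congʳ (X-⊛-suc ε n)) (solve 2 (λ x y → x :- y :+ y := x) refl (θ (suc n)) (σ θ (suc n)))) }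
    squareSum-cong : ∀ {a a′ b b′} → a ≋ a′ → b ≋ b′ → Landen.squareSum series m a b ≋ Landen.squareSum series m a′ b′
    squareSum-cong e e′ = S.∑-cong (suc m) (λ i _ → S.*-congˡ (S.*-cong (S.^-congˡ i (S.*-cong e e)) (S.^-congˡ (m ∸ i) (S.*-cong e′ e′))))

  -- For k = x² and p - k = 2y² the weight k - (p - k) is x² - 2y².
  summand : ℕ → Carrier
  summand k = (ι k + - ι (p ∸ k)) * (θ k * σ θ (p ∸ k))

  wronskian-∑ : wronskian θ (σ θ) p ≈ ∑ (suc p) summand
  wronskian-∑ = begin
    (σ θ ⊛ D θ) p + - (θ ⊛ D (σ θ)) p
      ≈⟨ +-cong (trans (at (S.*-comm (σ θ) (D θ)) p) (⊛-∑ (D θ) (σ θ) p))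
                (trans (-‿cong (⊛-∑ θ (D (σ θ)) p)) (trans (sym (-1* _)) (∑-*ˡ (suc p) (- 1#) _))) ⟩
    ∑ (suc p) (λ k → D θ k * σ θ (p ∸ k)) + ∑ (suc p) (λ k → - 1# * (θ k * D (σ θ) (p ∸ k)))
      ≈⟨ ∑-+ (suc p) _ _ ⟨
    ∑ (suc p) (λ k → D θ k * σ θ (p ∸ k) + - 1# * (θ k * D (σ θ) (p ∸ k)))
      ≈⟨ ∑-cong (suc p) (λ k _ → solve 4 (λ i j x y → i :* x :* y :+ :- con (+ 1) :* (x :* (j :* y)) := (i :- j) :* (x :* y)) refl (ι k) (ι (p ∸ k)) (θ k) (σ θ (p ∸ k))) ⟩
    ∑ (suc p) summand ∎
    where
    -1* : ∀ x → - 1# * x ≈ - x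
    -1* = solve 1 (λ x → :- con (+ 1) :* x := :- x) refl

  summand-support : ∀ {k} → k ≤ p → ∃ (λ x → k ≡ x ℕ.* x × ∃ λ y → p ≡ x ℕ.* x ℕ.+ 2 ℕ.* (y ℕ.* y)) ⊎ summand k ≈ 0#
  summand-support {k} k≤p with θ-support k | σθ-support (p ∸ k)
  ... | inj₂ e | _ = inj₂ (trans (*-congˡ (trans (*-congʳ e) (zeroˡ _))) (zeroʳ _))
  ... | inj₁ _ | inj₂ e = inj₂ (trans (*-congˡ (trans (*-congˡ e) (zeroʳ _))) (zeroʳ _))
  ... | inj₁ (x , ≡.refl) | inj₁ (y , e) = inj₁ (x , ≡.refl , y , ≡.trans (≡.sym (ℕₚ.m+[n∸m]≡n k≤p)) (≡.cong (x ℕ.* x ℕ.+_) e))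

  module _ (p∤2 : p ∤ 2) (h : Carrier) (8h≈1 : ι 8 * h ≈ 1#) where
    private
      dombSum : Carrier
      dombSum = ∑ p (λ n → h ^ n * ι (Defs.A n))

      dombSum-∑ : ι 2 * dombSum ≈ ∑ (suc p) summand
      dombSum-∑ = trans (*-congˡ (domb-sum h 8h≈1)) (trans (*-comm _ _) (trans (sym wronskian-θ) wronskian-∑))

    domb-nonrepresented : (∀ x y → p ≢ x ℕ.* x ℕ.+ 2 ℕ.* (y ℕ.* y)) → dombSum ≈ 0#
    domb-nonrepresented none = ι-cancel p∤2 (trans dombSum-∑ (∑-zero (suc p) vanish))
      where
      vanish : ∀ k → k < suc p → summand k ≈ 0#
      vanish k (s≤s k≤p) with summand-support k≤p
      ... | inj₁ (x , _ , y , e) = contradiction e (none x y)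
      ... | inj₂ e = e

    -- Positive x and y, encoded by `suc`, make both theta coefficients equal to 2. The only nonzero
    -- summand is then 4(x² - 2y²) = 8x² - 4p, twice the claimed value modulo p.
    domb-represented : ∀ x y → p ≡ suc x ℕ.* suc x ℕ.+ 2 ℕ.* (suc y ℕ.* suc y) →
      (∀ u v → p ≡ u ℕ.* u ℕ.+ 2 ℕ.* (v ℕ.* v) → u ℕ.* u ≡ suc x ℕ.* suc x) →
      dombSum ≈ ι (4 ℕ.* (suc x ℕ.* suc x))
    domb-represented x y p≡ unique = x∙y⁻¹≈ε⇒x≈y _ _ (ι-cancel p∤2 (begin
      ι 2 * (dombSum + - ι (4 ℕ.* x²))
        ≈⟨ +-congˡ′ (trans (*-congˡ (-‿cong (ι-* 4 x²))) (solve 1 (λ a → con (+ 2) :* :- (con (+ 4) :* a) := :- (con (+ 8) :* a)) refl (ι x²))) ⟩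
      ι 2 * dombSum + - (ι 8 * ι x²)
        ≈⟨ +-congʳ (trans dombSum-∑ (∑-single (suc p) x² summand (s≤s x²≤p) off)) ⟩
      summand x² + - (ι 8 * ι x²)
        ≈⟨ +-congʳ (*-cong (+-congˡ (-‿cong (ι-cong p∸x²))) (*-cong (θ-square x) σθ-value)) ⟩
      (ι x² + - ι (2 ℕ.* y²)) * (ι 2 * ι 2) + - (ι 8 * ι x²)
        ≈⟨ solve 2 (λ a b → (a :- b) :* (con (+ 2) :* con (+ 2)) :- con (+ 8) :* a := :- con (+ 4) :* (a :+ b)) refl (ι x²) (ι (2 ℕ.* y²)) ⟩
      - ι 4 * (ι x² + ι (2 ℕ.* y²))
        ≈⟨ *-congˡ (trans (sym (ι-+ x² (2 ℕ.* y²))) (trans (ι-cong (≡.sym p≡)) ι-p)) ⟩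
      - ι 4 * 0#
        ≈⟨ zeroʳ _ ⟩
      0# ∎))
      where
      x² y² : ℕ
      x² = suc x ℕ.* suc x
      y² = suc y ℕ.* suc y
      +-congˡ′ : ∀ {a b z} → ι 2 * b ≈ z → ι 2 * (a + b) ≈ ι 2 * a + z
      +-congˡ′ e = trans (distribˡ _ _ _) (+-congˡ e)
      x²≤p : x² ≤ p
      x²≤p = ℕₚ.≤-trans (ℕₚ.m≤m+n x² (2 ℕ.* y²)) (ℕₚ.≤-reflexive (≡.sym p≡))
      p∸x² : p ∸ x² ≡ 2 ℕ.* y²
      p∸x² = ≡.trans (≡.cong (_∸ x²) p≡) (ℕₚ.m+n∸m≡n x² (2 ℕ.* y²))
      σθ-value : σ θ (p ∸ x²) ≈ ι 2
      σθ-value = trans (reflexive (≡.cong (σ θ) (≡.trans p∸x² (≡.cong (y² ℕ.+_) (ℕₚ.+-identityʳ y²))))) (trans (σ-even θ y²) (θ-square y))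
      off : ∀ k → k < suc p → k ≢ x² → summand k ≈ 0#
      off k (s≤s k≤p) k≢ with summand-support k≤p
      ... | inj₁ (u , k≡ , v , e) = contradiction (≡.trans k≡ (unique u v e)) k≢
      ... | inj₂ e = e

open import Defs
open import Data.Integer using (_+_; _*_)
open import Data.Rational using (ℚ; _/_; ↥_; ↧_; ↧ₙ_)

-- The ring of integers modulo p

module Modular (p : ℕ) where
  open ℤ-Solver.+-*-Solver

  infix 4 _≡ₚ_
  record _≡ₚ_ (x y : ℤ) : Set where
    constructor congruent
    field p∣x-y : + p ∣ℤ x ℤ.- y
  open _≡ₚ_ public

  reflexiveₚ : ∀ {x y} → x ≡ y → x ≡ₚ y
  reflexiveₚ {x} ≡.refl = congruent (ℤ∣.divides (+ 0) (ℤₚ.+-inverseʳ x))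

  congruent-via : ∀ {x y z} → + p ∣ℤ z → z ≡ x ℤ.- y → x ≡ₚ y
  congruent-via d e = congruent (≡.subst (λ z → + p ∣ℤ z) e d)

  -- Integers under a coarser equality, so that no representatives have to be chosen.
  ℤ/p : CommutativeRing 0ℓ 0ℓ
  ℤ/p = record
    { Carrier = ℤ ; _≈_ = _≡ₚ_ ; _+_ = _+_ ; _*_ = _*_ ; -_ = ℤ.-_ ; 0# = + 0 ; 1# = + 1
    ; isCommutativeRing = record
      { isRing = record
        { +-isAbelianGroup = record
          { isGroup = record
            { isMonoid = record
              { isSemigroup = record
                { isMagma = record
                  { isEquivalence = record
                    { refl  = reflexiveₚ ≡.refl
                    ; sym   = λ {x} {y} e → congruent-via (ℤ∣.∣m⇒∣-m (p∣x-y e)) (solve 2 (λ x y → :- (x :- y) := y :- x) ≡.refl x y)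
                    ; trans = λ {x} {y} {z} e e′ → congruent-via (ℤ∣.∣m∣n⇒∣m+n (p∣x-y e) (p∣x-y e′)) (solve 3 (λ x y z → x :- y :+ (y :- z) := x :- z) ≡.refl x y z) }
                  ; ∙-cong = λ {x} {y} {u} {v} e e′ → congruent-via (ℤ∣.∣m∣n⇒∣m+n (p∣x-y e) (p∣x-y e′)) (solve 4 (λ x y u v → x :- y :+ (u :- v) := x :+ u :- (y :+ v)) ≡.refl x y u v) }
                ; assoc = λ x y z → reflexiveₚ (ℤₚ.+-assoc x y z) }
              ; identity = (λ x → reflexiveₚ (ℤₚ.+-identityˡ x)) , (λ x → reflexiveₚ (ℤₚ.+-identityʳ x)) }
            ; inverse = (λ x → reflexiveₚ (ℤₚ.+-inverseˡ x)) , (λ x → reflexiveₚ (ℤₚ.+-inverseʳ x))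
            ; ⁻¹-cong = λ {x} {y} e → congruent-via (ℤ∣.∣m⇒∣-m (p∣x-y e)) (solve 2 (λ x y → :- (x :- y) := :- x :- :- y) ≡.refl x y) }
          ; comm = λ x y → reflexiveₚ (ℤₚ.+-comm x y) }
        ; *-cong = λ {x} {y} {u} {v} e e′ → congruent-via (ℤ∣.∣m∣n⇒∣m+n (ℤ∣.∣m⇒∣m*n u (p∣x-y e)) (ℤ∣.∣n⇒∣m*n y (p∣x-y e′)))
                     (solve 4 (λ x y u v → (x :- y) :* u :+ y :* (u :- v) := x :* u :- y :* v) ≡.refl x y u v)
        ; *-assoc = λ x y z → reflexiveₚ (ℤₚ.*-assoc x y z)
        ; *-identity = (λ x → reflexiveₚ (ℤₚ.*-identityˡ x)) , (λ x → reflexiveₚ (ℤₚ.*-identityʳ x))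
        ; distrib = (λ x y z → reflexiveₚ (ℤₚ.*-distribˡ-+ x y z)) , (λ x y z → reflexiveₚ (ℤₚ.*-distribʳ-+ x y z)) }
      ; *-comm = λ x y → reflexiveₚ (ℤₚ.*-comm x y) } }

  open RingTools ℤ/p using (ι)

  ι≡+ : ∀ n → ι n ≡ + n
  ι≡+ zero          = ≡.refl
  ι≡+ (suc zero)    = ≡.refl
  ι≡+ (suc (suc n)) = ≡.cong (λ z → + 1 + z) (ι≡+ (suc n))

  ≡ₚ0⇒∣ : ∀ {x} → x ≡ₚ + 0 → p ∣ ∣ x ∣
  ≡ₚ0⇒∣ {x} e = ℤ∣.∣⇒∣ᵤ (≡.subst (λ z → + p ∣ℤ z) (ℤₚ.+-identityʳ x) (p∣x-y e))

  ∣⇒≡ₚ0 : ∀ {x} → p ∣ ∣ x ∣ → x ≡ₚ + 0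
  ∣⇒≡ₚ0 {x} d = congruent-via (ℤ∣.∣ᵤ⇒∣ {+ p} {x} d) (≡.sym (ℤₚ.+-identityʳ x))

-- Reduction of rational numbers modulo a prime

module PrimeField (p : ℕ) (prime : Prime p) where
  open Modular p
  open RingTools ℤ/p using (ι; ∑; ∑-empty; ∑-suc; trans; sym; *-congʳ; -‿cong; x∙y⁻¹≈ε⇒x≈y; ^-distrib-*; ^-congˡ; 1^n≈1; ι-^)
    renaming (_^_ to _^ᶻ_)
  open ℤ-Solver.+-*-Solver

  cancelℤ : ∀ n x → p ∤ n → + n * x ≡ₚ + 0 → x ≡ₚ + 0
  cancelℤ n x p∤n e with euclidsLemma n ∣ x ∣ prime (≡.subst (p ∣_) (ℤₚ.abs-* (+ n) x) (≡ₚ0⇒∣ e))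
  ... | inj₁ p∣n = contradiction p∣n p∤n
  ... | inj₂ p∣x = ∣⇒≡ₚ0 p∣x

  characteristic : HasCharacteristic ℤ/p p
  characteristic = record
    { ι-p      = trans (reflexiveₚ (ι≡+ p)) (∣⇒≡ₚ0 ℕ∣.∣-refl)
    ; ι-cancel = λ {n} {x} p∤n e → cancelℤ n x p∤n (≡.subst (λ z → z * x ≡ₚ + 0) (ι≡+ n) e) }

  infix 4 _reducesTo_
  -- The integer r is a residue of q, expressed without inverting the denominator; reductions add
  -- like elements of ℤ modulo p.
  record _reducesTo_ (q : ℚ) (r : ℤ) : Set where
    constructor reduces
    field
      p∤↧  : p ∤ ↧ₙ q
      ↥≡r↧ : ↥ q ≡ₚ r * ↧ q
  open _reducesTo_ public

  reducesTo-resp : ∀ {q r r′} → r ≡ₚ r′ → q reducesTo r → q reducesTo r′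
  reducesTo-resp {q} {r} {r′} e (reduces p∤q e′) = reduces p∤q (trans e′ (*-congʳ {↧ q} {r} {r′} e))

  cross-multiply : ∀ i n .{{_ : ℕ.NonZero n}} → ↥ (i / n) * + n ≡ i * ↧ (i / n)
  cross-multiply i n = begin
    ↥ q * + n                ≡⟨ ≡.cong (↥ q *_) (ℚₚ.↧-/ i n) ⟨
    ↥ q * (↧ q * g)          ≡⟨ solve 3 (λ a b g → a :* (b :* g) := (a :* g) :* b) ≡.refl (↥ q) (↧ q) g ⟩
    (↥ q * g) * ↧ q          ≡⟨ ≡.cong (_* ↧ q) (ℚₚ.↥-/ i n) ⟩
    i * ↧ q                  ∎
    where
    open ≡.≡-Reasoning
    q : ℚ
    q = i / n
    g : ℤ
    g = gcd i (+ n)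

  ↧∣denominator : ∀ i n .{{_ : ℕ.NonZero n}} → ↧ₙ (i / n) ∣ n
  ↧∣denominator i n = ℕ∣.divides ∣ g ∣ (≡.trans (≡.sym (≡.cong ∣_∣ (ℚₚ.↧-/ i n)))
    (≡.trans (ℤₚ.abs-* (↧ (i / n)) g) (ℕₚ.*-comm (↧ₙ (i / n)) ∣ g ∣)))
    where
    g : ℤ
    g = gcd i (+ n)

  -- `i / n` is stored in lowest terms. For q = i / n, n times ↥ q - r ↧ q equals (i - r n) ↧ q,
  -- which p divides, and n is cancelled.
  fraction : ∀ i n r .{{_ : ℕ.NonZero n}} → p ∤ n → i ≡ₚ r * + n → (i / n) reducesTo r
  fraction i n r p∤n i≡rn = reduces (λ p∣↧ → p∤n (ℕ∣.∣-trans p∣↧ (↧∣denominator i n)))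
    (x∙y⁻¹≈ε⇒x≈y (↥ q) (r * ↧ q) (cancelℤ n (↥ q ℤ.- r * ↧ q) p∤n
      (congruent-via (ℤ∣.∣m⇒∣m*n (↧ q) (p∣x-y i≡rn)) (≡.sym (≡.trans (ℤₚ.+-identityʳ _) difference)))))
    where
    q : ℚ
    q = i / n
    difference : + n * (↥ q ℤ.- r * ↧ q) ≡ (i ℤ.- r * + n) * ↧ q
    difference = begin
      + n * (↥ q ℤ.- r * ↧ q)            ≡⟨ solve 4 (λ n a r b → n :* (a :- r :* b) := a :* n :- r :* n :* b) ≡.refl (+ n) (↥ q) r (↧ q) ⟩
      ↥ q * + n ℤ.- r * + n * ↧ q        ≡⟨ ≡.cong (ℤ._- r * + n * ↧ q) (cross-multiply i n) ⟩
      i * ↧ q ℤ.- r * + n * ↧ q          ≡⟨ solve 4 (λ n i r b → i :* b :- r :* n :* b := (i :- r :* n) :* b) ≡.refl (+ n) i r (↧ q) ⟩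
      (i ℤ.- r * + n) * ↧ q              ∎
      where open ≡.≡-Reasoning

  ∤-* : ∀ {a b} → p ∤ a → p ∤ b → p ∤ a ℕ.* b
  ∤-* {a} {b} p∤a p∤b p∣ab with euclidsLemma a b prime p∣ab
  ... | inj₁ d = p∤a d
  ... | inj₂ d = p∤b d

  reduces-+ : ∀ {q q′ r r′} → q reducesTo r → q′ reducesTo r′ → (q ℚ.+ q′) reducesTo (r + r′)
  -- Exposing both records lets the rational sum unfold to the quotient to which `fraction` applies.
  reduces-+ {q@record{}} {q′@record{}} {r} {r′} (reduces p∤q e) (reduces p∤q′ e′) =
    fraction (↥ q * ↧ q′ + ↥ q′ * ↧ q) (↧ₙ q ℕ.* ↧ₙ q′) (r + r′) (∤-* p∤q p∤q′)
      (congruent-via (ℤ∣.∣m∣n⇒∣m+n (ℤ∣.∣m⇒∣m*n (↧ q′) (p∣x-y e)) (ℤ∣.∣m⇒∣m*n (↧ q) (p∣x-y e′))) (≡.trans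
        (solve 6 (λ a b r d r′ d′ → (a :- r :* d) :* d′ :+ (b :- r′ :* d′) :* d := a :* d′ :+ b :* d :- (r :+ r′) :* (d :* d′)) ≡.refl (↥ q) (↥ q′) r (↧ q) r′ (↧ q′))
        (≡.cong (λ z → ↥ q * ↧ q′ + ↥ q′ * ↧ q ℤ.- (r + r′) * z) (≡.sym (ℤₚ.pos-* (↧ₙ q) (↧ₙ q′))))))

  reduces-neg : ∀ {q r} → q reducesTo r → (ℚ.- q) reducesTo (ℤ.- r)
  reduces-neg {q} {r} (reduces p∤q e) = reduces
    (λ p∣ → p∤q (≡.subst (p ∣_) (≡.cong ∣_∣ (ℚₚ.↧-neg q)) p∣))
    (≡.subst₂ (λ a b → a ≡ₚ ℤ.- r * b) (≡.sym (ℚₚ.↥-neg q)) (≡.sym (ℚₚ.↧-neg q))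
      (trans (-‿cong e) (reflexiveₚ (ℤₚ.neg-distribˡ-* r (↧ q)))))

  p∤1 : p ∤ 1
  p∤1 p∣1 = ℕ.nonTrivial⇒≢1 {{prime⇒nonTrivial prime}} (ℕ∣.∣1⇒≡1 p∣1)

  reduces-/1 : ∀ c → (c / 1) reducesTo c
  reduces-/1 c = fraction c 1 c p∤1 (reflexiveₚ (≡.sym (ℤₚ.*-identityʳ c)))

  -- The difference q - c reduces to c - c, so p divides its numerator.
  reduces⇒modℚ : ∀ {q c} → q reducesTo c → q ≡ (c / 1) [modℚ p ]
  reduces⇒modℚ {q} {c} e = p∤↧ e , p∤↧ (reduces-/1 c) ,
    ≡ₚ0⇒∣ (trans (↥≡r↧ d) (reflexiveₚ (≡.trans (≡.cong (_* ↧ (q ℚ.- c / 1)) (ℤₚ.+-inverseʳ c)) (ℤₚ.*-zeroˡ (↧ (q ℚ.- c / 1))))))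
    where
    d : (q ℚ.- c / 1) reducesTo (c ℤ.- c)
    d = reduces-+ e (reduces-neg (reduces-/1 c))

  module _ (h : ℤ) (8h≡1 : ι 8 * h ≡ₚ + 1) (p∤8 : p ∤ 8) where

    ∤-8^ : ∀ n → p ∤ 8 ℕ.^ n
    ∤-8^ zero    = p∤1
    ∤-8^ (suc n) = ∤-* p∤8 (∤-8^ n)

    term-reduces : ∀ n → term n reducesTo (h ^ᶻ n * ι (A n))
    term-reduces n = fraction (+ A n) (8 ℕ.^ n) (h ^ᶻ n * ι (A n)) {{ℕₚ.m^n≢0 8 n}} (∤-8^ n) (sym (begin
      h ^ᶻ n * ι (A n) * + (8 ℕ.^ n)
        ≡⟨ ≡.cong₂ (λ a b → h ^ᶻ n * a * b) (ι≡+ (A n)) (≡.sym (ι≡+ (8 ℕ.^ n))) ⟩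
      h ^ᶻ n * + A n * ι (8 ℕ.^ n)
        ≡⟨ solve 3 (λ x y z → x :* y :* z := z :* x :* y) ≡.refl (h ^ᶻ n) (+ A n) (ι (8 ℕ.^ n)) ⟩
      ι (8 ℕ.^ n) * h ^ᶻ n * + A n
        ≈⟨ *-congʳ {+ A n} {ι (8 ℕ.^ n) * h ^ᶻ n} {+ 1} inverse ⟩
      + 1 * + A n
        ≡⟨ ℤₚ.*-identityˡ (+ A n) ⟩
      + A n ∎))
      where
      open RingTools ℤ/p using (begin_; step-≈-⟩; step-≈-⟨; step-≡-⟩; step-≡-⟨; _∎)
      inverse : ι (8 ℕ.^ n) * h ^ᶻ n ≡ₚ + 1
      inverse = begin
        ι (8 ℕ.^ n) * h ^ᶻ n      ≈⟨ *-congʳ {h ^ᶻ n} {ι (8 ℕ.^ n)} {ι 8 ^ᶻ n} (ι-^ 8 n) ⟩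
        ι 8 ^ᶻ n * h ^ᶻ n         ≈⟨ ^-distrib-* (ι 8) h n ⟨
        (ι 8 * h) ^ᶻ n            ≈⟨ ^-congˡ n 8h≡1 ⟩
        (+ 1) ^ᶻ n                ≈⟨ 1^n≈1 n ⟩
        + 1                       ∎

    sumQ-reduces : ∀ N → sumQ N reducesTo (∑ N (λ n → h ^ᶻ n * ι (A n)))
    sumQ-reduces N = go (λ n → n) N
      where
      go : ∀ f N → foldr ℚ._+_ ℚ.0ℚ (map term (applyUpTo f N)) reducesTo (∑ N (λ n → h ^ᶻ f n * ι (A (f n))))
      go f zero    = reduces p∤1 (sym (*-congʳ {+ 1} (∑-empty (λ n → h ^ᶻ f n * ι (A (f n))))))
      go f (suc N) = reducesTo-resp (sym (∑-suc N (λ n → h ^ᶻ f n * ι (A (f n))))) (reduces-+ (term-reduces (f 0)) (go (λ n → f (suc n)) N))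

-- Representations of primes by x² + 2y²

module Representations where
  open Squares using (+sq)
  open ℤ-Solver.+-*-Solver

  -- Only the residues of x and y modulo 8 matter, and the 64 cases are decided by computation.
  represented-% : ∀ x y → (x ℕ.* x ℕ.+ 2 ℕ.* (y ℕ.* y)) % 8 ≢ 5 × (x ℕ.* x ℕ.+ 2 ℕ.* (y ℕ.* y)) % 8 ≢ 7
  represented-% x y = ≡.subst (λ r → r ≢ 5 × r ≢ 7) (≡.sym reduce)
    (≡.subst₂ (λ a b → (a ℕ.* a ℕ.+ 2 ℕ.* (b ℕ.* b)) % 8 ≢ 5 × (a ℕ.* a ℕ.+ 2 ℕ.* (b ℕ.* b)) % 8 ≢ 7) (toℕ-fromℕ< (m%n<n x 8)) (toℕ-fromℕ< (m%n<n y 8))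
      (residues (fromℕ< (m%n<n x 8)) (fromℕ< (m%n<n y 8))))
    where
    residues : (a b : Fin 8) → (toℕ a ℕ.* toℕ a ℕ.+ 2 ℕ.* (toℕ b ℕ.* toℕ b)) % 8 ≢ 5 × (toℕ a ℕ.* toℕ a ℕ.+ 2 ℕ.* (toℕ b ℕ.* toℕ b)) % 8 ≢ 7
    residues = from-yes (all? λ a → all? λ b → ¬? (f a b ℕ.≟ 5) ×-dec ¬? (f a b ℕ.≟ 7))
      where
      f : Fin 8 → Fin 8 → ℕ
      f a b = (toℕ a ℕ.* toℕ a ℕ.+ 2 ℕ.* (toℕ b ℕ.* toℕ b)) % 8
    square : ∀ x → (x ℕ.* x) % 8 ≡ ((x % 8) ℕ.* (x % 8)) % 8
    square x = %-distribˡ-* x x 8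
    reduce : (x ℕ.* x ℕ.+ 2 ℕ.* (y ℕ.* y)) % 8 ≡ ((x % 8) ℕ.* (x % 8) ℕ.+ 2 ℕ.* ((y % 8) ℕ.* (y % 8))) % 8
    reduce = ≡.trans (%-distribˡ-+ (x ℕ.* x) (2 ℕ.* (y ℕ.* y)) 8)
      (≡.trans (≡.cong₂ (λ a b → (a ℕ.+ b) % 8) (square x)
        (≡.trans (%-distribˡ-* 2 (y ℕ.* y) 8) (≡.trans (≡.cong (λ z → (2 ℕ.* z) % 8) (square y)) (≡.sym (≡.trans (%-distribˡ-* 2 ((y % 8) ℕ.* (y % 8)) 8) ≡.refl)))))
        (≡.sym (%-distribˡ-+ ((x % 8) ℕ.* (x % 8)) (2 ℕ.* ((y % 8) ℕ.* (y % 8))) 8)))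

  private
    -- A nonzero multiple z of p would give 2z² ≥ 2p² > p².
    multiple-vanishes : ∀ p w z → + p * + p ≡ w * w + + 2 * (z * z) → .{{ℕ.NonZero p}} → p ∣ ∣ z ∣ → z ≡ + 0
    multiple-vanishes p w z e p∣z with ∣ z ∣ ℕ.≟ 0
    ... | yes ∣z∣≡0 = ℤₚ.∣i∣≡0⇒i≡0 ∣z∣≡0
    ... | no ∣z∣≢0  = contradiction
        (ℕₚ.≤-trans (ℕₚ.+-mono-≤ pp≤zz pp≤zz) (ℕₚ.≤-trans (ℕₚ.≤-reflexive (≡.cong (zz ℕ.+_) (≡.sym (ℕₚ.+-identityʳ zz))))
          (ℕₚ.≤-trans (ℕₚ.m≤n+m (2 ℕ.* zz) (∣ w ∣ ℕ.* ∣ w ∣)) (ℕₚ.≤-reflexive (≡.sym e′)))))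
        (ℕₚ.<⇒≱ (ℕₚ.m<m+n (p ℕ.* p) (ℕₚ.≤-trans (ℕ.>-nonZero⁻¹ p) (ℕₚ.m≤m*n p p))))
      where
      zz : ℕ
      zz = ∣ z ∣ ℕ.* ∣ z ∣
      p≤z : p ≤ ∣ z ∣
      p≤z = ℕ∣.∣⇒≤ {{ℕ.≢-nonZero ∣z∣≢0}} p∣z
      pp≤zz : p ℕ.* p ≤ zz
      pp≤zz = ℕₚ.*-mono-≤ p≤z p≤z
      e′ : p ℕ.* p ≡ ∣ w ∣ ℕ.* ∣ w ∣ ℕ.+ 2 ℕ.* zz
      e′ = ℤₚ.+-injective (≡.trans (ℤₚ.pos-* p p) (≡.trans e (≡.sym (≡.trans (ℤₚ.pos-+ (∣ w ∣ ℕ.* ∣ w ∣) (2 ℕ.* zz))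
        (≡.cong₂ _+_ (+sq w) (≡.trans (ℤₚ.pos-* 2 zz) (≡.cong (λ z → + 2 * z) (+sq z))))))))

  -- Since (xv-uy)(xv+uy) = p(v²-y²), p divides one of the factors. Brahmagupta's identity p² =
  -- (xu±2yv)² + 2(xv∓uy)² forces that factor to be 0. Finally p(u²-x²) = -2(xv-uy)(xv+uy) = 0.
  unique-representation : ∀ {p} → Prime p → ∀ x y u v → + p ≡ x * x + + 2 * (y * y) → + p ≡ u * u + + 2 * (v * v) → u * u ≡ x * x
  unique-representation {p} isPrime x y u v e e′ = ℤₚ.*-cancelˡ-≡ (+ p) (u * u) (x * x) {{nz}} (squares (zero-case (euclidsLemma ∣ z₁ ∣ ∣ z₂ ∣ isPrime p∣z₁z₂)))
    where
    instance
      nonZero : ℕ.NonZero p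
      nonZero = ℕ.nonTrivial⇒nonZero p {{prime⇒nonTrivial isPrime}}
    nz : ℤ.NonZero (+ p)
    nz = nonZero
    z₁ z₂ : ℤ
    z₁ = x * v ℤ.- u * y
    z₂ = x * v + u * y
    p∣z₁z₂ : p ∣ ∣ z₁ ∣ ℕ.* ∣ z₂ ∣
    p∣z₁z₂ = ≡.subst (p ∣_) (ℤₚ.abs-* z₁ z₂) (ℤ∣.∣⇒∣ᵤ {+ p} {z₁ * z₂} (ℤ∣.divides (v * v ℤ.- y * y) (≡.trans
      (solve 4 (λ x y u v → (x :* v :- u :* y) :* (x :* v :+ u :* y) := v :* v :* (x :* x :+ con (+ 2) :* (y :* y)) :- y :* y :* (u :* u :+ con (+ 2) :* (v :* v))) ≡.refl x y u v)
      (≡.trans (≡.cong₂ (λ a b → v * v * a ℤ.- y * y * b) (≡.sym e) (≡.sym e′))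
        (solve 3 (λ v y p → v :* v :* p :- y :* y :* p := (v :* v :- y :* y) :* p) ≡.refl v y (+ p))))))
    norm : + p * + p ≡ (x * x + + 2 * (y * y)) * (u * u + + 2 * (v * v))
    norm = ≡.cong₂ _*_ e e′
    zero-case : (p ∣ (∣ z₁ ∣)) ⊎ (p ∣ (∣ z₂ ∣)) → z₁ ≡ + 0 ⊎ z₂ ≡ + 0
    zero-case (inj₁ d) = inj₁ (multiple-vanishes p (x * u + + 2 * (y * v)) z₁ (≡.trans norm
      (solve 4 (λ x y u v → (x :* x :+ con (+ 2) :* (y :* y)) :* (u :* u :+ con (+ 2) :* (v :* v))
        := (x :* u :+ con (+ 2) :* (y :* v)) :* (x :* u :+ con (+ 2) :* (y :* v)) :+ con (+ 2) :* ((x :* v :- u :* y) :* (x :* v :- u :* y))) ≡.refl x y u v)) d)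
    zero-case (inj₂ d) = inj₂ (multiple-vanishes p (x * u ℤ.- + 2 * (y * v)) z₂ (≡.trans norm
      (solve 4 (λ x y u v → (x :* x :+ con (+ 2) :* (y :* y)) :* (u :* u :+ con (+ 2) :* (v :* v))
        := (x :* u :- con (+ 2) :* (y :* v)) :* (x :* u :- con (+ 2) :* (y :* v)) :+ con (+ 2) :* ((x :* v :+ u :* y) :* (x :* v :+ u :* y))) ≡.refl x y u v)) d)
    z₁z₂≡0 : z₁ ≡ + 0 ⊎ z₂ ≡ + 0 → z₁ * z₂ ≡ + 0
    z₁z₂≡0 (inj₁ e₁) = ≡.trans (≡.cong (_* z₂) e₁) (ℤₚ.*-zeroˡ z₂)
    z₁z₂≡0 (inj₂ e₂) = ≡.trans (≡.cong (z₁ *_) e₂) (ℤₚ.*-zeroʳ z₁)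
    squares : z₁ ≡ + 0 ⊎ z₂ ≡ + 0 → + p * (u * u) ≡ + p * (x * x)
    squares c = ≡.trans (≡.cong (_* (u * u)) e) (≡.trans
      (solve 4 (λ x y u v → (x :* x :+ con (+ 2) :* (y :* y)) :* (u :* u)
        := (u :* u :+ con (+ 2) :* (v :* v)) :* (x :* x) :- con (+ 2) :* ((x :* v :- u :* y) :* (x :* v :+ u :* y))) ≡.refl x y u v)
      (≡.trans (≡.cong₂ (λ a b → a * (x * x) ℤ.- + 2 * b) (≡.sym e′) (z₁z₂≡0 c)) (ℤₚ.+-identityʳ (+ p * (x * x)))))

  odd-prime : ∀ {p} → Prime p → p ≢ 2 → ∃ λ m → p ≡ suc (2 ℕ.* m)
  odd-prime {p} isPrime p≢2 with parity p
  ... | m , inj₂ e = m , ≡.trans e (≡.cong (λ k → suc (m ℕ.+ k)) (≡.sym (ℕₚ.+-identityʳ m)))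
  ... | m , inj₁ e with prime⇒irreducible isPrime (ℕ∣.divides m (≡.trans e (≡.trans (≡.cong (m ℕ.+_) (≡.sym (ℕₚ.+-identityʳ m))) (ℕₚ.*-comm 2 m))))
  ...   | inj₁ ()
  ...   | inj₂ 2≡p = contradiction (≡.sym 2≡p) p≢2

  not-square : ∀ {p} → Prime p → ∀ x → p ≢ x ℕ.* x
  not-square {p} isPrime x e with prime⇒irreducible isPrime (ℕ∣.divides x e)
  ... | inj₁ ≡.refl = ℕ.nonTrivial⇒≢1 {{prime⇒nonTrivial isPrime}} e
  ... | inj₂ ≡.refl = ℕ.nonTrivial⇒≢1 {{prime⇒nonTrivial isPrime}} (ℕₚ.*-cancelˡ-≡ p 1 p {{ℕ.nonTrivial⇒nonZero p {{prime⇒nonTrivial isPrime}}}} (≡.trans (≡.sym e) (≡.sym (ℕₚ.*-identityʳ p))))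

-- The congruences for the prime p = 2m + 1

module OddPrime (m : ℕ) (isPrime : Prime (suc (2 ℕ.* m))) (p≢2 : suc (2 ℕ.* m) ≢ 2) where
  private
    p : ℕ
    p = suc (2 ℕ.* m)
  open Modular p
  open PrimeField p isPrime
  open Representations
  open Squares using (+sq)
  open DombTheta ℤ/p m characteristic
  open RingTools ℤ/p using (ι)

  p∤2 : p ∤ 2
  p∤2 p∣2 with prime⇒irreducible prime[2] p∣2
  ... | inj₁ p≡1 = ℕ.nonTrivial⇒≢1 {{prime⇒nonTrivial isPrime}} p≡1
  ... | inj₂ p≡2 = p≢2 p≡2

  p∤8 : p ∤ 8
  p∤8 = ∤-* p∤2 (∤-* p∤2 p∤2)

  -- 2(m+1) = p + 1 ≡ 1, so m + 1 is an inverse of 2 and its cube an inverse of 8.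
  ⅛ : ℤ
  ⅛ = + suc m * + suc m * + suc m

  8*⅛≡1 : ι 8 * ⅛ ≡ₚ + 1
  -- The quotient comes from (p+1)³ - 1 = (p² + 3p + 3) p.
  8*⅛≡1 = congruent-via (ℤ∣.divides (+ p * + p + + 3 * + p + + 3) ≡.refl) (≡.trans
    (≡.cong (λ p → (p * p + + 3 * p + + 3) * p) (≡.trans (ℤₚ.pos-+ 1 (2 ℕ.* m)) (≡.cong (λ z → + 1 + z) (ℤₚ.pos-* 2 m))))
    (≡.trans (solve 1 (λ m → let p = con (+ 1) :+ con (+ 2) :* m ; s = con (+ 1) :+ m in
                (p :* p :+ con (+ 3) :* p :+ con (+ 3)) :* p := con (+ 8) :* (s :* s :* s) :- con (+ 1)) ≡.refl (+ m))
      (≡.cong (λ s → + 8 * (s * s * s) ℤ.- + 1) (≡.sym (ℤₚ.pos-+ 1 m)))))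
    where open ℤ-Solver.+-*-Solver

  nonrepresented : (∀ x y → p ≢ x ℕ.* x ℕ.+ 2 ℕ.* (y ℕ.* y)) → sumQ p ≡ (+ 0 / 1) [modℚ p ]
  nonrepresented none = reduces⇒modℚ {sumQ p} {+ 0} (reducesTo-resp (domb-nonrepresented p∤2 ⅛ 8*⅛≡1 none) (sumQ-reduces ⅛ 8*⅛≡1 p∤8 p))

  not-even : ∀ k → p ≢ 2 ℕ.* k
  not-even k e with prime⇒irreducible isPrime {2} (ℕ∣.divides k (≡.trans e (ℕₚ.*-comm 2 k)))
  ... | inj₂ 2≡p = p≢2 (≡.sym 2≡p)

  represented : ∀ x y → p ≡ x ℕ.* x ℕ.+ 2 ℕ.* (y ℕ.* y) → sumQ p ≡ (+ (4 ℕ.* (x ℕ.* x)) / 1) [modℚ p ]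
  -- x = 0 would make p even and y = 0 would make it a square; once both are excluded, each of the
  -- two squares has exactly two roots.
  represented zero y p≡ = contradiction p≡ (not-even (y ℕ.* y))
  represented (suc x) zero p≡ = contradiction (≡.trans p≡ (ℕₚ.+-identityʳ _)) (not-square isPrime (suc x))
  represented (suc x) (suc y) p≡ = reduces⇒modℚ {sumQ p} {+ (4 ℕ.* (suc x ℕ.* suc x))}
    (reducesTo-resp (≡.subst (_ ≡ₚ_) (ι≡+ (4 ℕ.* (suc x ℕ.* suc x))) (domb-represented p∤2 ⅛ 8*⅛≡1 x y p≡ unique)) (sumQ-reduces ⅛ 8*⅛≡1 p∤8 p))
    where
    cast : ∀ u v → p ≡ u ℕ.* u ℕ.+ 2 ℕ.* (v ℕ.* v) → + p ≡ + u * + u + + 2 * (+ v * + v)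
    cast u v e = ≡.trans (≡.cong +_ e) (≡.trans (ℤₚ.pos-+ (u ℕ.* u) (2 ℕ.* (v ℕ.* v)))
      (≡.cong₂ _+_ (ℤₚ.pos-* u u) (≡.trans (ℤₚ.pos-* 2 (v ℕ.* v)) (≡.cong (λ z → + 2 * z) (ℤₚ.pos-* v v)))))
    unique : ∀ u v → p ≡ u ℕ.* u ℕ.+ 2 ℕ.* (v ℕ.* v) → u ℕ.* u ≡ suc x ℕ.* suc x
    unique u v e = ℤₚ.+-injective (≡.trans (ℤₚ.pos-* u u) (≡.trans
      (unique-representation isPrime (+ suc x) (+ suc y) (+ u) (+ v) (cast (suc x) (suc y) p≡) (cast u v e)) (≡.sym (ℤₚ.pos-* (suc x) (suc x)))))

  representedℤ : (x y : ℤ) → + p ≡ x * x + + 2 * (y * y) → sumQ p ≡ ((+ 4 * (x * x)) / 1) [modℚ p ]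
  representedℤ x y e = ≡.subst (λ c → sumQ p ≡ (c / 1) [modℚ p ])
    (≡.trans (ℤₚ.pos-* 4 (∣ x ∣ ℕ.* ∣ x ∣)) (≡.cong (λ z → + 4 * z) (+sq x)))
    (represented ∣ x ∣ ∣ y ∣ (ℤₚ.+-injective (≡.trans e (≡.sym (≡.trans (ℤₚ.pos-+ (∣ x ∣ ℕ.* ∣ x ∣) (2 ℕ.* (∣ y ∣ ℕ.* ∣ y ∣)))
      (≡.cong₂ _+_ (+sq x) (≡.trans (ℤₚ.pos-* 2 (∣ y ∣ ℕ.* ∣ y ∣)) (≡.cong (λ z → + 2 * z) (+sq y)))))))))

  residue-nonrepresented : p % 8 ≡ 5 ⊎ p % 8 ≡ 7 → ∀ x y → p ≢ x ℕ.* x ℕ.+ 2 ℕ.* (y ℕ.* y)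
  residue-nonrepresented (inj₁ r) x y e = proj₁ (represented-% x y) (≡.trans (≡.cong (_% 8) (≡.sym e)) r)
  residue-nonrepresented (inj₂ r) x y e = proj₂ (represented-% x y) (≡.trans (≡.cong (_% 8) (≡.sym e)) r)

sum-represented : ∀ {p} → ∃ (λ m → p ≡ suc (2 ℕ.* m)) → Prime p → p ≢ 2 →
  (x y : ℤ) → + p ≡ x * x + + 2 * (y * y) → sumQ p ≡ ((+ 4 * (x * x)) / 1) [modℚ p ]
sum-represented (m , ≡.refl) isPrime p≢2 = OddPrime.representedℤ m isPrime p≢2

sum-nonrepresented : ∀ {p} → ∃ (λ m → p ≡ suc (2 ℕ.* m)) → Prime p → p ≢ 2 →
  p % 8 ≡ 5 ⊎ p % 8 ≡ 7 → sumQ p ≡ (+ 0 / 1) [modℚ p ]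
sum-nonrepresented (m , ≡.refl) isPrime p≢2 r =
  OddPrime.nonrepresented m isPrime p≢2 (OddPrime.residue-nonrepresented m isPrime p≢2 r)

theorem3p4 : (p : ℕ) → Prime p → p ≢ 2 →
    ((p % 8 ≡ 1 ⊎ p % 8 ≡ 3) →
    (x y : ℤ) → + p ≡ x * x + + 2 * (y * y) →
    sumQ p ≡ ((+ 4 * (x * x)) / 1) [modℚ p ])
    × ((p % 8 ≡ 5 ⊎ p % 8 ≡ 7) → sumQ p ≡ (+ 0 / 1) [modℚ p ])
theorem3p4 p isPrime p≢2 =
  (λ _ → sum-represented (Representations.odd-prime isPrime p≢2) isPrime p≢2) ,
  sum-nonrepresented (Representations.odd-prime isPrime p≢2) isPrime p≢2
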